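{- Let $\eta>0$ and let $H$ be a graph with at least one edge and chromatic number $\chi(H)=r$ (so $r\ge 2$). Let $\sigma:=\sigma(H)$, $h:=|H|$ and $\omega:=(h-\sigma)/(r-1)$. Then there exists $n_0=n_0(\eta,H)\in\mathbb{N}$ such that the following holds: if $G$ is a graph on $n\ge n_0$ vertices with degree sequence $d_1\le d_2\le\dots\le d_n$ such that \[d_i\ge\left(1-\frac{\omega+\sigma}{h}\right)n+\frac{\sigma}{\omega}i\quad\text{for all } 1\le i\le \frac{\omega n}{h},\] then $G$ contains an $H$-tiling covering all but at most $\eta n$ vertices.
   Context: For a graph $H$, $\sigma(H)$ denotes the smallest possible size of a colour class over all proper colourings of $H$ with $\chi(H)$ colours. An $H$-tiling in a graph $G$ is a collection of vertex-disjoint copies of $H$ in $G$; it covers the vertices lying in these copies. The degree sequence $d_1\le\dots\le d_n$ of $G$ is the list of vertex degrees of $G$ in non-decreasing order. -}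

module Defs where

open import Data.Bool using (Bool; true; false)
open import Data.Nat as ℕ using (ℕ; zero; suc)
open import Data.Nat.Properties using (≤-decTotalOrder)
open import Data.Integer using (+_)
open import Data.Fin as Fin using (Fin)
open import Data.Vec using (allFin; countᵇ; map; toList)
open import Data.List using (List; []; _∷_)
open import Data.Product using (Σ; ∃; ∃-syntax; _×_; _,_)
open import Relation.Nullary using (¬_; yes; no)
open import Relation.Nullary.Decidable using (⌊_⌋)
open import Relation.Binary.PropositionalEquality using (_≡_; _≢_)
open import Data.Rational as ℚ using (ℚ; 0ℚ; _/_; _*_; _÷_; ≢-nonZero)
import Data.Rational.Properties as ℚP
import Data.List.Sort as Sort

record Graph (n : ℕ) : Set where
  field
    Adj   : Fin n → Fin n → Bool
    sym   : ∀ u v → Adj u v ≡ Adj v u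
    irrefl : ∀ v → Adj v v ≡ false
open Graph public

HasEdge : ∀ {h} → Graph h → Set
HasEdge H = ∃[ u ] ∃[ v ] Adj H u v ≡ true

ProperColouring : ∀ {h} → Graph h → (k : ℕ) → (Fin h → Fin k) → Set
ProperColouring H k c = ∀ u v → Adj H u v ≡ true → c u ≢ c v

Colourable : ∀ {h} → Graph h → ℕ → Set
Colourable H k = Σ (Fin _ → Fin k) (ProperColouring H k)

IsChromaticNumber : ∀ {h} → Graph h → ℕ → Set
IsChromaticNumber H r = Colourable H r × (∀ k → k ℕ.< r → ¬ Colourable H k)

classSize : ∀ {h k} → (Fin h → Fin k) → Fin k → ℕ
classSize {h} c j = countᵇ (λ v → ⌊ c v Fin.≟ j ⌋) (allFin h)

IsSigma : ∀ {h} → Graph h → (r s : ℕ) → Set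
IsSigma {h} H r s =
  (∃[ c ] ProperColouring H r c × ∃[ j ] classSize c j ≡ s)
  × (∀ (c : Fin h → Fin r) → ProperColouring H r c → ∀ j → s ℕ.≤ classSize c j)

degree : ∀ {n} → Graph n → Fin n → ℕ
degree {n} G v = countᵇ (Adj G v) (allFin n)

open Sort ≤-decTotalOrder using (sort)

degreeList : ∀ {n} → Graph n → List ℕ
degreeList {n} G = sort (toList (map (degree G) (allFin n)))

nth : List ℕ → ℕ → ℕ
nth []       _       = 0
nth (x ∷ xs) zero    = x
nth (x ∷ xs) (suc i) = nth xs i

-- d G i = dᵢ (1-indexed; meaningful for 1 ≤ i ≤ n)
d : ∀ {n} → Graph n → ℕ → ℕ
d G i = nth (degreeList G) (i ℕ.∸ 1)

record Tiling {h n : ℕ} (H : Graph h) (G : Graph n) : Set where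
  field
    copies : ℕ
    embed  : Fin copies → Fin h → Fin n
    edges  : ∀ k u v → Adj H u v ≡ true → Adj G (embed k u) (embed k v) ≡ true
    -- the copies are vertex-disjoint (and each copy is injective)
    disjoint : ∀ k k′ u u′ → embed k u ≡ embed k′ u′ → (k ≡ k′ × u ≡ u′)
open Tiling public

covered : ∀ {h n} {H : Graph h} {G : Graph n} → Tiling H G → ℕ
covered {h} T = copies T ℕ.* h

ℕ→ℚ : ℕ → ℚ
ℕ→ℚ n = (+ n) / 1

-- division, with the (irrelevant here) convention p ÷₀ 0 = 0
_÷₀_ : ℚ → ℚ → ℚ
p ÷₀ q with q ℚP.≟ 0ℚ
... | yes _  = 0ℚ
... | no q≢0 = _÷_ p q {{≢-nonZero q≢0}}

{-# OPTIONS --safe #-}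

-- The argument replaces regularity by a one-sided partition lemma and then works with
-- linear programming duality on the resulting reduced graph.
--
-- Partition.  Keep a set of "dead" pairs of parts that contains few edges.  As long as
-- the live pairs failing one-sided density (every pair of large subsets spans many edges)
-- have non-negligible total area, each contains a sparse sub-rectangle of proportional
-- area; refining by these and declaring them dead increases the dead area by a constant
-- fraction of n².  Hence boundedly many refinements suffice, and almost all edges end up
-- in pairs of parts that are dense in the one-sided sense.
--
-- Fractional tiling.  Let W and s be proportional to ω and σ.  Cover the reduced graph
-- exactly by bottles (r-cliques with part sizes W, …, W, s), allowing a universal dummy
-- vertex whose use is minimised, and let w be an optimal dual solution.  If dummies are
-- used at all, let Z be the set of clusters of maximal weight.  Replacing a vertex of a
-- bottle T in the support by v ∈ Z shows, by complementary slackness, that v misses weight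
-- at least W of T, and misses less than W + s only if it misses exactly one non-pointed
-- vertex, which then lies in Z.  Summing over the bottles gives
-- n − deg v ≥ (ω + σ) n / h − (σ/ω) |Z| and n − deg v ≥ ω n / h, both with a surplus
-- proportional to the dummy use.  Taking v ∈ Z of largest degree, the degree sequence
-- condition at i = min (|Z|, ω n / h) forces the dummy use to be negligible.
--
-- Finally the bottles without dummies are rounded down and realised greedily by copies
-- of H, the r − 1 rotations of the large colour classes making up one bottle.

module Submission where

open import Data.Nat as ℕ using (ℕ; zero; suc; z≤n; s≤s)
import Data.Nat.Properties as ℕP
open import Data.Integer as ℤ using (ℤ; +_; 0ℤ; 1ℤ)
import Data.Integer.Properties as ℤP
open import Data.Integer.Tactic.RingSolver using () renaming (solve-∀ to ℤ-ring)
open import Data.Nat.Tactic.RingSolver using () renaming (solve-∀ to ℕ-ring)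
open import Data.Bool using (Bool; true; false; not; _∧_; _∨_; if_then_else_)
open import Data.Fin as Fin using (Fin; zero; suc; _↑ˡ_; _↑ʳ_; splitAt; punchIn)
import Data.Fin.Properties as FinP
open import Data.Product using (∃-syntax; Σ-syntax; _×_; _,_; proj₁; proj₂)
open import Data.Sum using (_⊎_; inj₁; inj₂; [_,_]′)
open import Data.Empty using (⊥; ⊥-elim)
open import Function using (_∘_; id)
open import Relation.Binary using (Tri; tri<; tri≈; tri>)
open import Relation.Nullary using (¬_; Dec; yes; no; does; ¬?; _→-dec_; _×-dec_)
open import Relation.Nullary.Decidable using (dec-true; dec-false; decidable-stable)
import Data.Bool.Properties as BoolP
open import Relation.Binary.PropositionalEquality
  using (_≡_; _≢_; refl; sym; trans; cong; cong₂; subst; subst₂; module ≡-Reasoning)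

open import Data.Vec using (Vec; lookup; tabulate)
import Data.Vec.Properties as VecP
open import Data.Fin.Subset using (Subset)
open import Data.Fin.Subset.Properties using (anySubset?)
open import Data.List as List using (List; []; _∷_; _++_)
open import Data.List.Relation.Unary.All using (All; []; _∷_)
open import Data.Nat.DivMod using (_%_; _/_; _mod_; m<n⇒m%n≡m; [m+n]%n≡m%n; m%n<n; m≡m%n+[m/n]*n; m/n*n≤m; m*n/n≡m; /-monoˡ-≤)
import Data.List.Properties as ListP
import Data.List.Relation.Unary.All.Properties as AllP
import Data.Vec as Vec
import Data.Nat.ListAction as ListAction
import Data.Nat.ListAction.Properties as ListActionP
open import Data.List.Relation.Binary.Permutation.Propositional using (_↭_)
import Data.List.Relation.Binary.Permutation.Propositional.Properties as PermP
open import Data.List.Relation.Unary.AllPairs using (AllPairs; []; _∷_)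
import Data.List.Relation.Unary.Linked.Properties as LinkedP
import Data.List.Sort as Sort
import Data.Fin.Permutation.Components as PC
open import Data.Rational as ℚ using (ℚ; 0ℚ; 1ℚ)
import Data.Rational.Properties as ℚP
open import Data.Rational.Unnormalised as ℚᵘ using (mkℚᵘ; *≡*; *≤*; *<*)
import Data.Rational.Unnormalised.Properties as ℚᵘP
import Data.Rational.Solver as ℚSolver
open import Relation.Nullary.Decidable using (isYes≗does)
open import Defs using (Graph; HasEdge; ProperColouring; Colourable; IsChromaticNumber; IsSigma; classSize; degree; nth; Tiling; covered; ℕ→ℚ; _÷₀_)
import Algebra.Properties.Semiring.Sum as SemiringSum


-- Finite sums and the Farkas lemma

-- The swapping argument rests on complementary slackness, so an exact optimum is needed and an
-- approximate one would not do. Everything is therefore kept integral: `W`, `s` and `P` are ω, σ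
-- and h multiplied by r - 1, and fractional solutions carry a common denominator `μ`. Universal
-- dummies make the program feasible for every reduced graph; a failure to tile then shows up as
-- dummy use, a number that can be bounded. Embedding a fixed graph asks only for lower bounds on
-- density between large subsets, which is why a one-sided notion is refined. Parts may have any
-- sizes, so clusters are weighted by the number of vertices they keep. The degree hypothesis is
-- applied to actual vertices and never transferred to clusters: fewer than i vertices have degree
-- below the i-th entry of the sequence, so any i vertices lying in clusters of Z include one of at
-- least that degree.

module ΣN = SemiringSum ℕP.+-*-semiring
module ΣZ = SemiringSum (ℤP.+-*-semiring)

0≤* : ∀ {a b} → 0ℤ ℤ.≤ a → 0ℤ ℤ.≤ b → 0ℤ ℤ.≤ a ℤ.* b
0≤* {a} {b} p q = subst (ℤ._≤ a ℤ.* b) (ℤP.*-zeroʳ a)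
  (ℤP.*-monoˡ-≤-nonNeg a ⦃ ℤ.nonNegative p ⦄ q)

0<* : ∀ {a b} → 0ℤ ℤ.< a → 0ℤ ℤ.< b → 0ℤ ℤ.< a ℤ.* b
0<* {a} {b} p q = subst (ℤ._< a ℤ.* b) (ℤP.*-zeroʳ a)
  (ℤP.*-monoˡ-<-pos a ⦃ ℤ.positive p ⦄ q)

≤0⇒0≤- : ∀ {a} → a ℤ.≤ 0ℤ → 0ℤ ℤ.≤ ℤ.- a
≤0⇒0≤- = ℤP.neg-mono-≤

0≤-⇒≤0 : ∀ {a} → 0ℤ ℤ.≤ ℤ.- a → a ℤ.≤ 0ℤ
0≤-⇒≤0 {a} p = subst (ℤ._≤ 0ℤ) (ℤP.neg-involutive a) (ℤP.neg-mono-≤ p)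


opaque
  ∑ : ∀ {n} → (Fin n → ℕ) → ℕ
  ∑ = ΣN.sum

  ∑-[] : (f : Fin 0 → ℕ) → ∑ f ≡ 0
  ∑-[] f = refl

  ∑-∷ : ∀ {n} (f : Fin (suc n) → ℕ) → ∑ f ≡ f zero ℕ.+ ∑ (λ i → f (suc i))
  ∑-∷ f = refl

  ∑-cong : ∀ {n} {f g : Fin n → ℕ} → (∀ i → f i ≡ g i) → ∑ f ≡ ∑ g
  ∑-cong = ΣN.sum-cong-≗

  ∑-mono : ∀ {n} {f g : Fin n → ℕ} → (∀ i → f i ℕ.≤ g i) → ∑ f ℕ.≤ ∑ g
  ∑-mono {zero}  p = z≤n
  ∑-mono {suc n} p = ℕP.+-mono-≤ (p zero) (∑-mono (λ i → p (suc i)))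

  ∑-+ : ∀ {n} (f g : Fin n → ℕ) → ∑ (λ i → f i ℕ.+ g i) ≡ ∑ f ℕ.+ ∑ g
  ∑-+ = ΣN.∑-distrib-+

  ∑-*ˡ : ∀ {n} c (f : Fin n → ℕ) → ∑ (λ i → c ℕ.* f i) ≡ c ℕ.* ∑ f
  ∑-*ˡ c f = sym (ΣN.*-distribˡ-sum c f)

  ∑-*ʳ : ∀ {n} c (f : Fin n → ℕ) → ∑ (λ i → f i ℕ.* c) ≡ ∑ f ℕ.* c
  ∑-*ʳ c f = sym (ΣN.*-distribʳ-sum c f)

  ∑-swap : ∀ {m n} (f : Fin m → Fin n → ℕ) → ∑ (λ i → ∑ (f i)) ≡ ∑ (λ j → ∑ (λ i → f i j))
  ∑-swap = ΣN.∑-comm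

  ∑-const : ∀ n c → ∑ {n} (λ _ → c) ≡ n ℕ.* c
  ∑-const zero    c = refl
  ∑-const (suc n) c = cong (c ℕ.+_) (∑-const n c)

  ∑-remove : ∀ {n} (i : Fin (suc n)) (f : Fin (suc n) → ℕ) → ∑ f ≡ f i ℕ.+ ∑ (f ∘ punchIn i)
  ∑-remove i f = ΣN.sum-remove {i = i} f

  ∑ᶻ : ∀ {n} → (Fin n → ℤ) → ℤ
  ∑ᶻ = ΣZ.sum

  ∑ᶻ-[] : (f : Fin 0 → ℤ) → ∑ᶻ f ≡ 0ℤ
  ∑ᶻ-[] f = refl

  ∑ᶻ-∷ : ∀ {n} (f : Fin (suc n) → ℤ) → ∑ᶻ f ≡ f zero ℤ.+ ∑ᶻ (λ i → f (suc i))
  ∑ᶻ-∷ f = refl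

  ∑ᶻ-cong : ∀ {n} {f g : Fin n → ℤ} → (∀ i → f i ≡ g i) → ∑ᶻ f ≡ ∑ᶻ g
  ∑ᶻ-cong = ΣZ.sum-cong-≗

  ∑ᶻ-mono : ∀ {n} {f g : Fin n → ℤ} → (∀ i → f i ℤ.≤ g i) → ∑ᶻ f ℤ.≤ ∑ᶻ g
  ∑ᶻ-mono {zero}  p = ℤP.≤-refl
  ∑ᶻ-mono {suc n} p = ℤP.+-mono-≤ (p zero) (∑ᶻ-mono (λ i → p (suc i)))

  ∑ᶻ-comb : ∀ {n} s t (f g : Fin n → ℤ) →
    ∑ᶻ (λ i → s ℤ.* f i ℤ.+ t ℤ.* g i) ≡ s ℤ.* ∑ᶻ f ℤ.+ t ℤ.* ∑ᶻ g
  ∑ᶻ-comb s t f g = trans (ΣZ.∑-distrib-+ (λ i → s ℤ.* f i) (λ i → t ℤ.* g i))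
    (cong₂ ℤ._+_ (sym (ΣZ.*-distribˡ-sum s f)) (sym (ΣZ.*-distribˡ-sum t g)))

  ∑ᶻ-+ : ∀ {n} (f g : Fin n → ℤ) → ∑ᶻ (λ i → f i ℤ.+ g i) ≡ ∑ᶻ f ℤ.+ ∑ᶻ g
  ∑ᶻ-+ = ΣZ.∑-distrib-+

  ∑ᶻ-*ˡ : ∀ {n} c (f : Fin n → ℤ) → ∑ᶻ (λ i → c ℤ.* f i) ≡ c ℤ.* ∑ᶻ f
  ∑ᶻ-*ˡ c f = sym (ΣZ.*-distribˡ-sum c f)

  ∑ᶻ-swap : ∀ {m n} (f : Fin m → Fin n → ℤ) → ∑ᶻ (λ i → ∑ᶻ (f i)) ≡ ∑ᶻ (λ j → ∑ᶻ (λ i → f i j))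
  ∑ᶻ-swap = ΣZ.∑-comm

  ∑ᶻ-remove : ∀ {n} (i : Fin (suc n)) (f : Fin (suc n) → ℤ) → ∑ᶻ f ≡ f i ℤ.+ ∑ᶻ (f ∘ punchIn i)
  ∑ᶻ-remove i f = ΣZ.sum-remove {i = i} f

  ∑ᶻ-split : ∀ m {n} (f : Fin (m ℕ.+ n) → ℤ) → ∑ᶻ f ≡ ∑ᶻ (λ i → f (i ↑ˡ n)) ℤ.+ ∑ᶻ (λ i → f (m ↑ʳ i))
  ∑ᶻ-split zero    f = sym (ℤP.+-identityˡ _)
  ∑ᶻ-split (suc m) f = trans (cong (λ t → f zero ℤ.+ t) (∑ᶻ-split m (f ∘ suc))) (sym (ℤP.+-assoc (f zero) _ _))

  ∑ᶻ-+◃ : ∀ {n} (f : Fin n → ℕ) → ∑ᶻ (λ i → + f i) ≡ + ∑ f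
  ∑ᶻ-+◃ {zero}  f = refl
  ∑ᶻ-+◃ {suc n} f = cong (λ t → + f zero ℤ.+ t) (∑ᶻ-+◃ (f ∘ suc))

∑ᶻ-zero : ∀ {n} (f : Fin n → ℤ) → (∀ i → f i ≡ 0ℤ) → ∑ᶻ f ≡ 0ℤ
∑ᶻ-zero {n} f p = trans (∑ᶻ-cong {g = λ _ → 0ℤ ℤ.* 0ℤ} p) (∑ᶻ-*ˡ {n} 0ℤ (λ _ → 0ℤ))

0≤∑ᶻ : ∀ {n} (f : Fin n → ℤ) → (∀ i → 0ℤ ℤ.≤ f i) → 0ℤ ℤ.≤ ∑ᶻ f
0≤∑ᶻ {n} f p = subst (ℤ._≤ ∑ᶻ f) (∑ᶻ-zero {n} (λ _ → 0ℤ) (λ _ → refl)) (∑ᶻ-mono p)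

-- Fraction-free form of Bartl's induction: when the separator y of the smaller
-- system is violated by a₀, all other vectors are projected along a₀ onto y⊥.
module Farkas
  (V : Set) (comb : ℤ → V → ℤ → V → V) (⟨_,_⟩ : V → V → ℤ)
  (⟨⟩-comm : ∀ u v → ⟨ u , v ⟩ ≡ ⟨ v , u ⟩)
  (⟨⟩-comb : ∀ s u t v z → ⟨ comb s u t v , z ⟩ ≡ s ℤ.* ⟨ u , z ⟩ ℤ.+ t ℤ.* ⟨ v , z ⟩)
  (null? : ∀ b → (∀ y → ⟨ y , b ⟩ ≡ 0ℤ) ⊎ (0ℤ ℤ.< ⟨ b , b ⟩))
  where

  -- Over ℤ a conic combination exists only after clearing denominators, hence the positive factor
  -- `μ` on `b`. Vectors are compared through their pairings with every `y`.
  InCone : ∀ {m} → (Fin m → V) → V → Set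
  InCone {m} a b = Σ[ μ ∈ ℤ ] Σ[ x ∈ (Fin m → ℤ) ] (0ℤ ℤ.< μ) × (∀ j → 0ℤ ℤ.≤ x j)
    × (∀ y → ∑ᶻ (λ j → x j ℤ.* ⟨ y , a j ⟩) ≡ μ ℤ.* ⟨ y , b ⟩)

  Separated : ∀ {m} → (Fin m → V) → V → Set
  Separated a b = Σ[ y ∈ V ] (∀ j → ⟨ y , a j ⟩ ℤ.≤ 0ℤ) × (0ℤ ℤ.< ⟨ y , b ⟩)

  ⟨⟩-combʳ : ∀ s u t v z → ⟨ z , comb s u t v ⟩ ≡ s ℤ.* ⟨ z , u ⟩ ℤ.+ t ℤ.* ⟨ z , v ⟩
  ⟨⟩-combʳ s u t v z = trans (⟨⟩-comm z _) (trans (⟨⟩-comb s u t v z)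
    (cong₂ (λ p q → s ℤ.* p ℤ.+ t ℤ.* q) (⟨⟩-comm u z) (⟨⟩-comm v z)))

  farkas : ∀ m (a : Fin m → V) b → InCone a b ⊎ Separated a b
  farkas zero a b with null? b
  ... | inj₁ nul = inj₁ (1ℤ , (λ ()) , ℤ.+<+ (s≤s z≤n) , (λ ()) ,
                         λ y → trans (∑ᶻ-[] _) (sym (trans (cong (1ℤ ℤ.*_) (nul y)) (ℤP.*-zeroʳ 1ℤ))))
  ... | inj₂ pos = inj₂ (b , (λ ()) , pos)
  farkas (suc m) a b with farkas m (a ∘ suc) b
  ... | inj₁ (μ , x , μ>0 , x≥0 , eq) = inj₁ (μ , x′ , μ>0 , x′≥0 , eq′)
    where
    x′ : Fin (suc m) → ℤ
    x′ zero    = 0ℤ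
    x′ (suc j) = x j
    x′≥0 : ∀ j → 0ℤ ℤ.≤ x′ j
    x′≥0 zero    = ℤP.≤-refl
    x′≥0 (suc j) = x≥0 j
    eq′ : ∀ y → ∑ᶻ (λ j → x′ j ℤ.* ⟨ y , a j ⟩) ≡ μ ℤ.* ⟨ y , b ⟩
    eq′ y = trans (∑ᶻ-∷ _) (trans (cong₂ ℤ._+_ (ℤP.*-zeroˡ ⟨ y , a zero ⟩) (eq y)) (ℤP.+-identityˡ _))
  ... | inj₂ (y , y≤0 , y>0) with ⟨ y , a zero ⟩ ℤ.≤? 0ℤ
  ...   | yes p = inj₂ (y , (λ { zero → p ; (suc j) → y≤0 j }) , y>0)
  ...   | no ¬p with farkas m a′ b′
    where
    β = ⟨ y , a zero ⟩
    a′ = λ j → comb β (a (suc j)) (ℤ.- ⟨ y , a (suc j) ⟩) (a zero)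
    b′ = comb β b (ℤ.- ⟨ y , b ⟩) (a zero)
  ...     | inj₂ (z , z≤0 , z>0) = inj₂ (z″ , z″≤0 , subst (0ℤ ℤ.<_) (same b) z>0)
    where
    β = ⟨ y , a zero ⟩
    z″ = comb β z (ℤ.- ⟨ z , a zero ⟩) y
    -- Pairing `z` with a projected vector is pairing the pulled back `z″` with the original one,
    -- and `z″` vanishes on `a zero`. So a separator of the projected system separates the full one.
    same : ∀ v → ⟨ z , comb β v (ℤ.- ⟨ y , v ⟩) (a zero) ⟩ ≡ ⟨ z″ , v ⟩
    same v = trans (⟨⟩-combʳ β v _ (a zero) z) (trans
      (lemma β ⟨ z , v ⟩ ⟨ y , v ⟩ ⟨ z , a zero ⟩) (sym (⟨⟩-comb β z _ y v)))
      where
      lemma : ∀ β p q r → β ℤ.* p ℤ.+ ℤ.- q ℤ.* r ≡ β ℤ.* p ℤ.+ ℤ.- r ℤ.* q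
      lemma = ℤ-ring
    z″≤0 : ∀ j → ⟨ z″ , a j ⟩ ℤ.≤ 0ℤ
    z″≤0 zero    = ℤP.≤-reflexive (trans (⟨⟩-comb β z _ y (a zero)) (lemma β ⟨ z , a zero ⟩))
      where
      lemma : ∀ β p → β ℤ.* p ℤ.+ ℤ.- p ℤ.* β ≡ 0ℤ
      lemma = ℤ-ring
    z″≤0 (suc j) = subst (ℤ._≤ 0ℤ) (same (a (suc j))) (z≤0 j)
  ...     | inj₁ (μ , x , μ>0 , x≥0 , eq) = inj₁ (μ ℤ.* β , x′ , 0<* μ>0 β>0 , x′≥0 , eq′)
    where
    β = ⟨ y , a zero ⟩
    β>0 : 0ℤ ℤ.< β
    β>0 = ℤP.≰⇒> ¬p
    ξ = ∑ᶻ (λ j → x j ℤ.* ⟨ y , a (suc j) ⟩)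
    x′ : Fin (suc m) → ℤ
    -- This coefficient collects the multiples of `a zero` hidden in the projected vectors. It is
    -- nonnegative because `y` is positive on `b` and nonpositive on the vectors behind `ξ`.
    x′ zero    = μ ℤ.* ⟨ y , b ⟩ ℤ.- ξ
    x′ (suc j) = β ℤ.* x j
    ξ≤0 : 0ℤ ℤ.≤ ℤ.- ξ
    ξ≤0 = subst (0ℤ ℤ.≤_) (trans (∑ᶻ-*ˡ ℤ.-1ℤ _) (ℤP.-1*i≡-i ξ))
      (0≤∑ᶻ _ λ j → subst (0ℤ ℤ.≤_) (lemma (x j) ⟨ y , a (suc j) ⟩) (0≤* (x≥0 j) (≤0⇒0≤- (y≤0 j))))
      where
      lemma : ∀ p q → p ℤ.* ℤ.- q ≡ ℤ.-1ℤ ℤ.* (p ℤ.* q)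
      lemma = ℤ-ring
    x′≥0 : ∀ j → 0ℤ ℤ.≤ x′ j
    x′≥0 zero    = ℤP.+-mono-≤ (ℤP.<⇒≤ (0<* μ>0 y>0)) ξ≤0
    x′≥0 (suc j) = 0≤* (ℤP.<⇒≤ β>0) (x≥0 j)
    eq′ : ∀ z → ∑ᶻ (λ j → x′ j ℤ.* ⟨ z , a j ⟩) ≡ (μ ℤ.* β) ℤ.* ⟨ z , b ⟩
    eq′ z = trans (∑ᶻ-∷ _) (trans (cong (λ t → x′ zero ℤ.* ⟨ z , a zero ⟩ ℤ.+ t) rest)
                  (lemma (μ ℤ.* ⟨ y , b ⟩) ξ ⟨ z , a zero ⟩ β _ (trans (sym lhs) mid)))
      where
      Q = ∑ᶻ (λ j → x j ℤ.* ⟨ z , a (suc j) ⟩)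
      rest : ∑ᶻ (λ j → (β ℤ.* x j) ℤ.* ⟨ z , a (suc j) ⟩) ≡ β ℤ.* Q
      rest = trans (∑ᶻ-cong (λ j → ℤP.*-assoc β (x j) _)) (∑ᶻ-*ˡ β _)
      lhs : ∑ᶻ (λ j → x j ℤ.* ⟨ z , comb β (a (suc j)) (ℤ.- ⟨ y , a (suc j) ⟩) (a zero) ⟩)
            ≡ β ℤ.* Q ℤ.+ ℤ.- ⟨ z , a zero ⟩ ℤ.* ξ
      lhs = trans (∑ᶻ-cong λ j → trans (cong (x j ℤ.*_) (⟨⟩-combʳ β (a (suc j)) _ (a zero) z))
                (l (x j) β ⟨ z , a (suc j) ⟩ ⟨ y , a (suc j) ⟩ ⟨ z , a zero ⟩))
              (∑ᶻ-comb β (ℤ.- ⟨ z , a zero ⟩) _ _)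
        where
        l : ∀ x β p q r → x ℤ.* (β ℤ.* p ℤ.+ ℤ.- q ℤ.* r) ≡ β ℤ.* (x ℤ.* p) ℤ.+ ℤ.- r ℤ.* (x ℤ.* q)
        l = ℤ-ring
      mid : ∑ᶻ (λ j → x j ℤ.* ⟨ z , comb β (a (suc j)) (ℤ.- ⟨ y , a (suc j) ⟩) (a zero) ⟩)
            ≡ (μ ℤ.* β) ℤ.* ⟨ z , b ⟩ ℤ.- μ ℤ.* ⟨ y , b ⟩ ℤ.* ⟨ z , a zero ⟩
      mid = trans (eq z) (trans (cong (μ ℤ.*_) (⟨⟩-combʳ β b _ (a zero) z))
              (l μ β ⟨ z , b ⟩ ⟨ y , b ⟩ ⟨ z , a zero ⟩))
        where
        l : ∀ μ β p q r → μ ℤ.* (β ℤ.* p ℤ.+ ℤ.- q ℤ.* r) ≡ (μ ℤ.* β) ℤ.* p ℤ.- μ ℤ.* q ℤ.* r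
        l = ℤ-ring
      lemma : ∀ p ξ r BQ S → BQ ℤ.* Q ℤ.+ ℤ.- r ℤ.* ξ ≡ S ℤ.- p ℤ.* r →
              (p ℤ.- ξ) ℤ.* r ℤ.+ BQ ℤ.* Q ≡ S
      lemma p ξ r BQ S e = trans (l₁ p ξ r (BQ ℤ.* Q)) (trans (cong (ℤ._+ p ℤ.* r) e) (l₂ S (p ℤ.* r)))
        where
        l₁ : ∀ p ξ r t → (p ℤ.- ξ) ℤ.* r ℤ.+ t ≡ (t ℤ.+ ℤ.- r ℤ.* ξ) ℤ.+ p ℤ.* r
        l₁ = ℤ-ring
        l₂ : ∀ S t → (S ℤ.- t) ℤ.+ t ≡ S
        l₂ = ℤ-ring

-- Linear programming duality

ι : Bool → ℕ
ι true  = 1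
ι false = 0

δ : ∀ {n} → Fin n → Fin n → ℕ
δ i j = ι (does (i Fin.≟ j))

∑ᶻ-δ : ∀ {n} (j : Fin n) (g : Fin n → ℤ) → ∑ᶻ (λ i → + δ j i ℤ.* g i) ≡ g j
∑ᶻ-δ {suc n} zero g = trans (∑ᶻ-∷ _) (trans (cong₂ ℤ._+_ (ℤP.*-identityˡ (g zero))
  (∑ᶻ-zero _ (λ i → ℤP.*-zeroˡ (g (suc i))))) (ℤP.+-identityʳ _))
∑ᶻ-δ {suc n} (suc j) g = trans (∑ᶻ-∷ _) (trans (cong₂ ℤ._+_ (ℤP.*-zeroˡ (g zero))
  (∑ᶻ-δ j (λ i → g (suc i)))) (ℤP.+-identityˡ _))

∑ᶻ-δʳ : ∀ {n} (j : Fin n) (g : Fin n → ℤ) → ∑ᶻ (λ i → g i ℤ.* + δ j i) ≡ g j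
∑ᶻ-δʳ j g = trans (∑ᶻ-cong (λ i → ℤP.*-comm (g i) _)) (∑ᶻ-δ j g)

∑ᶻ-term : ∀ {n} (f : Fin n → ℤ) → (∀ i → 0ℤ ℤ.≤ f i) → ∀ i → f i ℤ.≤ ∑ᶻ f
∑ᶻ-term {suc n} f p i = subst₂ ℤ._≤_ (ℤP.+-identityʳ (f i)) (sym (∑ᶻ-remove i f))
  (ℤP.+-monoʳ-≤ (f i) (0≤∑ᶻ (f ∘ punchIn i) (p ∘ punchIn i)))

∑ᶻ-pos : ∀ {n} (f : Fin n → ℤ) → (∀ i → 0ℤ ℤ.≤ f i) → ∀ i → 0ℤ ℤ.< f i → 0ℤ ℤ.< ∑ᶻ f
∑ᶻ-pos f p i q = ℤP.<-≤-trans q (∑ᶻ-term f p i)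

0≤i*i : ∀ i → 0ℤ ℤ.≤ i ℤ.* i
0≤i*i i with ℤP.≤-total 0ℤ i
... | inj₁ p = 0≤* p p
... | inj₂ p = subst (0ℤ ℤ.≤_) (lemma i) (0≤* (≤0⇒0≤- p) (≤0⇒0≤- p))
  where
  lemma : ∀ i → ℤ.- i ℤ.* ℤ.- i ≡ i ℤ.* i
  lemma = ℤ-ring

0<i*i : ∀ i → i ≢ 0ℤ → 0ℤ ℤ.< i ℤ.* i
0<i*i i i≢0 with ℤP.<-cmp 0ℤ i
... | tri< p _ _ = 0<* p p
... | tri≈ _ p _ = ⊥-elim (i≢0 (sym p))
... | tri> _ _ p = subst (0ℤ ℤ.<_) (lemma i) (0<* (ℤP.neg-mono-< p) (ℤP.neg-mono-< p))
  where
  lemma : ∀ i → ℤ.- i ℤ.* ℤ.- i ≡ i ℤ.* i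
  lemma = ℤ-ring

null?ᶻ : ∀ {n} (f : Fin n → ℤ) → (∀ i → f i ≡ 0ℤ) ⊎ 0ℤ ℤ.< ∑ᶻ (λ i → f i ℤ.* f i)
null?ᶻ f with FinP.all? (λ i → f i ℤ.≟ 0ℤ)
... | yes p = inj₁ p
... | no ¬p with FinP.¬∀⟶∃¬ _ _ (λ i → f i ℤ.≟ 0ℤ) ¬p
...   | i , q = inj₂ (∑ᶻ-pos _ (λ j → 0≤i*i (f j)) i (0<i*i (f i) q))

-- The primal program minimises c·x over x ≥ 0 with `colᵀ x` equal to `b`; the dual maximises y·b
-- over free y with `rowᵀ y` at most `c`. Both feasibilities and cost ≤ value are put into one conic
-- system, so a single use of `farkas` yields both optima.
module Duality {k m} (a : Fin m → Fin k → ℤ) (b : Fin k → ℤ) (c : Fin m → ℤ) where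

  rowᵀ : (Fin k → ℤ) → Fin m → ℤ
  rowᵀ p j = ∑ᶻ (λ i → p i ℤ.* a j i)

  colᵀ : (Fin m → ℤ) → Fin k → ℤ
  colᵀ q i = ∑ᶻ (λ j → q j ℤ.* a j i)

  adjoint : ∀ p q → ∑ᶻ (λ j → q j ℤ.* rowᵀ p j) ≡ ∑ᶻ (λ i → p i ℤ.* colᵀ q i)
  adjoint p q = trans (∑ᶻ-cong λ j → sym (∑ᶻ-*ˡ (q j) _)) (trans (∑ᶻ-swap _) (∑ᶻ-cong λ i →
    trans (∑ᶻ-cong λ j → l (q j) (p i) (a j i)) (∑ᶻ-*ˡ (p i) _)))
    where
    l : ∀ q p a → q ℤ.* (p ℤ.* a) ≡ p ℤ.* (q ℤ.* a)
    l = ℤ-ring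

  V : Set
  V = (Fin k → ℤ) × (Fin m → ℤ) × ℤ

  comb : ℤ → V → ℤ → V → V
  comb s (p , q , t) s′ (p′ , q′ , t′) =
    (λ i → s ℤ.* p i ℤ.+ s′ ℤ.* p′ i) , (λ j → s ℤ.* q j ℤ.+ s′ ℤ.* q′ j) , s ℤ.* t ℤ.+ s′ ℤ.* t′

  ⟨_,_⟩ : V → V → ℤ
  ⟨ (p , q , t) , (p′ , q′ , t′) ⟩ =
    ∑ᶻ (λ i → p i ℤ.* p′ i) ℤ.+ (∑ᶻ (λ j → q j ℤ.* q′ j) ℤ.+ t ℤ.* t′)

  ⟨⟩-comm : ∀ u v → ⟨ u , v ⟩ ≡ ⟨ v , u ⟩
  ⟨⟩-comm (p , q , t) (p′ , q′ , t′) = cong₂ ℤ._+_ (∑ᶻ-cong λ i → ℤP.*-comm (p i) _)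
    (cong₂ ℤ._+_ (∑ᶻ-cong λ i → ℤP.*-comm (q i) _) (ℤP.*-comm t t′))

  ⟨⟩-comb : ∀ s u t v z → ⟨ comb s u t v , z ⟩ ≡ s ℤ.* ⟨ u , z ⟩ ℤ.+ t ℤ.* ⟨ v , z ⟩
  ⟨⟩-comb s (p , q , t) s′ (p′ , q′ , t′) (p″ , q″ , t″) =
    trans (cong₂ ℤ._+_ (dist p p′ p″) (cong₂ ℤ._+_ (dist q q′ q″) (l s t s′ t′ t″)))
      (l₂ s s′ (∑ᶻ (λ i → p i ℤ.* p″ i)) (∑ᶻ (λ i → p′ i ℤ.* p″ i))
        (∑ᶻ (λ i → q i ℤ.* q″ i)) (∑ᶻ (λ i → q′ i ℤ.* q″ i)) (t ℤ.* t″) (t′ ℤ.* t″))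
    where
    l : ∀ s t s′ t′ u → (s ℤ.* t ℤ.+ s′ ℤ.* t′) ℤ.* u ≡ s ℤ.* (t ℤ.* u) ℤ.+ s′ ℤ.* (t′ ℤ.* u)
    l = ℤ-ring
    l₂ : ∀ s s′ p p′ q q′ t t′ →
      (s ℤ.* p ℤ.+ s′ ℤ.* p′) ℤ.+ ((s ℤ.* q ℤ.+ s′ ℤ.* q′) ℤ.+ (s ℤ.* t ℤ.+ s′ ℤ.* t′))
      ≡ s ℤ.* (p ℤ.+ (q ℤ.+ t)) ℤ.+ s′ ℤ.* (p′ ℤ.+ (q′ ℤ.+ t′))
    l₂ = ℤ-ring
    dist : ∀ {n} (f g h : Fin n → ℤ) → ∑ᶻ (λ i → (s ℤ.* f i ℤ.+ s′ ℤ.* g i) ℤ.* h i)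
      ≡ s ℤ.* ∑ᶻ (λ i → f i ℤ.* h i) ℤ.+ s′ ℤ.* ∑ᶻ (λ i → g i ℤ.* h i)
    dist f g h = trans (∑ᶻ-cong λ i → l s (f i) s′ (g i) (h i)) (∑ᶻ-comb s s′ _ _)

  null? : ∀ v → (∀ y → ⟨ y , v ⟩ ≡ 0ℤ) ⊎ (0ℤ ℤ.< ⟨ v , v ⟩)
  null? (p , q , t) with null?ᶻ p | null?ᶻ q | t ℤ.≟ 0ℤ
  ... | inj₁ p0 | inj₁ q0 | yes t0 = inj₁ λ (p′ , q′ , t′) → cong₂ ℤ._+_ (z p′ p p0)
        (cong₂ ℤ._+_ (z q′ q q0) (trans (cong (t′ ℤ.*_) t0) (ℤP.*-zeroʳ t′)))
    where
    z : ∀ {n} (f g : Fin n → ℤ) → (∀ i → g i ≡ 0ℤ) → ∑ᶻ (λ i → f i ℤ.* g i) ≡ 0ℤ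
    z f g e = ∑ᶻ-zero _ λ i → trans (cong (f i ℤ.*_) (e i)) (ℤP.*-zeroʳ (f i))
  ... | inj₂ p>0 | _ | _ = inj₂ (ℤP.+-mono-<-≤ p>0
        (ℤP.+-mono-≤ (0≤∑ᶻ _ (λ i → 0≤i*i (q i))) (0≤i*i t)))
  ... | inj₁ _ | inj₂ q>0 | _ = inj₂ (ℤP.+-mono-≤-< (0≤∑ᶻ _ (λ i → 0≤i*i (p i)))
        (ℤP.+-mono-<-≤ q>0 (0≤i*i t)))
  ... | inj₁ _ | inj₁ _ | no t≢0 = inj₂ (ℤP.+-mono-≤-< (0≤∑ᶻ _ (λ i → 0≤i*i (p i)))
        (ℤP.+-mono-≤-< (0≤∑ᶻ _ (λ i → 0≤i*i (q i))) (0<i*i t t≢0)))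

  open Farkas V comb ⟨_,_⟩ ⟨⟩-comm ⟨⟩-comb null?

  𝟎 : ∀ {n} → Fin n → ℤ
  𝟎 _ = 0ℤ

  Gen : Set
  Gen = Fin m ⊎ (Fin k ⊎ (Fin k ⊎ (Fin m ⊎ Fin 1)))

  -- The five blocks are the primal variables, the positive and negative parts
  -- of the dual ones, the dual slacks, and the slack of cost ≤ value.
  gen : Gen → V
  gen (inj₁ j)                      = a j , 𝟎 , c j
  gen (inj₂ (inj₁ i))               = 𝟎 , (λ j → a j i) , ℤ.- b i
  gen (inj₂ (inj₂ (inj₁ i)))        = 𝟎 , (λ j → ℤ.- a j i) , b i
  gen (inj₂ (inj₂ (inj₂ (inj₁ j)))) = 𝟎 , (λ j′ → + δ j j′) , 0ℤ
  gen (inj₂ (inj₂ (inj₂ (inj₂ _)))) = 𝟎 , 𝟎 , 1ℤ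

  size : ℕ
  size = m ℕ.+ (k ℕ.+ (k ℕ.+ (m ℕ.+ 1)))

  decode : Fin size → Gen
  decode i = [ inj₁ , (λ i₁ → inj₂ ([ inj₁ , (λ i₂ → inj₂ ([ inj₁ , (λ i₃ → inj₂ (splitAt m i₃)) ]′
    (splitAt k i₂))) ]′ (splitAt k i₁))) ]′ (splitAt m i)

  encode : Gen → Fin size
  encode (inj₁ j)                      = j ↑ˡ _
  encode (inj₂ (inj₁ i))               = m ↑ʳ (i ↑ˡ _)
  encode (inj₂ (inj₂ (inj₁ i)))        = m ↑ʳ (k ↑ʳ (i ↑ˡ _))
  encode (inj₂ (inj₂ (inj₂ (inj₁ j)))) = m ↑ʳ (k ↑ʳ (k ↑ʳ (j ↑ˡ 1)))
  encode (inj₂ (inj₂ (inj₂ (inj₂ u)))) = m ↑ʳ (k ↑ʳ (k ↑ʳ (m ↑ʳ u)))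

  decode-encode : ∀ g → decode (encode g) ≡ g
  decode-encode (inj₁ j) rewrite FinP.splitAt-↑ˡ m j (k ℕ.+ (k ℕ.+ (m ℕ.+ 1))) = refl
  decode-encode (inj₂ (inj₁ i))
    rewrite FinP.splitAt-↑ʳ m (k ℕ.+ (k ℕ.+ (m ℕ.+ 1))) (i ↑ˡ (k ℕ.+ (m ℕ.+ 1)))
          | FinP.splitAt-↑ˡ k i (k ℕ.+ (m ℕ.+ 1)) = refl
  decode-encode (inj₂ (inj₂ (inj₁ i)))
    rewrite FinP.splitAt-↑ʳ m (k ℕ.+ (k ℕ.+ (m ℕ.+ 1))) (k ↑ʳ (i ↑ˡ (m ℕ.+ 1)))
          | FinP.splitAt-↑ʳ k (k ℕ.+ (m ℕ.+ 1)) (i ↑ˡ (m ℕ.+ 1))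
          | FinP.splitAt-↑ˡ k i (m ℕ.+ 1) = refl
  decode-encode (inj₂ (inj₂ (inj₂ (inj₁ j))))
    rewrite FinP.splitAt-↑ʳ m (k ℕ.+ (k ℕ.+ (m ℕ.+ 1))) (k ↑ʳ (k ↑ʳ (j ↑ˡ 1)))
          | FinP.splitAt-↑ʳ k (k ℕ.+ (m ℕ.+ 1)) (k ↑ʳ (j ↑ˡ 1))
          | FinP.splitAt-↑ʳ k (m ℕ.+ 1) (j ↑ˡ 1)
          | FinP.splitAt-↑ˡ m j 1 = refl
  decode-encode (inj₂ (inj₂ (inj₂ (inj₂ u))))
    rewrite FinP.splitAt-↑ʳ m (k ℕ.+ (k ℕ.+ (m ℕ.+ 1))) (k ↑ʳ (k ↑ʳ (m ↑ʳ u)))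
          | FinP.splitAt-↑ʳ k (k ℕ.+ (m ℕ.+ 1)) (k ↑ʳ (m ↑ʳ u))
          | FinP.splitAt-↑ʳ k (m ℕ.+ 1) (m ↑ʳ u)
          | FinP.splitAt-↑ʳ m 1 u = refl

  target : V
  target = b , c , 0ℤ

  record Optimal : Set where
    field
      μ        : ℤ
      x        : Fin m → ℤ
      y        : Fin k → ℤ
      μ>0      : 0ℤ ℤ.< μ
      x≥0      : ∀ j → 0ℤ ℤ.≤ x j
      primal   : ∀ i → colᵀ x i ≡ μ ℤ.* b i
      dual     : ∀ j → rowᵀ y j ℤ.≤ μ ℤ.* c j
      slack    : ∀ j → x j ≡ 0ℤ ⊎ rowᵀ y j ≡ μ ℤ.* c j

  ∑-𝟎ˡ : ∀ {n} (f : Fin n → ℤ) → ∑ᶻ (λ i → 0ℤ ℤ.* f i) ≡ 0ℤ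
  ∑-𝟎ˡ f = ∑ᶻ-zero _ λ i → ℤP.*-zeroˡ (f i)

  ∑-𝟎ʳ : ∀ {n} (f : Fin n → ℤ) → ∑ᶻ (λ i → f i ℤ.* 0ℤ) ≡ 0ℤ
  ∑-𝟎ʳ f = ∑ᶻ-zero _ λ i → ℤP.*-zeroʳ (f i)

  value : (Fin k → ℤ) → (Fin m → ℤ) → ℤ → Gen → ℤ
  value p q t (inj₁ j)                      = rowᵀ p j ℤ.+ t ℤ.* c j
  value p q t (inj₂ (inj₁ i))               = colᵀ q i ℤ.- t ℤ.* b i
  value p q t (inj₂ (inj₂ (inj₁ i)))        = ℤ.- (colᵀ q i ℤ.- t ℤ.* b i)
  value p q t (inj₂ (inj₂ (inj₂ (inj₁ j)))) = q j
  value p q t (inj₂ (inj₂ (inj₂ (inj₂ _)))) = t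

  ⟨gen⟩ : ∀ p q t g → ⟨ (p , q , t) , gen g ⟩ ≡ value p q t g
  ⟨gen⟩ p q t (inj₁ j) = trans (cong (λ z → rowᵀ p j ℤ.+ (z ℤ.+ t ℤ.* c j)) (∑-𝟎ʳ q))
    (cong (λ w → rowᵀ p j ℤ.+ w) (ℤP.+-identityˡ _))
  ⟨gen⟩ p q t (inj₂ (inj₁ i)) = trans (cong (ℤ._+ _) (∑-𝟎ʳ p)) (l (colᵀ q i) t (b i))
    where
    l : ∀ s t b → 0ℤ ℤ.+ (s ℤ.+ t ℤ.* ℤ.- b) ≡ s ℤ.- t ℤ.* b
    l = ℤ-ring
  ⟨gen⟩ p q t (inj₂ (inj₂ (inj₁ i))) = trans (cong₂ (λ z w → z ℤ.+ (w ℤ.+ t ℤ.* b i)) (∑-𝟎ʳ p)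
    (trans (∑ᶻ-cong λ j → l₁ (q j) (a j i)) (∑ᶻ-*ˡ ℤ.-1ℤ _))) (l (colᵀ q i) t (b i))
    where
    l₁ : ∀ q a → q ℤ.* ℤ.- a ≡ ℤ.-1ℤ ℤ.* (q ℤ.* a)
    l₁ = ℤ-ring
    l : ∀ s t b → 0ℤ ℤ.+ (ℤ.-1ℤ ℤ.* s ℤ.+ t ℤ.* b) ≡ ℤ.- (s ℤ.- t ℤ.* b)
    l = ℤ-ring
  ⟨gen⟩ p q t (inj₂ (inj₂ (inj₂ (inj₁ j)))) = trans (cong₂ (λ z w → z ℤ.+ (w ℤ.+ t ℤ.* 0ℤ)) (∑-𝟎ʳ p)
    (∑ᶻ-δʳ j q)) (l (q j) t)
    where
    l : ∀ s t → 0ℤ ℤ.+ (s ℤ.+ t ℤ.* 0ℤ) ≡ s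
    l = ℤ-ring
  ⟨gen⟩ p q t (inj₂ (inj₂ (inj₂ (inj₂ u)))) = trans (cong₂ (λ z w → z ℤ.+ (w ℤ.+ t ℤ.* 1ℤ)) (∑-𝟎ʳ p)
    (∑-𝟎ʳ q)) (l t)
    where
    l : ∀ t → 0ℤ ℤ.+ (0ℤ ℤ.+ t ℤ.* 1ℤ) ≡ t
    l = ℤ-ring

  -- A separator with t < 0, divided by -t, is a primal and a dual solution violating weak duality.
  -- With t = 0 it splits into a ray `p`, excluded by the feasibility hypothesis, and a `q` of
  -- nonpositive cost. The last generator excludes t > 0.
  not-separated : (∀ j → 0ℤ ℤ.≤ c j) →
    (∀ p → (∀ j → rowᵀ p j ℤ.≤ 0ℤ) → ∑ᶻ (λ i → p i ℤ.* b i) ℤ.≤ 0ℤ) →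
    ¬ Separated (gen ∘ decode) target
  not-separated c≥0 feasible ((p , q , t) , sep , pos) = case (ℤP.<-cmp t 0ℤ)
    where
    sep′ : ∀ g → value p q t g ℤ.≤ 0ℤ
    sep′ g = subst (ℤ._≤ 0ℤ) (trans (cong (λ g′ → ⟨ (p , q , t) , gen g′ ⟩) (decode-encode g)) (⟨gen⟩ p q t g))
      (sep (encode g))
    pb = ∑ᶻ (λ i → p i ℤ.* b i)
    qc = ∑ᶻ (λ j → q j ℤ.* c j)
    pos′ : 0ℤ ℤ.< pb ℤ.+ qc
    pos′ = subst (0ℤ ℤ.<_) (l pb qc t) pos
      where
      l : ∀ u v t → u ℤ.+ (v ℤ.+ t ℤ.* 0ℤ) ≡ u ℤ.+ v
      l = ℤ-ring
    q≤0 : ∀ j → q j ℤ.≤ 0ℤ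
    q≤0 j = sep′ (inj₂ (inj₂ (inj₂ (inj₁ j))))
    cover : ∀ i → colᵀ q i ≡ t ℤ.* b i
    cover i = ℤP.≤-antisym (ℤP.i-j≤0⇒i≤j (sep′ (inj₂ (inj₁ i))))
      (ℤP.0≤i-j⇒j≤i (subst (0ℤ ℤ.≤_) (ℤP.neg-involutive _) (≤0⇒0≤- (sep′ (inj₂ (inj₂ (inj₁ i)))))))
    neg*neg : ∀ {u v} → u ℤ.≤ 0ℤ → v ℤ.≤ 0ℤ → 0ℤ ℤ.≤ u ℤ.* v
    neg*neg {u} {v} u≤0 v≤0 = subst (0ℤ ℤ.≤_) (l u v) (0≤* (≤0⇒0≤- u≤0) (≤0⇒0≤- v≤0))
      where
      l : ∀ u v → ℤ.- u ℤ.* ℤ.- v ≡ u ℤ.* v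
      l = ℤ-ring
    key : 0ℤ ℤ.≤ t ℤ.* (pb ℤ.+ qc)
    key = subst (0ℤ ℤ.≤_) eq (0≤∑ᶻ _ λ j → neg*neg (q≤0 j) (sep′ (inj₁ j)))
      where
      l : ∀ q r t c → q ℤ.* (r ℤ.+ t ℤ.* c) ≡ q ℤ.* r ℤ.+ t ℤ.* (q ℤ.* c)
      l = ℤ-ring
      l₂ : ∀ p t b → p ℤ.* (t ℤ.* b) ≡ t ℤ.* (p ℤ.* b)
      l₂ = ℤ-ring
      eq : ∑ᶻ (λ j → q j ℤ.* (rowᵀ p j ℤ.+ t ℤ.* c j)) ≡ t ℤ.* (pb ℤ.+ qc)
      eq = trans (∑ᶻ-cong λ j → l (q j) (rowᵀ p j) t (c j)) (trans (∑ᶻ-+ _ _) (trans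
        (cong₂ ℤ._+_ (trans (adjoint p q) (trans (∑ᶻ-cong λ i → trans (cong (p i ℤ.*_) (cover i))
           (l₂ (p i) t (b i))) (∑ᶻ-*ˡ t _))) (∑ᶻ-*ˡ t _)) (sym (ℤP.*-distribˡ-+ t pb qc))))
    case : Tri (t ℤ.< 0ℤ) (t ≡ 0ℤ) (0ℤ ℤ.< t) → ⊥
    case (tri< t<0 _ _) = ℤP.<⇒≱ (0<* (ℤP.neg-mono-< t<0) pos′)
      (0≤-⇒≤0 (subst (0ℤ ℤ.≤_) (l t (pb ℤ.+ qc)) key))
      where
      l : ∀ t s → t ℤ.* s ≡ ℤ.- (ℤ.- t ℤ.* s)
      l = ℤ-ring
    case (tri≈ _ t≡0 _) = ℤP.<⇒≱ pos′ (ℤP.+-mono-≤ (feasible p λ j → subst (ℤ._≤ 0ℤ)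
        (trans (cong (λ s → rowᵀ p j ℤ.+ s ℤ.* c j) t≡0) (l (rowᵀ p j) (c j))) (sep′ (inj₁ j)))
      (0≤-⇒≤0 (subst (0ℤ ℤ.≤_) (trans (∑ᶻ-cong λ j → l₂ (q j) (c j)) (trans (∑ᶻ-*ˡ ℤ.-1ℤ _) (ℤP.-1*i≡-i qc)))
        (0≤∑ᶻ _ λ j → 0≤* (≤0⇒0≤- (q≤0 j)) (c≥0 j)))))
      where
      l : ∀ r c → r ℤ.+ 0ℤ ℤ.* c ≡ r
      l = ℤ-ring
      l₂ : ∀ q c → ℤ.- q ℤ.* c ≡ ℤ.-1ℤ ℤ.* (q ℤ.* c)
      l₂ = ℤ-ring
    case (tri> _ _ t>0) = ℤP.<⇒≱ t>0 (sep′ (inj₂ (inj₂ (inj₂ (inj₂ zero)))))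

  optimal-from-cone : InCone (gen ∘ decode) target → Optimal
  optimal-from-cone (μ , x′ , μ>0 , x′≥0 , eq) = record
    { μ = μ ; x = x ; y = y ; μ>0 = μ>0 ; x≥0 = λ j → x′≥0 _
    ; primal = primal ; dual = dual ; slack = slack }
    where
    x : Fin m → ℤ
    x j = x′ (encode (inj₁ j))
    y⁺ y⁻ y : Fin k → ℤ
    y⁺ i = x′ (encode (inj₂ (inj₁ i)))
    y⁻ i = x′ (encode (inj₂ (inj₂ (inj₁ i))))
    y i = y⁺ i ℤ.- y⁻ i
    s : Fin m → ℤ
    s j = x′ (encode (inj₂ (inj₂ (inj₂ (inj₁ j)))))
    u : ℤ
    u = x′ (encode (inj₂ (inj₂ (inj₂ (inj₂ zero)))))
    -- The conic identity read at an arbitrary test vector. Unit vectors in the first and second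
    -- block extract the primal equations and the dual balance from it.
    total : ∀ p q t →
      ∑ᶻ (λ j → x j ℤ.* (rowᵀ p j ℤ.+ t ℤ.* c j))
        ℤ.+ (∑ᶻ (λ i → y i ℤ.* (colᵀ q i ℤ.- t ℤ.* b i)) ℤ.+ (∑ᶻ (λ j → s j ℤ.* q j) ℤ.+ u ℤ.* t))
      ≡ μ ℤ.* (∑ᶻ (λ i → p i ℤ.* b i) ℤ.+ (∑ᶻ (λ j → q j ℤ.* c j) ℤ.+ t ℤ.* 0ℤ))
    total p q t = trans (sym (trans blocks merge)) (eq (p , q , t))
      where
      f : Fin size → ℤ
      f i = x′ i ℤ.* ⟨ (p , q , t) , gen (decode i) ⟩
      at : ∀ g → f (encode g) ≡ x′ (encode g) ℤ.* value p q t g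
      at g = cong (x′ (encode g) ℤ.*_)
        (trans (cong (λ g′ → ⟨ (p , q , t) , gen g′ ⟩) (decode-encode g)) (⟨gen⟩ p q t g))
      l₁ : ∀ u t → u ℤ.* t ℤ.+ 0ℤ ≡ u ℤ.* t
      l₁ = ℤ-ring
      blocks : ∑ᶻ f ≡ ∑ᶻ (λ j → x j ℤ.* (rowᵀ p j ℤ.+ t ℤ.* c j)) ℤ.+
        (∑ᶻ (λ i → y⁺ i ℤ.* (colᵀ q i ℤ.- t ℤ.* b i)) ℤ.+
        (∑ᶻ (λ i → y⁻ i ℤ.* ℤ.- (colᵀ q i ℤ.- t ℤ.* b i)) ℤ.+
        (∑ᶻ (λ j → s j ℤ.* q j) ℤ.+ u ℤ.* t)))
      blocks = trans (∑ᶻ-split m f) (cong₂ ℤ._+_ (∑ᶻ-cong λ j → at (inj₁ j))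
        (trans (∑ᶻ-split k _) (cong₂ ℤ._+_ (∑ᶻ-cong λ i → at (inj₂ (inj₁ i)))
        (trans (∑ᶻ-split k _) (cong₂ ℤ._+_ (∑ᶻ-cong λ i → at (inj₂ (inj₂ (inj₁ i))))
        (trans (∑ᶻ-split m _) (cong₂ ℤ._+_ (∑ᶻ-cong λ j → at (inj₂ (inj₂ (inj₂ (inj₁ j)))))
        (trans (∑ᶻ-∷ _) (trans (cong₂ ℤ._+_ (at (inj₂ (inj₂ (inj₂ (inj₂ zero))))) (∑ᶻ-[] _)) (l₁ u t))))))))))
      l₂ : ∀ y y′ r → y ℤ.* r ℤ.+ y′ ℤ.* ℤ.- r ≡ (y ℤ.- y′) ℤ.* r
      l₂ = ℤ-ring
      merge : ∑ᶻ (λ j → x j ℤ.* (rowᵀ p j ℤ.+ t ℤ.* c j)) ℤ.+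
        (∑ᶻ (λ i → y⁺ i ℤ.* (colᵀ q i ℤ.- t ℤ.* b i)) ℤ.+
        (∑ᶻ (λ i → y⁻ i ℤ.* ℤ.- (colᵀ q i ℤ.- t ℤ.* b i)) ℤ.+
        (∑ᶻ (λ j → s j ℤ.* q j) ℤ.+ u ℤ.* t))) ≡ _
      merge = cong (λ w → ∑ᶻ (λ j → x j ℤ.* (rowᵀ p j ℤ.+ t ℤ.* c j)) ℤ.+ w)
        (trans (sym (ℤP.+-assoc (∑ᶻ (λ i → y⁺ i ℤ.* (colᵀ q i ℤ.- t ℤ.* b i))) _ _))
          (cong (ℤ._+ (∑ᶻ (λ j → s j ℤ.* q j) ℤ.+ u ℤ.* t)) (trans (sym (∑ᶻ-+ _ _))
            (∑ᶻ-cong λ i → l₂ (y⁺ i) (y⁻ i) (colᵀ q i ℤ.- t ℤ.* b i)))))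
    primal : ∀ i → colᵀ x i ≡ μ ℤ.* b i
    primal i = trans (sym lhs) (trans (total (λ i′ → + δ i i′) 𝟎 0ℤ) rhs)
      where
      l₁ : ∀ a c → a ℤ.+ 0ℤ ℤ.* c ≡ a
      l₁ = ℤ-ring
      l₂ : ∀ y b → y ℤ.* (0ℤ ℤ.- 0ℤ ℤ.* b) ≡ 0ℤ
      l₂ = ℤ-ring
      l₃ : ∀ v u → v ℤ.+ (0ℤ ℤ.+ (0ℤ ℤ.+ u ℤ.* 0ℤ)) ≡ v
      l₃ = ℤ-ring
      l₄ : ∀ b → b ℤ.+ (0ℤ ℤ.+ 0ℤ ℤ.* 0ℤ) ≡ b
      l₄ = ℤ-ring
      lhs = trans (cong₂ ℤ._+_
          (∑ᶻ-cong λ j → cong (x j ℤ.*_) (trans (l₁ _ (c j)) (∑ᶻ-δ i (a j))))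
          (cong₂ ℤ._+_ (∑ᶻ-zero _ λ i′ → trans (cong (λ w → y i′ ℤ.* (w ℤ.- 0ℤ ℤ.* b i′)) (∑-𝟎ˡ (λ j → a j i′))) (l₂ (y i′) (b i′)))
            (cong (ℤ._+ u ℤ.* 0ℤ) (∑-𝟎ʳ s))))
        (l₃ (colᵀ x i) u)
      rhs = cong (μ ℤ.*_) (trans (cong₂ (λ v w → v ℤ.+ (w ℤ.+ 0ℤ ℤ.* 0ℤ)) (∑ᶻ-δ i b) (∑-𝟎ˡ c)) (l₄ (b i)))
    balance : ∀ j → rowᵀ y j ℤ.+ s j ≡ μ ℤ.* c j
    balance j = trans (sym lhs) (trans (total 𝟎 (λ j′ → + δ j j′) 0ℤ) rhs)
      where
      l₁ : ∀ x c → x ℤ.* (0ℤ ℤ.+ 0ℤ ℤ.* c) ≡ 0ℤ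
      l₁ = ℤ-ring
      l₂ : ∀ a b → a ℤ.- 0ℤ ℤ.* b ≡ a
      l₂ = ℤ-ring
      l₃ : ∀ r s u → 0ℤ ℤ.+ (r ℤ.+ (s ℤ.+ u ℤ.* 0ℤ)) ≡ r ℤ.+ s
      l₃ = ℤ-ring
      l₄ : ∀ c → 0ℤ ℤ.+ (c ℤ.+ 0ℤ ℤ.* 0ℤ) ≡ c
      l₄ = ℤ-ring
      lhs = trans (cong₂ ℤ._+_
          (∑ᶻ-zero _ λ j′ → trans (cong (λ w → x j′ ℤ.* (w ℤ.+ 0ℤ ℤ.* c j′)) (∑-𝟎ˡ (a j′))) (l₁ (x j′) (c j′)))
          (cong₂ ℤ._+_ (∑ᶻ-cong λ i → cong (y i ℤ.*_) (trans (l₂ _ (b i)) (∑ᶻ-δ j (λ j′ → a j′ i))))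
            (cong (ℤ._+ u ℤ.* 0ℤ) (∑ᶻ-δʳ j s))))
        (l₃ (rowᵀ y j) (s j) u)
      rhs = cong (μ ℤ.*_) (trans (cong₂ (λ v w → v ℤ.+ (w ℤ.+ 0ℤ ℤ.* 0ℤ)) (∑-𝟎ˡ b) (∑ᶻ-δ j c)) (l₄ (c j)))
    s≥0 : ∀ j → 0ℤ ℤ.≤ s j
    s≥0 j = x′≥0 _
    dual : ∀ j → rowᵀ y j ℤ.≤ μ ℤ.* c j
    dual j = subst₂ ℤ._≤_ (ℤP.+-identityʳ _) (balance j) (ℤP.+-monoʳ-≤ (rowᵀ y j) (s≥0 j))
    -- The system is skew-symmetric: evaluated at (−y , x , μ) it leaves only ⟨ s , x ⟩ + u μ ≡ 0.
    complementary : ∑ᶻ (λ j → s j ℤ.* x j) ≡ ℤ.- (u ℤ.* μ)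
    complementary = final _ _ _ _ _ _ _ _ (sym lhs₁) (sym lhs₂) (sym rhs₁) (adjoint y x) (total (λ i → ℤ.- y i) x μ)
      where
      xc = ∑ᶻ (λ j → x j ℤ.* c j)
      yb = ∑ᶻ (λ i → y i ℤ.* b i)
      neg : ∀ {n} (f g : Fin n → ℤ) → ∑ᶻ (λ i → ℤ.- f i ℤ.* g i) ≡ ℤ.- ∑ᶻ (λ i → f i ℤ.* g i)
      neg f g = trans (∑ᶻ-cong λ i → l (f i) (g i)) (trans (∑ᶻ-*ˡ ℤ.-1ℤ _) (ℤP.-1*i≡-i _))
        where
        l : ∀ f g → ℤ.- f ℤ.* g ≡ ℤ.-1ℤ ℤ.* (f ℤ.* g)
        l = ℤ-ring
      lhs₁ : ∑ᶻ (λ j → x j ℤ.* (rowᵀ (λ i → ℤ.- y i) j ℤ.+ μ ℤ.* c j))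
        ≡ ℤ.-1ℤ ℤ.* ∑ᶻ (λ j → x j ℤ.* rowᵀ y j) ℤ.+ μ ℤ.* xc
      lhs₁ = trans (∑ᶻ-cong λ j → trans (cong (λ r → x j ℤ.* (r ℤ.+ μ ℤ.* c j)) (neg y (a j)))
          (l (x j) (rowᵀ y j) μ (c j))) (∑ᶻ-comb ℤ.-1ℤ μ _ _)
        where
        l : ∀ x r μ c → x ℤ.* (ℤ.- r ℤ.+ μ ℤ.* c) ≡ ℤ.-1ℤ ℤ.* (x ℤ.* r) ℤ.+ μ ℤ.* (x ℤ.* c)
        l = ℤ-ring
      lhs₂ : ∑ᶻ (λ i → y i ℤ.* (colᵀ x i ℤ.- μ ℤ.* b i)) ≡ 1ℤ ℤ.* ∑ᶻ (λ i → y i ℤ.* colᵀ x i) ℤ.+ ℤ.- μ ℤ.* yb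
      lhs₂ = trans (∑ᶻ-cong λ i → l (y i) (colᵀ x i) μ (b i)) (∑ᶻ-comb 1ℤ (ℤ.- μ) _ _)
        where
        l : ∀ y r μ b → y ℤ.* (r ℤ.- μ ℤ.* b) ≡ 1ℤ ℤ.* (y ℤ.* r) ℤ.+ ℤ.- μ ℤ.* (y ℤ.* b)
        l = ℤ-ring
      rhs₁ : ∑ᶻ (λ i → ℤ.- y i ℤ.* b i) ≡ ℤ.- yb
      rhs₁ = neg y b
      final : ∀ X Y S B X′ Y′ xc yb → ℤ.-1ℤ ℤ.* X′ ℤ.+ μ ℤ.* xc ≡ X → 1ℤ ℤ.* Y′ ℤ.+ ℤ.- μ ℤ.* yb ≡ Y →
        ℤ.- yb ≡ B → X′ ≡ Y′ →
        X ℤ.+ (Y ℤ.+ (S ℤ.+ u ℤ.* μ)) ≡ μ ℤ.* (B ℤ.+ (xc ℤ.+ μ ℤ.* 0ℤ)) → S ≡ ℤ.- (u ℤ.* μ)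
      final X Y S B X′ Y′ xc yb refl refl refl refl e =
        trans (l₁ X′ S xc yb μ u) (trans (cong (λ w → w ℤ.- _) e) (l₂ xc yb μ u))
        where
        l₁ : ∀ X S xc yb μ u → S ≡ ((ℤ.-1ℤ ℤ.* X ℤ.+ μ ℤ.* xc) ℤ.+
          ((1ℤ ℤ.* X ℤ.+ ℤ.- μ ℤ.* yb) ℤ.+ (S ℤ.+ u ℤ.* μ))) ℤ.- (μ ℤ.* xc ℤ.- μ ℤ.* yb ℤ.+ u ℤ.* μ)
        l₁ = ℤ-ring
        l₂ : ∀ xc yb μ u → μ ℤ.* (ℤ.- yb ℤ.+ (xc ℤ.+ μ ℤ.* 0ℤ)) ℤ.- (μ ℤ.* xc ℤ.- μ ℤ.* yb ℤ.+ u ℤ.* μ)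
          ≡ ℤ.- (u ℤ.* μ)
        l₂ = ℤ-ring
    slack : ∀ j → x j ≡ 0ℤ ⊎ rowᵀ y j ≡ μ ℤ.* c j
    slack j = [ (λ s≡0 → inj₂ (trans (sym (ℤP.+-identityʳ _)) (trans (cong (λ w → rowᵀ y j ℤ.+ w) (sym s≡0)) (balance j)))) , inj₁ ]′
      (ℤP.i*j≡0⇒i≡0∨j≡0 (s j) sx≡0)
      where
      sx≥0 : ∀ j → 0ℤ ℤ.≤ s j ℤ.* x j
      sx≥0 j = 0≤* (s≥0 j) (x′≥0 _)
      -- By `complementary` the nonnegative products sum to -uμ, which is at most zero, so each of
      -- them vanishes.
      sx≡0 : s j ℤ.* x j ≡ 0ℤ
      sx≡0 = ℤP.≤-antisym (ℤP.≤-trans (∑ᶻ-term _ sx≥0 j) (subst (ℤ._≤ 0ℤ) (sym complementary)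
        (ℤP.neg-mono-≤ (0≤* (x′≥0 (encode (inj₂ (inj₂ (inj₂ (inj₂ zero)))))) (ℤP.<⇒≤ μ>0))))) (sx≥0 j)

  opaque
    -- The second hypothesis is feasibility of the primal program in Farkas form. Nonnegative costs
    -- make the zero vector dual feasible, so both programs attain their optima.
    strong-duality : (∀ j → 0ℤ ℤ.≤ c j) →
      (∀ p → (∀ j → rowᵀ p j ℤ.≤ 0ℤ) → ∑ᶻ (λ i → p i ℤ.* b i) ℤ.≤ 0ℤ) → Optimal
    strong-duality c≥0 feasible with farkas size (gen ∘ decode) target
    ... | inj₁ cone = optimal-from-cone cone
    ... | inj₂ sep  = ⊥-elim (not-separated c≥0 feasible sep)

-- Bottles and the swapping argument

ℕ-lift : ∀ {a b} → a ℕ.≤ b → + a ℤ.≤ + b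
ℕ-lift = ℤ.+≤+

0≤+ : ∀ n → 0ℤ ℤ.≤ + n
0≤+ n = ℤ.+≤+ z≤n

∑-δ : ∀ {n} (j : Fin n) (g : Fin n → ℕ) → ∑ (λ i → δ j i ℕ.* g i) ≡ g j
∑-δ {suc n} zero g = trans (∑-∷ _) (trans (cong₂ ℕ._+_ (ℕP.+-identityʳ (g zero))
  (trans (∑-const n 0) (ℕP.*-zeroʳ n))) (ℕP.+-identityʳ _))
∑-δ {suc n} (suc j) g = trans (∑-∷ _) (∑-δ j (λ i → g (suc i)))

δ-refl : ∀ {n} (t : Fin n) → δ t t ≡ 1
δ-refl t = cong ι (dec-true (t Fin.≟ t) refl)

∑-zero : ∀ {n} (f : Fin n → ℕ) → (∀ i → f i ≡ 0) → ∑ f ≡ 0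
∑-zero {n} f p = trans (∑-cong p) (trans (∑-const n 0) (ℕP.*-zeroʳ n))

∑-term : ∀ {n} (f : Fin n → ℕ) i → f i ℕ.≤ ∑ f
∑-term {suc n} f i = subst (f i ℕ.≤_) (sym (∑-remove i f)) (ℕP.m≤m+n (f i) _)

∑-two : ∀ {n} (f : Fin n → ℕ) {i j} → i ≢ j → f i ℕ.+ f j ℕ.≤ ∑ f
∑-two {suc n} f {i} {j} i≢j = subst (f i ℕ.+ f j ℕ.≤_) (sym (∑-remove i f))
  (ℕP.+-monoʳ-≤ (f i) (subst (ℕ._≤ ∑ (f ∘ punchIn i)) (cong f (FinP.punchIn-punchOut i≢j))
    (∑-term (f ∘ punchIn i) (Fin.punchOut i≢j))))

∑ᶻ-agree-off : ∀ {n} (i : Fin n) (f g : Fin n → ℤ) → (∀ j → j ≢ i → f j ≡ g j) →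
  ∑ᶻ f ℤ.+ g i ≡ ∑ᶻ g ℤ.+ f i
∑ᶻ-agree-off {suc n} i f g e = trans (cong (ℤ._+ g i) (∑ᶻ-remove i f)) (trans
  (cong (λ t → (f i ℤ.+ t) ℤ.+ g i) (∑ᶻ-cong λ j → e (punchIn i j) (FinP.punchInᵢ≢i i j)))
  (trans (l (f i) _ (g i)) (cong (ℤ._+ f i) (sym (∑ᶻ-remove i g)))))
  where
  l : ∀ a s b → (a ℤ.+ s) ℤ.+ b ≡ (b ℤ.+ s) ℤ.+ a
  l = ℤ-ring

∑ᶻ-pos-* : ∀ {n} (c : Fin n → ℕ) (f : Fin n → ℤ) → (∀ i → 0ℤ ℤ.≤ f i) → ∀ i → 0 ℕ.< c i → 0ℤ ℤ.< f i →
  0ℤ ℤ.< ∑ᶻ (λ i → + c i ℤ.* f i)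
∑ᶻ-pos-* c f f≥0 i c>0 f>0 = ∑ᶻ-pos _ (λ i → 0≤* (0≤+ (c i)) (f≥0 i)) i (0<* (ℤ.+<+ c>0) f>0)

pos-cancel-≤ : ∀ {c x y} → 0 ℕ.< c → + c ℤ.* x ℤ.≤ + c ℤ.* y → x ℤ.≤ y
pos-cancel-≤ {suc c} {x} {y} _ = ℤP.*-cancelˡ-≤-pos x y (+ suc c)

argmax : ∀ {n} (b : Fin n → ℕ) (y : Fin n → ℤ) →
  (∀ v → b v ≡ 0) ⊎ (∃[ v ] 0 ℕ.< b v × (∀ u → 0 ℕ.< b u → y u ℤ.≤ y v))
argmax {zero}  b y = inj₁ λ ()
argmax {suc n} b y with argmax (b ∘ suc) (y ∘ suc) | b zero in eq
... | inj₁ z | zero  = inj₁ λ { zero → eq ; (suc v) → z v }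
... | inj₁ z | suc _ = inj₂ (zero , subst (0 ℕ.<_) (sym eq) (s≤s z≤n) , λ
  { zero _ → ℤP.≤-refl ; (suc u) p → ⊥-elim (ℕP.<-irrefl (sym (z u)) p) })
... | inj₂ (v , v>0 , max) | zero = inj₂ (suc v , v>0 , λ
  { zero p → ⊥-elim (ℕP.<-irrefl (sym eq) p) ; (suc u) → max u })
... | inj₂ (v , v>0 , max) | suc _ with ℤP.≤-total (y zero) (y (suc v))
...   | inj₁ p = inj₂ (suc v , v>0 , λ { zero _ → p ; (suc u) → max u })
...   | inj₂ p = inj₂ (zero , subst (0 ℕ.<_) (sym eq) (s≤s z≤n) , λ
  { zero _ → ℤP.≤-refl ; (suc u) q → ℤP.≤-trans (max u q) p })

-- Node zero is a universal dummy vertex; the linear program minimises its use.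
-- Position zero of a tuple carries the small class of the bottle.
module Bottle {K : ℕ} (R : Fin K → Fin K → Bool) (R-sym : ∀ i j → R i j ≡ R j i)
  (ρ W s : ℕ) (0<s : 0 ℕ.< s) (s≤W : s ℕ.≤ W) where

  Node : Set
  Node = Fin (suc K)

  Position : Set
  Position = Fin (suc (suc ρ))

  Tuple : Set
  Tuple = Position → Node

  P : ℕ
  P = s ℕ.+ suc ρ ℕ.* W

  coef : Position → ℕ
  coef zero    = s
  coef (suc _) = W

  0<W : 0 ℕ.< W
  0<W = ℕP.<-≤-trans 0<s s≤W

  coef>0 : ∀ a → 0 ℕ.< coef a
  coef>0 zero    = 0<s
  coef>0 (suc a) = 0<W

  s≤coef : ∀ a → s ℕ.≤ coef a
  s≤coef zero    = ℕP.≤-refl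
  s≤coef (suc a) = s≤W

  ∑-coef : ∑ coef ≡ P
  ∑-coef = trans (∑-∷ coef) (cong (s ℕ.+_) (∑-const (suc ρ) W))

  -- The dummy is joined to itself and `R` may have loops, so a bottle can repeat the dummy, or a
  -- cluster that is dense to itself.
  adj : Node → Node → Bool
  adj zero    _       = true
  adj (suc i) zero    = true
  adj (suc i) (suc j) = R i j

  adj-sym : ∀ t u → adj t u ≡ adj u t
  adj-sym zero    zero    = refl
  adj-sym zero    (suc j) = refl
  adj-sym (suc i) zero    = refl
  adj-sym (suc i) (suc j) = R-sym i j

  Valid : Tuple → Set
  Valid T = ∀ a c → a ≢ c → adj (T a) (T c) ≡ true

  opaque
    valid? : ∀ T → Dec (Valid T)
    valid? T = FinP.all? λ a → FinP.all? λ c → ¬? (a Fin.≟ c) →-dec (adj (T a) (T c) BoolP.≟ true)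

  weight : (Node → ℤ) → Tuple → ℤ
  weight w T = ∑ᶻ (λ a → + coef a ℤ.* w (T a))

  load : (Node → ℕ) → Tuple → ℕ
  load φ T = ∑ (λ a → coef a ℕ.* φ (T a))

  nonadj : Fin K → Node → ℕ
  nonadj v t = ι (not (adj (suc v) t))

  -- A bottle in the support is tight by complementary slackness, so no exchange that keeps it valid
  -- can raise its weight above 0.
  module Swap (w : Node → ℤ) (dual : ∀ T → Valid T → weight w T ℤ.≤ 0ℤ)
    (M : ℤ) (0<M : 0ℤ ℤ.< M) (v : Fin K) (wv : w (suc v) ≡ M)
    (T : Tuple) (valid : Valid T) (tight : weight w T ≡ 0ℤ) (w≤M : ∀ a → w (T a) ℤ.≤ M) where

    top : Node → ℕ
    top t = ι (does (w t ℤ.≟ M))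

    not-all-top : ¬ (∀ a → w (T a) ≡ M)
    not-all-top e = ℤP.<-irrefl (sym tight)
      (∑ᶻ-pos-* coef (w ∘ T) (λ a → ℤP.<⇒≤ (pos a)) zero 0<s (pos zero))
      where
      pos : ∀ a → 0ℤ ℤ.< w (T a)
      pos a = subst (0ℤ ℤ.<_) (sym (e a)) 0<M

    replace : ∀ {n} → Fin n → (Fin n → Node) → Fin n → Node
    replace a S b = if does (b Fin.≟ a) then suc v else S b

    replace-at : ∀ {n} (a : Fin n) S → replace a S a ≡ suc v
    replace-at a S with a Fin.≟ a
    ... | yes _ = refl
    ... | no ¬p = ⊥-elim (¬p refl)

    replace-off : ∀ {n} (a : Fin n) S b → b ≢ a → replace a S b ≡ S b
    replace-off a S b b≢a with b Fin.≟ a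
    ... | yes p = ⊥-elim (b≢a p)
    ... | no _  = refl

    replace-valid : ∀ {n} (a : Fin n) S → (∀ b c → b ≢ c → adj (S b) (S c) ≡ true) →
      (∀ b → b ≢ a → adj (suc v) (S b) ≡ true) →
      ∀ b c → b ≢ c → adj (replace a S b) (replace a S c) ≡ true
    replace-valid a S ok near b c b≢c with b Fin.≟ a | c Fin.≟ a
    ... | yes p | yes q = ⊥-elim (b≢c (trans p (sym q)))
    ... | yes p | no ¬q = near c ¬q
    ... | no ¬p | yes q = trans (adj-sym (S b) (suc v)) (near b ¬p)
    ... | no ¬p | no ¬q = ok b c b≢c

    -- Exchanging `T a` for `v` leaves a valid tuple, whose weight exceeds that of the tight `T` by
    -- `coef a` times M - w (T a). This excess cannot be positive.
    swap : ∀ a → (∀ b → b ≢ a → adj (suc v) (T b) ≡ true) → w (T a) ≡ M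
    swap a near = ℤP.≤-antisym (w≤M a) (pos-cancel-≤ (coef>0 a) (subst₂ ℤ._≤_ e₁ (ℤP.+-identityˡ _)
      (ℤP.+-monoˡ-≤ (+ coef a ℤ.* w (T a)) (dual (replace a T) (replace-valid a T valid near)))))
      where
      e₁ : weight w (replace a T) ℤ.+ + coef a ℤ.* w (T a) ≡ + coef a ℤ.* M
      e₁ = trans (∑ᶻ-agree-off a (λ b → + coef b ℤ.* w (replace a T b)) (λ b → + coef b ℤ.* w (T b))
               (λ b b≢a → cong (λ t → + coef b ℤ.* w t) (replace-off a T b b≢a)))
             (trans (cong₂ ℤ._+_ tight (cong (+ coef a ℤ.*_) (trans (cong w (replace-at a T)) wv)))
               (ℤP.+-identityˡ _))

    -- Here `v` can miss the pointed node only. So `T (suc a)` moves into the small class, `v` takes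
    -- its place and `T zero` leaves; the left side is the resulting change of weight.
    repoint : (∀ a → adj (suc v) (T (suc a)) ≡ true) → ∀ a →
      + s ℤ.* (w (T (suc a)) ℤ.- w (T zero)) ℤ.+ + W ℤ.* (M ℤ.- w (T (suc a))) ℤ.≤ 0ℤ
    repoint near a = subst (ℤ._≤ 0ℤ) e (dual T′ valid′)
      where
      T′ : Tuple
      T′ zero    = T (suc a)
      T′ (suc b) = replace a (T ∘ suc) b
      hub : ∀ b → adj (T (suc a)) (replace a (T ∘ suc) b) ≡ true
      hub b with b Fin.≟ a
      ... | yes _ = trans (adj-sym (T (suc a)) (suc v)) (near a)
      ... | no ¬p = valid (suc a) (suc b) λ q → ¬p (sym (FinP.suc-injective q))
      valid′ : Valid T′
      valid′ zero    zero    p = ⊥-elim (p refl)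
      valid′ zero    (suc c) p = hub c
      valid′ (suc b) zero    p = trans (adj-sym (T′ (suc b)) (T (suc a))) (hub b)
      valid′ (suc b) (suc c) p = replace-valid a (T ∘ suc)
        (λ b c b≢c → valid (suc b) (suc c) (b≢c ∘ FinP.suc-injective)) (λ b _ → near b) b c (p ∘ cong suc)
      m m′ : ℤ
      m  = ∑ᶻ (λ b → + W ℤ.* w (T (suc b)))
      m′ = ∑ᶻ (λ b → + W ℤ.* w (T′ (suc b)))
      off : m′ ℤ.+ + W ℤ.* w (T (suc a)) ≡ m ℤ.+ + W ℤ.* M
      off = trans (∑ᶻ-agree-off a _ (λ b → + W ℤ.* w (T (suc b)))
               (λ b b≢a → cong (λ t → + W ℤ.* w t) (replace-off a (T ∘ suc) b b≢a)))
             (cong (λ t → m ℤ.+ + W ℤ.* t) (trans (cong w (replace-at a (T ∘ suc))) wv))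
      calc : ∀ s W wa w0 M m m′ → m′ ℤ.+ W ℤ.* wa ≡ m ℤ.+ W ℤ.* M → s ℤ.* w0 ℤ.+ m ≡ 0ℤ →
        s ℤ.* wa ℤ.+ m′ ≡ s ℤ.* (wa ℤ.- w0) ℤ.+ W ℤ.* (M ℤ.- wa)
      calc s W wa w0 M m m′ e₁ e₂ = trans (l₁ s W wa m′) (trans (cong (λ t → s ℤ.* wa ℤ.+ (t ℤ.- W ℤ.* wa)) e₁)
        (trans (l₂ s W wa w0 M m) (trans (cong (λ t → (s ℤ.* (wa ℤ.- w0) ℤ.+ W ℤ.* (M ℤ.- wa)) ℤ.+ t) e₂)
          (ℤP.+-identityʳ _))))
        where
        l₁ : ∀ s W wa m′ → s ℤ.* wa ℤ.+ m′ ≡ s ℤ.* wa ℤ.+ ((m′ ℤ.+ W ℤ.* wa) ℤ.- W ℤ.* wa)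
        l₁ = ℤ-ring
        l₂ : ∀ s W wa w0 M m → s ℤ.* wa ℤ.+ ((m ℤ.+ W ℤ.* M) ℤ.- W ℤ.* wa)
          ≡ (s ℤ.* (wa ℤ.- w0) ℤ.+ W ℤ.* (M ℤ.- wa)) ℤ.+ (s ℤ.* w0 ℤ.+ m)
        l₂ = ℤ-ring
      e : weight w T′ ≡ + s ℤ.* (w (T (suc a)) ℤ.- w (T zero)) ℤ.+ + W ℤ.* (M ℤ.- w (T (suc a)))
      e = trans (∑ᶻ-∷ _) (calc (+ s) (+ W) _ (w (T zero)) M m m′ off (trans (sym (∑ᶻ-∷ _)) tight))

    missed : Position → Set
    missed a = adj (suc v) (T a) ≡ false

    missed-load : ∀ {a} → missed a → coef a ℕ.* nonadj v (T a) ≡ coef a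
    missed-load {a} e = trans (cong (λ t → coef a ℕ.* ι (not t)) e) (ℕP.*-identityʳ _)

    top-load : ∀ {a} → w (T a) ≡ M → coef a ℕ.* top (T a) ≡ coef a
    top-load {a} e with w (T a) ℤ.≟ M
    ... | yes _ = ℕP.*-identityʳ _
    ... | no ¬p = ⊥-elim (¬p e)

    -- The alternative between missing W + s, and missing W while a top node of coefficient W is
    -- present, is merged into one linear inequality that can be added up over all bottles: a top
    -- load of W makes up exactly the deficit s·W.
    Claim : Set
    Claim = (W ℕ.≤ load (nonadj v) T) ×
      (W ℕ.* (W ℕ.+ s) ℕ.≤ W ℕ.* load (nonadj v) T ℕ.+ s ℕ.* load top T)

    one-missed : ∀ a → coef a ≡ W → missed a → w (T a) ≡ M → Claim
    one-missed a ca ma ta = W≤miss , subst (ℕ._≤ W ℕ.* load (nonadj v) T ℕ.+ s ℕ.* load top T) (sym (trans (ℕP.*-distribˡ-+ W W s) (cong (W ℕ.* W ℕ.+_) (ℕP.*-comm W s))))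
      (ℕP.+-mono-≤ (ℕP.*-monoʳ-≤ W W≤miss) (ℕP.*-monoʳ-≤ s
        (subst (ℕ._≤ load top T) (trans (top-load ta) ca) (∑-term (λ a → coef a ℕ.* top (T a)) a))))
      where
      W≤miss = subst (ℕ._≤ load (nonadj v) T) (trans (missed-load {a} ma) ca) (∑-term (λ a → coef a ℕ.* nonadj v (T a)) a)

    two-missed : ∀ a c → a ≢ c → missed a → missed c → Claim
    two-missed a c a≢c ma mc = ℕP.≤-trans (ℕP.m≤m+n W s) W+s≤miss ,
      ℕP.≤-trans (ℕP.*-monoʳ-≤ W W+s≤miss) (ℕP.m≤m+n _ _)
      where
      big : ∀ a c → a ≢ c → W ℕ.+ s ℕ.≤ coef a ℕ.+ coef c
      big zero    zero    p = ⊥-elim (p refl)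
      big zero    (suc c) p = ℕP.≤-reflexive (ℕP.+-comm W s)
      big (suc a) c       p = ℕP.+-monoʳ-≤ W (s≤coef c)
      W+s≤miss : W ℕ.+ s ℕ.≤ load (nonadj v) T
      W+s≤miss = ℕP.≤-trans (big a c a≢c) (subst (ℕ._≤ load (nonadj v) T)
        (cong₂ ℕ._+_ (missed-load {a} ma) (missed-load {c} mc)) (∑-two (λ a → coef a ℕ.* nonadj v (T a)) a≢c))

    -- By `repoint`, s(M - w₀) + (W - s)(M - wₐ) is at most 0, and both terms are nonnegative. So w₀
    -- = M. If W > s, every node is top, contradicting tightness; if W = s, the pointed node itself
    -- counts as one of coefficient W.
    pointed-missed : missed zero → (∀ a → adj (suc v) (T (suc a)) ≡ true) → Claim
    pointed-missed m0 near = byW (W ℕ.≟ s)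
      where
      split : ∀ a → + s ℤ.* (M ℤ.- w (T zero)) ℤ.+ (+ W ℤ.- + s) ℤ.* (M ℤ.- w (T (suc a))) ℤ.≤ 0ℤ
      split a = subst (ℤ._≤ 0ℤ) (l (+ s) (+ W) (w (T (suc a))) (w (T zero)) M) (repoint near a)
        where
        l : ∀ s W wa w0 M → s ℤ.* (wa ℤ.- w0) ℤ.+ W ℤ.* (M ℤ.- wa) ≡ s ℤ.* (M ℤ.- w0) ℤ.+ (W ℤ.- s) ℤ.* (M ℤ.- wa)
        l = ℤ-ring
      gap : ∀ a → 0ℤ ℤ.≤ M ℤ.- w (T a)
      gap a = ℤP.i≤j⇒0≤j-i (w≤M a)
      0≤W-s : 0ℤ ℤ.≤ + W ℤ.- + s
      0≤W-s = ℤP.i≤j⇒0≤j-i (ℕ-lift s≤W)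
      nonpos : ∀ {x y} → 0ℤ ℤ.≤ y → x ℤ.+ y ℤ.≤ 0ℤ → x ℤ.≤ 0ℤ
      nonpos {x} {y} 0≤y p = ℤP.≤-trans (subst (ℤ._≤ x ℤ.+ y) (ℤP.+-identityʳ x) (ℤP.+-monoʳ-≤ x 0≤y)) p
      from-gap : ∀ {a} → M ℤ.- w (T a) ℤ.≤ 0ℤ → w (T a) ≡ M
      from-gap {a} p = ℤP.≤-antisym (w≤M a) (ℤP.i-j≤0⇒i≤j p)
      top₀ : w (T zero) ≡ M
      top₀ = from-gap (pos-cancel-≤ 0<s (subst (+ s ℤ.* (M ℤ.- w (T zero)) ℤ.≤_) (sym (ℤP.*-zeroʳ (+ s)))
        (nonpos (0≤* 0≤W-s (gap (suc zero))) (split zero))))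
      byW : Dec (W ≡ s) → Claim
      byW (yes W≡s) = one-missed zero (sym W≡s) m0 top₀
      byW (no W≢s)  = ⊥-elim (not-all-top λ { zero → top₀ ; (suc a) → from-gap (ℤP.≮⇒≥ λ pos →
        ℤP.<⇒≱ (0<* (subst (ℤ._< + W ℤ.- + s) (ℤP.+-inverseʳ (+ s)) (ℤP.+-monoˡ-< (ℤ.- + s) W>s)) pos) (nonpos (0≤* (0≤+ s) (gap zero))
          (subst (ℤ._≤ 0ℤ) (ℤP.+-comm (+ s ℤ.* (M ℤ.- w (T zero))) _) (split a)))) })
        where
        W>s : + s ℤ.< + W
        W>s = ℤ.+<+ (ℕP.≤∧≢⇒< s≤W (W≢s ∘ sym))

    claim : Claim
    claim with FinP.any? (λ a → adj (suc v) (T a) BoolP.≟ false)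
    -- If `v` misses nothing, it can be swapped into every position, so all nodes are top.
    ... | no none = ⊥-elim (not-all-top λ a → swap a λ b _ → BoolP.¬-not λ e → none (b , e))
    ... | yes (a , ma) with FinP.any? (λ c → ¬? (a Fin.≟ c) ×-dec (adj (suc v) (T c) BoolP.≟ false))
    ...   | yes (c , a≢c , mc) = two-missed a c a≢c ma mc
    ...   | no none = only a ma λ c a≢c → BoolP.¬-not λ e → none (c , a≢c , e)
      where
      only : ∀ a → missed a → (∀ c → a ≢ c → adj (suc v) (T c) ≡ true) → Claim
      only zero    ma near = pointed-missed ma λ c → near (suc c) λ ()
      only (suc a) ma near = one-missed (suc a) refl ma (swap (suc a) λ b b≢a → near b (b≢a ∘ sym))

-- The linear program over bottles and its optimum

∑ᶻ-neg : ∀ {n} (f : Fin n → ℤ) → (∀ i → f i ℤ.≤ 0ℤ) → ∀ i → f i ℤ.< 0ℤ → ∑ᶻ f ℤ.< 0ℤ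
∑ᶻ-neg f f≤0 i f<0 = subst (ℤ._< 0ℤ) (trans (cong ℤ.-_ e) (ℤP.neg-involutive _))
  (ℤP.neg-mono-< (∑ᶻ-pos (λ i → ℤ.- f i) (λ i → ≤0⇒0≤- (f≤0 i)) i (ℤP.neg-mono-< f<0)))
  where
  e : ∑ᶻ (λ i → ℤ.- f i) ≡ ℤ.- ∑ᶻ f
  e = trans (∑ᶻ-cong λ i → sym (ℤP.-1*i≡-i (f i))) (trans (∑ᶻ-*ˡ ℤ.-1ℤ f) (ℤP.-1*i≡-i _))

module Fractional {K : ℕ} (R : Fin K → Fin K → Bool) (R-sym : ∀ i j → R i j ≡ R j i)
  (ρ W s : ℕ) (0<s : 0 ℕ.< s) (s≤W : s ℕ.≤ W) (b : Fin K → ℕ) where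

  open Bottle R R-sym ρ W s 0<s s≤W

  dummies : Tuple
  dummies _ = zero

  -- Invalid tuples are read as the all-dummy bottle, which is always valid. Thus the columns of the
  -- program are indexed by all functions, and their number is an explicit power.
  validated : ∀ T → Dec (Valid T) → Tuple
  validated T (yes _) = T
  validated T (no _)  = dummies

  opaque
    #tuples : ℕ
    #tuples = suc K ℕ.^ suc (suc ρ)

    #tuples-def : #tuples ≡ suc K ℕ.^ suc (suc ρ)
    #tuples-def = refl

    tup : Fin #tuples → Tuple
    tup j = validated (Fin.finToFun j) (valid? (Fin.finToFun j))

    tup-valid : ∀ j → Valid (tup j)
    tup-valid j = ok (Fin.finToFun j) (valid? (Fin.finToFun j))
      where
      ok : ∀ T d → Valid (validated T d)
      ok T (yes v) = v
      ok T (no _)  = λ a c _ → refl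

    tup-surjective : ∀ T → Valid T → ∃[ j ] (∀ a → tup j a ≡ T a)
    tup-surjective T v = Fin.funToFin T , ok (valid? (Fin.finToFun (Fin.funToFin T)))
      where
      ok : ∀ d a → validated (Fin.finToFun (Fin.funToFin T)) d a ≡ T a
      ok (yes _) a = FinP.finToFun-funToFin T a
      ok (no ¬p) a = ⊥-elim (¬p λ a c a≢c →
        trans (cong₂ adj (FinP.finToFun-funToFin T a) (FinP.finToFun-funToFin T c)) (v a c a≢c))

  col : Fin #tuples → Node → ℕ
  col j t = load (λ u → δ u t) (tup j)

  extend : ℤ → (Fin K → ℤ) → Node → ℤ
  extend c y zero    = c
  extend c y (suc i) = y i

  open Duality (λ j i → + col j (suc i)) (λ i → + b i) (λ j → + col j zero)

  δ-extend : ∀ p t → ∑ᶻ (λ i → p i ℤ.* + δ t (suc i)) ≡ extend 0ℤ p t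
  δ-extend p zero    = ∑ᶻ-zero _ λ i → ℤP.*-zeroʳ (p i)
  δ-extend p (suc i) = ∑ᶻ-δʳ i p

  rowᵀ-weight : ∀ p j → rowᵀ p j ≡ weight (extend 0ℤ p) (tup j)
  rowᵀ-weight p j = trans (∑ᶻ-cong λ i → trans (cong (p i ℤ.*_) (sym (∑ᶻ-+◃ _))) (sym (∑ᶻ-*ˡ (p i) _)))
    (trans (∑ᶻ-swap _) (∑ᶻ-cong λ a → trans (∑ᶻ-cong λ i → trans (cong (p i ℤ.*_) (ℤP.pos-* (coef a) _))
        (l (p i) (+ coef a) (+ δ (tup j a) (suc i))))
      (trans (∑ᶻ-*ˡ (+ coef a) _) (cong (+ coef a ℤ.*_) (δ-extend p (tup j a))))))
    where
    l : ∀ p c d → p ℤ.* (c ℤ.* d) ≡ c ℤ.* (p ℤ.* d)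
    l = ℤ-ring

  -- The bottle with cluster i in one large class and dummies elsewhere forces `p i` to be
  -- nonpositive. This is where the dummies guarantee feasibility.
  feasible : ∀ p → (∀ j → rowᵀ p j ℤ.≤ 0ℤ) → ∑ᶻ (λ i → p i ℤ.* + b i) ℤ.≤ 0ℤ
  feasible p h = subst (∑ᶻ (λ i → p i ℤ.* + b i) ℤ.≤_) (∑ᶻ-zero {K} (λ _ → 0ℤ) (λ _ → refl)) (∑ᶻ-mono λ i →
    ℤP.*-monoʳ-≤-nonNeg (+ b i) (p≤0 i))
    where
    single : Fin K → Tuple
    single i zero          = zero
    single i (suc zero)    = suc i
    single i (suc (suc _)) = zero
    single-valid : ∀ i → Valid (single i)
    single-valid i zero          c             _ = refl
    single-valid i (suc zero)    zero          _ = refl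
    single-valid i (suc zero)    (suc zero)    p = ⊥-elim (p refl)
    single-valid i (suc zero)    (suc (suc _)) _ = refl
    single-valid i (suc (suc _)) c             _ = refl
    p≤0 : ∀ i → p i ℤ.≤ 0ℤ
    p≤0 i with tup-surjective (single i) (single-valid i)
    ... | j , eq = pos-cancel-≤ 0<W (subst₂ ℤ._≤_ (trans (rowᵀ-weight p j) (trans
            (∑ᶻ-cong λ a → cong (λ t → + coef a ℤ.* extend 0ℤ p t) (eq a)) e)) (sym (ℤP.*-zeroʳ (+ W))) (h j))
      where
      e : weight (extend 0ℤ p) (single i) ≡ + W ℤ.* p i
      e = trans (∑ᶻ-∷ _) (trans (cong₂ ℤ._+_ (ℤP.*-zeroʳ (+ s)) (trans (∑ᶻ-∷ _)
        (cong (λ t → + W ℤ.* p i ℤ.+ t) (∑ᶻ-zero _ λ _ → ℤP.*-zeroʳ (+ W)))))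
        (trans (ℤP.+-identityˡ _) (ℤP.+-identityʳ _)))

  far : Fin K → ℕ
  far v = ∑ (λ i → b i ℕ.* ι (not (R v i)))

  dummyUse : (Fin #tuples → ℕ) → ℕ
  dummyUse x = ∑ (λ j → x j ℕ.* col j zero)

  -- By `mass`, μ∑b plus the dummy use is P times the total number of bottles. As W/P is ω/h and s/W
  -- is σ/ω, dividing by Pμ and by PWμ gives two lower bounds on `far v`, each raised by a share of
  -- the dummy use.
  Bounds : ℕ → (Fin #tuples → ℕ) → (Fin K → Bool) → Fin K → Set
  Bounds μ x Z v =
    (W ℕ.* (μ ℕ.* ∑ b ℕ.+ dummyUse x) ℕ.≤ P ℕ.* (μ ℕ.* far v)) ×
    (W ℕ.* (W ℕ.+ s) ℕ.* (μ ℕ.* ∑ b ℕ.+ dummyUse x)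
      ℕ.≤ P ℕ.* (W ℕ.* (μ ℕ.* far v) ℕ.+ s ℕ.* (μ ℕ.* ∑ (λ i → b i ℕ.* ι (Z i)))))

  -- When dummies are used at all, Z is the set of clusters of maximal dual weight.
  Obstruction : ℕ → (Fin #tuples → ℕ) → Set
  Obstruction μ x = dummyUse x ≡ 0 ⊎ Σ[ Z ∈ (Fin K → Bool) ]
    (∃[ v ] Z v ≡ true × 0 ℕ.< b v) × (∀ v → Z v ≡ true → Bounds μ x Z v)

  record FractionalTiling : Set where
    field
      μ           : ℕ
      x           : Fin #tuples → ℕ
      μ>0         : 0 ℕ.< μ
      covers      : ∀ i → ∑ (λ j → x j ℕ.* col j (suc i)) ≡ μ ℕ.* b i
      obstruction : Obstruction μ x

  module Counting (μ : ℕ) (x : Fin #tuples → ℕ)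
    (covers : ∀ i → ∑ (λ j → x j ℕ.* col j (suc i)) ≡ μ ℕ.* b i) where

    -- Double counting over nodes: by `covers`, cluster i occurs with total weight μ·b i, while the
    -- dummy is kept apart.
    load-total : ∀ φ → ∑ (λ j → x j ℕ.* load φ (tup j))
      ≡ φ zero ℕ.* ∑ (λ j → x j ℕ.* col j zero) ℕ.+ μ ℕ.* ∑ (λ i → b i ℕ.* φ (suc i))
    load-total φ = begin
      ∑ (λ j → x j ℕ.* load φ (tup j))                     ≡⟨ ∑-cong (λ j → cong (x j ℕ.*_) (expand j)) ⟩
      ∑ (λ j → x j ℕ.* ∑ (λ t → φ t ℕ.* col j t))          ≡⟨ ∑-cong (λ j → sym (∑-*ˡ (x j) _)) ⟩
      ∑ (λ j → ∑ (λ t → x j ℕ.* (φ t ℕ.* col j t)))        ≡⟨ ∑-swap _ ⟩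
      ∑ (λ t → ∑ (λ j → x j ℕ.* (φ t ℕ.* col j t)))        ≡⟨ ∑-cong (λ t → trans (∑-cong λ j → l (x j) (φ t) (col j t)) (∑-*ˡ (φ t) _)) ⟩
      ∑ (λ t → φ t ℕ.* ∑ (λ j → x j ℕ.* col j t))          ≡⟨ ∑-∷ _ ⟩
      φ zero ℕ.* A ℕ.+ ∑ (λ i → φ (suc i) ℕ.* ∑ (λ j → x j ℕ.* col j (suc i)))
        ≡⟨ cong (φ zero ℕ.* A ℕ.+_) (trans (∑-cong λ i → trans (cong (φ (suc i) ℕ.*_) (covers i)) (l₂ (φ (suc i)) μ (b i))) (∑-*ˡ μ _)) ⟩
      φ zero ℕ.* A ℕ.+ μ ℕ.* ∑ (λ i → b i ℕ.* φ (suc i))   ∎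
      where
      open ≡-Reasoning
      A = ∑ (λ j → x j ℕ.* col j zero)
      l : ∀ x f c → x ℕ.* (f ℕ.* c) ≡ f ℕ.* (x ℕ.* c)
      l = ℕ-ring
      l₂ : ∀ f μ b → f ℕ.* (μ ℕ.* b) ≡ μ ℕ.* (b ℕ.* f)
      l₂ = ℕ-ring
      l₃ : ∀ f c d → f ℕ.* (c ℕ.* d) ≡ c ℕ.* (d ℕ.* f)
      l₃ = ℕ-ring
      expand : ∀ j → load φ (tup j) ≡ ∑ (λ t → φ t ℕ.* col j t)
      expand j = sym (trans (∑-cong λ t → sym (∑-*ˡ (φ t) _)) (trans (∑-swap _) (∑-cong λ a →
        trans (∑-cong λ t → l₃ (φ t) (coef a) (δ (tup j a) t)) (trans (∑-*ˡ (coef a) _)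
          (cong (coef a ℕ.*_) (∑-δ (tup j a) φ))))))

    mass : P ℕ.* ∑ x ≡ μ ℕ.* ∑ b ℕ.+ ∑ (λ j → x j ℕ.* col j zero)
    mass = trans (sym (∑-*ˡ P x)) (trans (∑-cong λ j → trans (ℕP.*-comm P (x j)) (cong (x j ℕ.*_)
        (sym (trans (∑-cong λ a → ℕP.*-identityʳ (coef a)) ∑-coef))))
      (trans (load-total (λ _ → 1)) (trans (cong₂ ℕ._+_ (ℕP.*-identityˡ A) (cong (μ ℕ.*_) (∑-cong λ i → ℕP.*-identityʳ (b i))))
        (ℕP.+-comm A _))))
      where A = ∑ (λ j → x j ℕ.* col j zero)

    -- The maximal dual weight is taken over clusters with b > 0 only. Keeping the other clusters
    -- out of the used bottles makes it a bound for every weight in the support.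
    support : ∀ j → 0 ℕ.< x j → ∀ a i → tup j a ≡ suc i → 0 ℕ.< b i
    support j x>0 a i eq = ℕP.n≢0⇒n>0 λ b≡0 → ℕP.<-irrefl refl (begin-strict
      0                                   <⟨ ℕP.*-mono-< x>0 (coef>0 a) ⟩
      x j ℕ.* coef a                      ≡⟨ cong (x j ℕ.*_) (sym (trans (cong (coef a ℕ.*_) (trans (cong (λ t → δ t (suc i)) eq) (δ-refl (suc i)))) (ℕP.*-identityʳ _))) ⟩
      x j ℕ.* (coef a ℕ.* δ (tup j a) (suc i)) ≤⟨ ℕP.*-monoʳ-≤ (x j) (∑-term (λ a → coef a ℕ.* δ (tup j a) (suc i)) a) ⟩
      x j ℕ.* col j (suc i)               ≤⟨ ∑-term (λ j → x j ℕ.* col j (suc i)) j ⟩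
      ∑ (λ j → x j ℕ.* col j (suc i))     ≡⟨ trans (covers i) (trans (cong (μ ℕ.*_) b≡0) (ℕP.*-zeroʳ μ)) ⟩
      0                                   ∎)
      where
      open ℕP.≤-Reasoning

  module FromOptimal (optimal : Optimal) where
    open Optimal optimal
    μ′ : ℕ
    μ′ = ℤ.∣ μ ∣
    x′ : Fin #tuples → ℕ
    x′ j = ℤ.∣ x j ∣
    +μ′ : + μ′ ≡ μ
    +μ′ = ℤP.0≤i⇒+∣i∣≡i (ℤP.<⇒≤ μ>0)
    +x′ : ∀ j → + x′ j ≡ x j
    +x′ j = ℤP.0≤i⇒+∣i∣≡i (x≥0 j)
    μ′>0 : 0 ℕ.< μ′
    μ′>0 = ℤP.drop‿+<+ (subst (0ℤ ℤ.<_) (sym +μ′) μ>0)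
    covers : ∀ i → ∑ (λ j → x′ j ℕ.* col j (suc i)) ≡ μ′ ℕ.* b i
    covers i = ℤP.+-injective (trans (sym (∑ᶻ-+◃ _)) (trans (∑ᶻ-cong λ j →
        trans (ℤP.pos-* (x′ j) _) (cong (ℤ._* + col j (suc i)) (+x′ j)))
      (trans (primal i) (trans (cong (ℤ._* + b i) (sym +μ′)) (sym (ℤP.pos-* μ′ (b i)))))))
    open Counting μ′ x′ covers
    -- The program charges dummies by their weight in a bottle. Giving the dummy the weight -μ moves
    -- this cost to the left, so the dual constraint says that valid tuples have weight at most 0.
    w : Node → ℤ
    w = extend (ℤ.- μ) y
    w₀<0 : w zero ℤ.< 0ℤ
    w₀<0 = ℤP.neg-mono-< μ>0
    weight-w : ∀ j → weight w (tup j) ≡ rowᵀ y j ℤ.- μ ℤ.* + col j zero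
    weight-w j = trans (∑ᶻ-cong λ a → pointwise (coef a) (tup j a)) (trans (∑ᶻ-comb 1ℤ (ℤ.- μ) _ _)
      (trans (cong₂ (λ u v → 1ℤ ℤ.* u ℤ.+ ℤ.- μ ℤ.* v) (sym (rowᵀ-weight y j)) (∑ᶻ-+◃ _)) (l₁ (rowᵀ y j) μ _)))
      where
      l₁ : ∀ r m c → 1ℤ ℤ.* r ℤ.+ ℤ.- m ℤ.* c ≡ r ℤ.- m ℤ.* c
      l₁ = ℤ-ring
      l₂ : ∀ c m → c ℤ.* ℤ.- m ≡ 1ℤ ℤ.* (c ℤ.* 0ℤ) ℤ.+ ℤ.- m ℤ.* (c ℤ.* 1ℤ)
      l₂ = ℤ-ring
      l₃ : ∀ c y m → c ℤ.* y ≡ 1ℤ ℤ.* (c ℤ.* y) ℤ.+ ℤ.- m ℤ.* (c ℤ.* 0ℤ)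
      l₃ = ℤ-ring
      pointwise : ∀ c t → + c ℤ.* w t ≡ 1ℤ ℤ.* (+ c ℤ.* extend 0ℤ y t) ℤ.+ ℤ.- μ ℤ.* + (c ℕ.* δ t zero)
      pointwise c zero    = trans (l₂ (+ c) μ) (cong (λ z → 1ℤ ℤ.* (+ c ℤ.* 0ℤ) ℤ.+ ℤ.- μ ℤ.* z) (sym (ℤP.pos-* c 1)))
      pointwise c (suc i) = trans (l₃ (+ c) (y i) μ) (cong (λ z → 1ℤ ℤ.* (+ c ℤ.* y i) ℤ.+ ℤ.- μ ℤ.* z) (sym (ℤP.pos-* c 0)))
    dual-w : ∀ T → Valid T → weight w T ℤ.≤ 0ℤ
    dual-w T v with tup-surjective T v
    ... | j , eq = subst (ℤ._≤ 0ℤ) (trans (sym (weight-w j)) (∑ᶻ-cong λ a → cong (λ t → + coef a ℤ.* w t) (eq a)))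
                     (ℤP.i≤j⇒i-j≤0 (dual j))
    tight-w : ∀ j → 0 ℕ.< x′ j → weight w (tup j) ≡ 0ℤ
    tight-w j x>0 = [ (λ x≡0 → ⊥-elim (ℕP.<-irrefl (sym (cong ℤ.∣_∣ x≡0)) x>0))
      , (λ e → trans (weight-w j) (ℤP.i≡j⇒i-j≡0 e)) ]′ (slack j)
    -- A used bottle is tight. If none of its nodes has positive weight, all terms vanish, which
    -- excludes a dummy of weight -μ < 0.
    no-dummies : (∀ v → 0 ℕ.< b v → y v ℤ.≤ 0ℤ) → ∑ (λ j → x′ j ℕ.* col j zero) ≡ 0
    no-dummies y≤0 = ∑-zero _ λ j → byx j (x′ j) refl
      where
      byx : ∀ j n → n ≡ x′ j → x′ j ℕ.* col j zero ≡ 0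
      byx j zero    e = cong (ℕ._* col j zero) (sym e)
      byx j (suc n) e = trans (cong (x′ j ℕ.*_) (∑-zero _ λ a → absent a (tup j a) refl)) (ℕP.*-zeroʳ (x′ j))
        where
        x>0 : 0 ℕ.< x′ j
        x>0 = subst (0 ℕ.<_) e (s≤s z≤n)
        w≤0 : ∀ a t → tup j a ≡ t → w t ℤ.≤ 0ℤ
        w≤0 a zero    e = ℤP.<⇒≤ w₀<0
        w≤0 a (suc i) e = y≤0 i (support j x>0 a i e)
        neg* : ∀ a {u} → u ℤ.≤ 0ℤ → + coef a ℤ.* u ℤ.≤ 0ℤ
        neg* a {u} p = subst (+ coef a ℤ.* u ℤ.≤_) (ℤP.*-zeroʳ (+ coef a)) (ℤP.*-monoˡ-≤-nonNeg (+ coef a) p)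
        neg*< : ∀ a {u} → u ℤ.< 0ℤ → + coef a ℤ.* u ℤ.< 0ℤ
        neg*< a {u} p = subst (+ coef a ℤ.* u ℤ.<_) (ℤP.*-zeroʳ (+ coef a))
          (ℤP.*-monoˡ-<-pos (+ coef a) ⦃ ℤ.positive (ℤ.+<+ (coef>0 a)) ⦄ p)
        absent : ∀ a t → tup j a ≡ t → coef a ℕ.* δ (tup j a) zero ≡ 0
        absent a (suc i) e = trans (cong (λ t → coef a ℕ.* δ t zero) e) (ℕP.*-zeroʳ (coef a))
        absent a zero    e = ⊥-elim (ℤP.<-irrefl (tight-w j x>0)
          (∑ᶻ-neg _ (λ a → neg* a (w≤0 a (tup j a) refl)) a (neg*< a (subst (λ t → w t ℤ.< 0ℤ) (sym e) w₀<0))))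
    obstruction : Obstruction μ′ x′
    obstruction = [ (λ b≡0 → inj₁ (no-dummies λ v b>0 → ⊥-elim (ℕP.<-irrefl (sym (b≡0 v)) b>0))) , pos ]′ (argmax b y)
      where
      pos : (∃[ v ] 0 ℕ.< b v × (∀ u → 0 ℕ.< b u → y u ℤ.≤ y v)) → Obstruction μ′ x′
      pos (v₀ , b>0 , max) = bySign (y v₀ ℤ.≤? 0ℤ)
        where
        M : ℤ
        M = y v₀
        Z : Fin K → Bool
        Z v = does (y v ℤ.≟ M)
        bySign : Dec (M ℤ.≤ 0ℤ) → Obstruction μ′ x′
        bySign (yes M≤0) = inj₁ (no-dummies λ v b>0 → ℤP.≤-trans (max v b>0) M≤0)
        bySign (no M≰0)  = inj₂ (Z , (v₀ , dec-true (y v₀ ℤ.≟ M) refl , b>0) , bounds)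
          where
          M>0 : 0ℤ ℤ.< M
          M>0 = ℤP.≰⇒> M≰0
          bounds : ∀ v → Z v ≡ true → Bounds μ′ x′ Z v
          bounds v Zv = scale W _ (ℕP.≤-trans (ℕP.≤-reflexive (sym (∑-*ˡ W x′)))
              (ℕP.≤-trans (∑-mono λ j → term₁ j (x′ j) refl) (ℕP.≤-reflexive (load-total (nonadj v))))) ,
            scale (W ℕ.* (W ℕ.+ s)) _ (ℕP.≤-trans (ℕP.≤-reflexive (sym (∑-*ˡ (W ℕ.* (W ℕ.+ s)) x′)))
              (ℕP.≤-trans (∑-mono λ j → term₂ j (x′ j) refl) (ℕP.≤-reflexive both)))
            where
            wv : w (suc v) ≡ M
            wv with y v ℤ.≟ M
            ... | yes p = p
            top : Node → ℕ
            top t = ι (does (w t ℤ.≟ M))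
            -- M > 0 keeps the dummy out of the top nodes, so the top loads add up to μ times the
            -- weight of Z.
            top₀ : top zero ≡ 0
            top₀ = cong ι (dec-false (w zero ℤ.≟ M) λ e → ℤP.<-asym M>0 (subst (ℤ._< 0ℤ) e w₀<0))
            claim : ∀ j → 0 ℕ.< x′ j → (W ℕ.≤ load (nonadj v) (tup j)) ×
              (W ℕ.* (W ℕ.+ s) ℕ.≤ W ℕ.* load (nonadj v) (tup j) ℕ.+ s ℕ.* load top (tup j))
            claim j x>0 = Swap.claim w dual-w M M>0 v wv (tup j) (tup-valid j) (tight-w j x>0) λ a → w≤M a (tup j a) refl
              where
              w≤M : ∀ a t → tup j a ≡ t → w t ℤ.≤ M
              w≤M a zero    e = ℤP.<⇒≤ (ℤP.<-trans w₀<0 M>0)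
              w≤M a (suc i) e = max i (support j x>0 a i e)
            term₁ : ∀ j n → n ≡ x′ j → W ℕ.* x′ j ℕ.≤ x′ j ℕ.* load (nonadj v) (tup j)
            term₁ j zero    e = subst (λ n → W ℕ.* n ℕ.≤ n ℕ.* _) e (ℕP.≤-reflexive (ℕP.*-zeroʳ W))
            term₁ j (suc n) e = subst (ℕ._≤ x′ j ℕ.* load (nonadj v) (tup j)) (ℕP.*-comm (x′ j) W)
              (ℕP.*-monoʳ-≤ (x′ j) (proj₁ (claim j (subst (0 ℕ.<_) e (s≤s z≤n)))))
            term₂ : ∀ j n → n ≡ x′ j → W ℕ.* (W ℕ.+ s) ℕ.* x′ j
              ℕ.≤ x′ j ℕ.* (W ℕ.* load (nonadj v) (tup j) ℕ.+ s ℕ.* load top (tup j))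
            term₂ j zero    e = subst (λ n → W ℕ.* (W ℕ.+ s) ℕ.* n ℕ.≤ n ℕ.* (W ℕ.* load (nonadj v) (tup j) ℕ.+ s ℕ.* load top (tup j))) e
              (ℕP.≤-reflexive (ℕP.*-zeroʳ (W ℕ.* (W ℕ.+ s))))
            term₂ j (suc n) e = subst (ℕ._≤ x′ j ℕ.* (W ℕ.* load (nonadj v) (tup j) ℕ.+ s ℕ.* load top (tup j))) (ℕP.*-comm (x′ j) (W ℕ.* (W ℕ.+ s)))
              (ℕP.*-monoʳ-≤ (x′ j) (proj₂ (claim j (subst (0 ℕ.<_) e (s≤s z≤n)))))
            both : ∑ (λ j → x′ j ℕ.* (W ℕ.* load (nonadj v) (tup j) ℕ.+ s ℕ.* load top (tup j)))
              ≡ W ℕ.* (μ′ ℕ.* ∑ (λ i → b i ℕ.* ι (not (R v i)))) ℕ.+ s ℕ.* (μ′ ℕ.* ∑ (λ i → b i ℕ.* ι (Z i)))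
            both = trans (∑-cong λ j → l (x′ j) W (load (nonadj v) (tup j)) s (load top (tup j))) (trans (∑-+ _ _)
              (cong₂ ℕ._+_ (trans (∑-*ˡ W _) (cong (W ℕ.*_) (load-total (nonadj v))))
                (trans (∑-*ˡ s _) (cong (s ℕ.*_) (trans (load-total top)
                  (cong (λ z → z ℕ.* _ ℕ.+ μ′ ℕ.* ∑ (λ i → b i ℕ.* ι (Z i))) top₀))))))
              where
              l : ∀ x W m s t → x ℕ.* (W ℕ.* m ℕ.+ s ℕ.* t) ≡ W ℕ.* (x ℕ.* m) ℕ.+ s ℕ.* (x ℕ.* t)
              l = ℕ-ring
            scale : ∀ c F → c ℕ.* ∑ x′ ℕ.≤ F → c ℕ.* (μ′ ℕ.* ∑ b ℕ.+ ∑ (λ j → x′ j ℕ.* col j zero)) ℕ.≤ P ℕ.* F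
            scale c F p = subst (ℕ._≤ P ℕ.* F) (trans (l P c (∑ x′)) (cong (c ℕ.*_) mass)) (ℕP.*-monoʳ-≤ P p)
              where
              l : ∀ P c X → P ℕ.* (c ℕ.* X) ≡ c ℕ.* (P ℕ.* X)
              l = ℕ-ring

  opaque
    fractional-tiling : FractionalTiling
    fractional-tiling = record { μ = μ′ ; x = x′ ; μ>0 = μ′>0 ; covers = covers ; obstruction = obstruction }
      where open FromOptimal (strong-duality (λ j → 0≤+ _) feasible)

-- One-sided regularity

∑₂ : ∀ {m n} → (Fin m → Fin n → ℕ) → ℕ
∑₂ f = ∑ (λ u → ∑ (f u))

∑₂-cong : ∀ {m n} {f g : Fin m → Fin n → ℕ} → (∀ u v → f u v ≡ g u v) → ∑₂ f ≡ ∑₂ g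
∑₂-cong e = ∑-cong λ u → ∑-cong (e u)

∑₂-mono : ∀ {m n} {f g : Fin m → Fin n → ℕ} → (∀ u v → f u v ℕ.≤ g u v) → ∑₂ f ℕ.≤ ∑₂ g
∑₂-mono p = ∑-mono λ u → ∑-mono (p u)

∑₂-+ : ∀ {m n} (f g : Fin m → Fin n → ℕ) → ∑₂ (λ u v → f u v ℕ.+ g u v) ≡ ∑₂ f ℕ.+ ∑₂ g
∑₂-+ f g = trans (∑-cong λ u → ∑-+ (f u) (g u)) (∑-+ _ _)

∑₂-*ˡ : ∀ {m n} c (f : Fin m → Fin n → ℕ) → ∑₂ (λ u v → c ℕ.* f u v) ≡ c ℕ.* ∑₂ f
∑₂-*ˡ c f = trans (∑-cong λ u → ∑-*ˡ c (f u)) (∑-*ˡ c _)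

∑₂-× : ∀ {m n} (f : Fin m → ℕ) (g : Fin n → ℕ) → ∑₂ (λ u v → f u ℕ.* g v) ≡ ∑ f ℕ.* ∑ g
∑₂-× f g = trans (∑-cong λ u → ∑-*ˡ (f u) g) (∑-*ʳ (∑ g) f)

∑-group : ∀ {n K} (f : Fin n → Fin K) (φ : Fin K → Fin n → ℕ) →
  ∑ (λ u → φ (f u) u) ≡ ∑ (λ i → ∑ (λ u → δ (f u) i ℕ.* φ i u))
∑-group f φ = trans (∑-cong λ u → sym (∑-δ (f u) (λ i → φ i u))) (∑-swap _)

∑₂-group : ∀ {n K} (f : Fin n → Fin K) (φ : Fin K → Fin K → Fin n → Fin n → ℕ) →
  ∑₂ (λ u v → φ (f u) (f v) u v) ≡ ∑₂ (λ i j → ∑₂ (λ u v → δ (f u) i ℕ.* (δ (f v) j ℕ.* φ i j u v)))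
∑₂-group f φ = trans (∑-group f (λ i u → ∑ (λ v → φ i (f v) u v))) (∑-cong λ i →
  trans (∑-cong λ u → trans (cong (δ (f u) i ℕ.*_) (∑-group f (λ j v → φ i j u v))) (sym (∑-*ˡ (δ (f u) i) _)))
    (trans (∑-swap _) (∑-cong λ j → ∑-cong λ u → sym (∑-*ˡ (δ (f u) i) _))))

ι≤1 : ∀ b → ι b ℕ.≤ 1
ι≤1 true  = ℕP.≤-refl
ι≤1 false = z≤n

∑-ι≤ : ∀ {n} (p : Fin n → Bool) → ∑ (λ u → ι (p u)) ℕ.≤ n
∑-ι≤ {n} p = ℕP.≤-trans (∑-mono λ u → ι≤1 (p u)) (ℕP.≤-reflexive (trans (∑-const n 1) (ℕP.*-identityʳ n)))

∑₂-ι≤ : ∀ {m n} (p : Fin m → Fin n → Bool) → ∑₂ (λ u v → ι (p u v)) ℕ.≤ m ℕ.* n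
∑₂-ι≤ {m} {n} p = ℕP.≤-trans (∑-mono λ u → ∑-ι≤ (p u)) (ℕP.≤-reflexive (∑-const m n))

ι-∧ : ∀ a b → ι (a ∧ b) ≡ ι a ℕ.* ι b
ι-∧ true  b = sym (ℕP.+-identityʳ (ι b))
ι-∧ false b = refl

-- A refined label records two bits for each of the K² ordered pairs: membership in the chosen set
-- on the left and in the one on the right.
nextSize : ℕ → ℕ
nextSize K = K ℕ.* 4 ℕ.^ (K ℕ.* K)

-- All intermediate sizes are added up, so the bound also holds when the refinement stops early.
maxSize : ℕ → ℕ → ℕ
maxSize zero    K = K
maxSize (suc t) K = K ℕ.+ maxSize t (nextSize K)

-- The old label and all memberships are recovered from the new label alone, so properties of pairs
-- of vertices become properties of pairs of labels.
record Common {n K : ℕ} (f : Fin n → Fin K) (A B : Fin K → Fin K → Fin n → Bool) : Set where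
  field
    f′     : Fin n → Fin (nextSize K)
    base   : Fin (nextSize K) → Fin K
    inA    : Fin (nextSize K) → Fin K → Fin K → Bool
    inB    : Fin (nextSize K) → Fin K → Fin K → Bool
    base-f : ∀ u → base (f′ u) ≡ f u
    inA-f  : ∀ u i j → inA (f′ u) i j ≡ A i j u
    inB-f  : ∀ u i j → inB (f′ u) i j ≡ B i j u

opaque
  common-refinement : ∀ {n K} (f : Fin n → Fin K) A B → Common f A B
  common-refinement {n} {K} f A B = record
    { f′ = λ u → Fin.combine (f u) (Fin.funToFin (code u))
    ; base = λ a → proj₁ (Fin.remQuot {K} _ a)
    ; inA = λ a i j → bitA (bits a (Fin.combine i j))
    ; inB = λ a i j → bitB (bits a (Fin.combine i j))
    ; base-f = λ u → cong proj₁ (FinP.remQuot-combine (f u) _)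
    ; inA-f = λ u i j → trans (cong bitA (bits-f u i j)) (bitA-pack (A i j u) (B i j u))
    ; inB-f = λ u i j → trans (cong bitB (bits-f u i j)) (bitB-pack (A i j u) (B i j u)) }
    where
    pack : Bool → Bool → Fin 4
    pack false false = zero
    pack false true  = suc zero
    pack true  false = suc (suc zero)
    pack true  true  = suc (suc (suc zero))
    bitA bitB : Fin 4 → Bool
    bitA zero          = false
    bitA (suc zero)    = false
    bitA (suc (suc _)) = true
    bitB zero                = false
    bitB (suc zero)          = true
    bitB (suc (suc zero))    = false
    bitB (suc (suc (suc _))) = true
    bitA-pack : ∀ a b → bitA (pack a b) ≡ a
    bitA-pack false false = refl
    bitA-pack false true  = refl
    bitA-pack true  false = refl
    bitA-pack true  true  = refl
    bitB-pack : ∀ a b → bitB (pack a b) ≡ b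
    bitB-pack false false = refl
    bitB-pack false true  = refl
    bitB-pack true  false = refl
    bitB-pack true  true  = refl
    code : Fin n → Fin (K ℕ.* K) → Fin 4
    code u p = pack (A i j u) (B i j u)
      where
      i j : Fin K
      i = proj₁ (Fin.remQuot {K} K p)
      j = proj₂ (Fin.remQuot {K} K p)
    bits : Fin (nextSize K) → Fin (K ℕ.* K) → Fin 4
    bits a = Fin.finToFun (proj₂ (Fin.remQuot {K} _ a))
    bits-f : ∀ u i j → bits (Fin.combine (f u) (Fin.funToFin (code u))) (Fin.combine i j) ≡ pack (A i j u) (B i j u)
    bits-f u i j = trans (cong (λ q → Fin.finToFun (proj₂ q) (Fin.combine i j)) (FinP.remQuot-combine (f u) (Fin.funToFin (code u))))
      (trans (FinP.finToFun-funToFin (code u) (Fin.combine i j))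
        (cong (λ q → pack (A (proj₁ q) (proj₂ q) u) (B (proj₁ q) (proj₂ q) u)) (FinP.remQuot-combine i j)))

-- The parameters are reciprocals: subsets count as large from a share 1/E of their part on, the
-- density threshold is 1/D, and a bad area of n²/Q is tolerated.
module Regularity {n : ℕ} (Adj : Fin n → Fin n → Bool) (E D Q : ℕ) where

  module _ {K : ℕ} (f : Fin n → Fin K) where

    size : Fin K → ℕ
    size i = ∑ (λ u → δ (f u) i)

    card : (Fin n → Bool) → Fin K → ℕ
    card A i = ∑ (λ u → δ (f u) i ℕ.* ι (A u))

    edges : (Fin n → Bool) → (Fin n → Bool) → Fin K → Fin K → ℕ
    edges A B i j = ∑₂ (λ u v → (δ (f u) i ℕ.* ι (A u)) ℕ.* ((δ (f v) j ℕ.* ι (B v)) ℕ.* ι (Adj u v)))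

    Dense : Fin K → Fin K → Set
    Dense i j = ∀ A B → size i ℕ.≤ E ℕ.* card A i → size j ℕ.≤ E ℕ.* card B j →
      card A i ℕ.* card B j ℕ.≤ D ℕ.* edges A B i j

    SparsePair : Fin K → Fin K → Subset n → Subset n → Set
    SparsePair i j A B = (size i ℕ.≤ E ℕ.* card (lookup A) i × size j ℕ.≤ E ℕ.* card (lookup B) j) ×
      D ℕ.* edges (lookup A) (lookup B) i j ℕ.< card (lookup A) i ℕ.* card (lookup B) j

    Verdict : Fin K → Fin K → Set
    Verdict i j = Dense i j ⊎ (∃[ A ] ∃[ B ] SparsePair i j A B)

    opaque
      -- Searching all pairs of subsets makes the alternative constructive. A failure of the search
      -- refutes sparseness for tabulated predicates, hence for arbitrary ones.
      verdict : ∀ i j → Verdict i j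
      verdict i j = decide (anySubset? λ A → anySubset? λ B → (_ ℕP.≤? _ ×-dec _ ℕP.≤? _) ×-dec (_ ℕP.<? _))
        where
        card-tab : ∀ A i → card (lookup (tabulate A)) i ≡ card A i
        card-tab A i = ∑-cong λ u → cong (λ b → δ (f u) i ℕ.* ι b) (VecP.lookup∘tabulate A u)
        edges-tab : ∀ A B → edges (lookup (tabulate A)) (lookup (tabulate B)) i j ≡ edges A B i j
        edges-tab A B = ∑₂-cong λ u v → cong₂ (λ a b → (δ (f u) i ℕ.* ι a) ℕ.* ((δ (f v) j ℕ.* ι b) ℕ.* ι (Adj u v)))
          (VecP.lookup∘tabulate A u) (VecP.lookup∘tabulate B v)
        decide : Dec (∃[ A ] ∃[ B ] SparsePair i j A B) → Verdict i j
        decide (yes p) = inj₂ p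
        decide (no ¬p) = inj₁ λ A B a b → ℕP.≮⇒≥ λ lt → ¬p (tabulate A , tabulate B ,
          (subst (λ c → size i ℕ.≤ E ℕ.* c) (sym (card-tab A i)) a , subst (λ c → size j ℕ.≤ E ℕ.* c) (sym (card-tab B j)) b) ,
          subst₂ (λ e c → D ℕ.* e ℕ.< c) (sym (edges-tab A B)) (sym (cong₂ ℕ._*_ (card-tab A i) (card-tab B j))) lt)

    isDense : Fin K → Fin K → Bool
    isDense i j = [ (λ _ → true) , (λ _ → false) ]′ (verdict i j)

    isDense-sound : ∀ i j → isDense i j ≡ true → Dense i j
    isDense-sound i j = sound (verdict i j)
      where
      sound : ∀ (v : Verdict i j) → [ (λ _ → true) , (λ _ → false) ]′ v ≡ true → Dense i j
      sound (inj₁ d) _ = d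

    pickA pickB : Fin K → Fin K → Fin n → Bool
    pickA i j = [ (λ _ _ → false) , (λ p → lookup (proj₁ p)) ]′ (verdict i j)
    pickB i j = [ (λ _ _ → false) , (λ p → lookup (proj₁ (proj₂ p))) ]′ (verdict i j)

    pick-sparse : ∀ i j → isDense i j ≡ false →
      (D ℕ.* edges (pickA i j) (pickB i j) i j ℕ.≤ card (pickA i j) i ℕ.* card (pickB i j) j) ×
      (size i ℕ.* size j ℕ.≤ E ℕ.* E ℕ.* (card (pickA i j) i ℕ.* card (pickB i j) j))
    pick-sparse i j = sparse (verdict i j)
      where
      l : ∀ E a b → (E ℕ.* a) ℕ.* (E ℕ.* b) ≡ E ℕ.* E ℕ.* (a ℕ.* b)
      l = ℕ-ring
      A B : Verdict i j → Fin n → Bool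
      A v = [ (λ _ _ → false) , (λ p → lookup (proj₁ p)) ]′ v
      B v = [ (λ _ _ → false) , (λ p → lookup (proj₁ (proj₂ p))) ]′ v
      sparse : ∀ (v : Verdict i j) → [ (λ _ → true) , (λ _ → false) ]′ v ≡ false →
        (D ℕ.* edges (A v) (B v) i j ℕ.≤ card (A v) i ℕ.* card (B v) j) ×
        (size i ℕ.* size j ℕ.≤ E ℕ.* E ℕ.* (card (A v) i ℕ.* card (B v) j))
      sparse (inj₂ (A , B , (a , b) , lt)) _ = ℕP.<⇒≤ lt ,
        ℕP.≤-trans (ℕP.*-mono-≤ a b) (ℕP.≤-reflexive (l E (card (lookup A) i) (card (lookup B) j)))

    area : (Fin K → Fin K → Bool) → ℕ
    area S = ∑₂ (λ u v → ι (S (f u) (f v)))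

    edgesIn : (Fin K → Fin K → Bool) → ℕ
    edgesIn S = ∑₂ (λ u v → ι (S (f u) (f v)) ℕ.* ι (Adj u v))

  bad : ∀ {K} → (Fin n → Fin K) → (Fin K → Fin K → Bool) → Fin K → Fin K → Bool
  bad f dead i j = not (dead i j) ∧ not (isDense f i j)

  -- The dead area replaces the mean square density as the quantity that grows with each refinement.
  record Labelling (K : ℕ) : Set where
    field
      f      : Fin n → Fin K
      dead   : Fin K → Fin K → Bool
      sparse : D ℕ.* edgesIn f dead ℕ.≤ area f dead

  open Labelling

  deadArea badArea : ∀ {K} → Labelling K → ℕ
  deadArea L = area (f L) (dead L)
  badArea L = area (f L) (bad (f L) (dead L))

  refine : ∀ {K} (L : Labelling K) →
    Σ[ L′ ∈ Labelling (nextSize K) ] E ℕ.* E ℕ.* deadArea L ℕ.+ badArea L ℕ.≤ E ℕ.* E ℕ.* deadArea L′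
  refine {K} L = record { f = f′ ; dead = dead′ ; sparse = sparse′ } , growth
    where
    f₀ = f L
    d₀ = dead L
    A = pickA f₀
    B = pickB f₀
    bad₀ = bad f₀ d₀
    open Common (common-refinement f₀ A B)
    dead′ : Fin (nextSize K) → Fin (nextSize K) → Bool
    dead′ a c = d₀ (base a) (base c) ∨ (bad₀ (base a) (base c) ∧ (inA a (base a) (base c) ∧ inB c (base a) (base c)))
    new : Fin K → Fin K → Fin n → Fin n → ℕ
    new i j u v = ι (bad₀ i j) ℕ.* (ι (A i j u) ℕ.* ι (B i j v))
    -- A new rectangle is taken from a bad pair, and bad pairs are live. So the two sources of
    -- deadness are disjoint, and areas and edge counts add exactly.
    split : ∀ u v → ι (dead′ (f′ u) (f′ v)) ≡ ι (d₀ (f₀ u) (f₀ v)) ℕ.+ new (f₀ u) (f₀ v) u v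
    split u v = trans (cong ι eq) (ι-split (d₀ (f₀ u) (f₀ v)) (isDense f₀ (f₀ u) (f₀ v)) (A (f₀ u) (f₀ v) u) (B (f₀ u) (f₀ v) v))
      where
      eq : dead′ (f′ u) (f′ v) ≡ d₀ (f₀ u) (f₀ v) ∨ (bad₀ (f₀ u) (f₀ v) ∧ (A (f₀ u) (f₀ v) u ∧ B (f₀ u) (f₀ v) v))
      eq = trans (cong₂ (λ i j → d₀ i j ∨ (bad₀ i j ∧ (inA (f′ u) i j ∧ inB (f′ v) i j))) (base-f u) (base-f v))
        (cong₂ (λ x y → d₀ (f₀ u) (f₀ v) ∨ (bad₀ (f₀ u) (f₀ v) ∧ (x ∧ y))) (inA-f u (f₀ u) (f₀ v)) (inB-f v (f₀ u) (f₀ v)))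
      ι-split : ∀ d e a b → ι (d ∨ ((not d ∧ not e) ∧ (a ∧ b))) ≡ ι d ℕ.+ ι (not d ∧ not e) ℕ.* (ι a ℕ.* ι b)
      ι-split true  e     a b = refl
      ι-split false true  a b = refl
      ι-split false false a b = trans (ι-∧ a b) (sym (ℕP.+-identityʳ _))
    inner : (Fin n → Fin n → ℕ) → Fin K → Fin K → ℕ
    inner g i j = ∑₂ (λ u v → (δ (f₀ u) i ℕ.* ι (A i j u)) ℕ.* ((δ (f₀ v) j ℕ.* ι (B i j v)) ℕ.* g u v))
    new-sum : ∀ g → ∑₂ (λ u v → new (f₀ u) (f₀ v) u v ℕ.* g u v) ≡ ∑₂ (λ i j → ι (bad₀ i j) ℕ.* inner g i j)
    new-sum g = trans (∑₂-group f₀ (λ i j u v → new i j u v ℕ.* g u v)) (∑₂-cong λ i j →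
      trans (∑₂-cong λ u v → l (δ (f₀ u) i) (δ (f₀ v) j) (ι (bad₀ i j)) (ι (A i j u)) (ι (B i j v)) (g u v))
        (∑₂-*ˡ (ι (bad₀ i j)) _))
      where
      l : ∀ a b c x y g → a ℕ.* (b ℕ.* ((c ℕ.* (x ℕ.* y)) ℕ.* g)) ≡ c ℕ.* ((a ℕ.* x) ℕ.* ((b ℕ.* y) ℕ.* g))
      l = ℕ-ring
    cards : Fin K → Fin K → ℕ
    cards i j = card f₀ (A i j) i ℕ.* card f₀ (B i j) j
    new-area : ∑₂ (λ u v → new (f₀ u) (f₀ v) u v) ≡ ∑₂ (λ i j → ι (bad₀ i j) ℕ.* cards i j)
    new-area = trans (∑₂-cong λ u v → sym (ℕP.*-identityʳ (new (f₀ u) (f₀ v) u v))) (trans (new-sum (λ _ _ → 1))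
      (∑₂-cong λ i j → cong (ι (bad₀ i j) ℕ.*_) (trans (∑₂-cong λ u v →
        cong (δ (f₀ u) i ℕ.* ι (A i j u) ℕ.*_) (ℕP.*-identityʳ (δ (f₀ v) j ℕ.* ι (B i j v)))) (∑₂-× _ _))))
    bad-area : area f₀ bad₀ ≡ ∑₂ (λ i j → ι (bad₀ i j) ℕ.* (size f₀ i ℕ.* size f₀ j))
    bad-area = trans (∑₂-group f₀ (λ i j u v → ι (bad₀ i j))) (∑₂-cong λ i j → trans
      (∑₂-cong λ u v → l (δ (f₀ u) i) (δ (f₀ v) j) (ι (bad₀ i j)))
      (trans (∑₂-*ˡ (ι (bad₀ i j)) _) (cong (ι (bad₀ i j) ℕ.*_) (∑₂-× _ _))))
      where
      l : ∀ a b c → a ℕ.* (b ℕ.* c) ≡ c ℕ.* (a ℕ.* b)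
      l = ℕ-ring
    area′ : area f′ dead′ ≡ area f₀ d₀ ℕ.+ ∑₂ (λ i j → ι (bad₀ i j) ℕ.* cards i j)
    area′ = trans (∑₂-cong split) (trans (∑₂-+ _ _) (cong (area f₀ d₀ ℕ.+_) new-area))
    edges′ : edgesIn f′ dead′ ≡ edgesIn f₀ d₀ ℕ.+ ∑₂ (λ i j → ι (bad₀ i j) ℕ.* edges f₀ (A i j) (B i j) i j)
    edges′ = trans (∑₂-cong λ u v → trans (cong (ℕ._* ι (Adj u v)) (split u v))
        (ℕP.*-distribʳ-+ (ι (Adj u v)) (ι (d₀ (f₀ u) (f₀ v))) (new (f₀ u) (f₀ v) u v)))
      (trans (∑₂-+ _ _) (cong (edgesIn f₀ d₀ ℕ.+_) (new-sum λ u v → ι (Adj u v))))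
    when-bad : ∀ i j {x y} → (isDense f₀ i j ≡ false → x ℕ.≤ y) → ι (bad₀ i j) ℕ.* x ℕ.≤ ι (bad₀ i j) ℕ.* y
    when-bad i j p = go (dead L i j) (isDense f₀ i j) p
      where
      go : ∀ d e {x y} → (e ≡ false → x ℕ.≤ y) → ι (not d ∧ not e) ℕ.* x ℕ.≤ ι (not d ∧ not e) ℕ.* y
      go true  e     p = z≤n
      go false true  p = z≤n
      go false false p = ℕP.*-monoʳ-≤ 1 (p refl)
    sparse′ : D ℕ.* edgesIn f′ dead′ ℕ.≤ area f′ dead′
    sparse′ = begin
      D ℕ.* edgesIn f′ dead′
        ≡⟨ trans (cong (D ℕ.*_) edges′) (ℕP.*-distribˡ-+ D (edgesIn f₀ d₀) _) ⟩
      D ℕ.* edgesIn f₀ d₀ ℕ.+ D ℕ.* ∑₂ (λ i j → ι (bad₀ i j) ℕ.* edges f₀ (A i j) (B i j) i j)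
        ≡⟨ cong (D ℕ.* edgesIn f₀ d₀ ℕ.+_) (trans (sym (∑₂-*ˡ D _)) (∑₂-cong λ i j → l D (ι (bad₀ i j)) (edges f₀ (A i j) (B i j) i j))) ⟩
      D ℕ.* edgesIn f₀ d₀ ℕ.+ ∑₂ (λ i j → ι (bad₀ i j) ℕ.* (D ℕ.* edges f₀ (A i j) (B i j) i j))
        ≤⟨ ℕP.+-mono-≤ (sparse L) (∑₂-mono λ i j → when-bad i j λ e → proj₁ (pick-sparse f₀ i j e)) ⟩
      area f₀ d₀ ℕ.+ ∑₂ (λ i j → ι (bad₀ i j) ℕ.* cards i j)
        ≡⟨ sym area′ ⟩
      area f′ dead′ ∎
      where
      open ℕP.≤-Reasoning
      l : ∀ D c x → D ℕ.* (c ℕ.* x) ≡ c ℕ.* (D ℕ.* x)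
      l = ℕ-ring
    growth : E ℕ.* E ℕ.* area f₀ d₀ ℕ.+ area f₀ bad₀ ℕ.≤ E ℕ.* E ℕ.* area f′ dead′
    growth = begin
      E ℕ.* E ℕ.* area f₀ d₀ ℕ.+ area f₀ bad₀
        ≤⟨ ℕP.+-monoʳ-≤ (E ℕ.* E ℕ.* area f₀ d₀) (ℕP.≤-trans (ℕP.≤-reflexive bad-area) (∑₂-mono λ i j → when-bad i j λ e → proj₂ (pick-sparse f₀ i j e))) ⟩
      E ℕ.* E ℕ.* area f₀ d₀ ℕ.+ ∑₂ (λ i j → ι (bad₀ i j) ℕ.* (E ℕ.* E ℕ.* cards i j))
        ≡⟨ cong (E ℕ.* E ℕ.* area f₀ d₀ ℕ.+_) (trans (∑₂-cong λ i j → l (ι (bad₀ i j)) (E ℕ.* E) (cards i j)) (∑₂-*ˡ (E ℕ.* E) _)) ⟩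
      E ℕ.* E ℕ.* area f₀ d₀ ℕ.+ E ℕ.* E ℕ.* ∑₂ (λ i j → ι (bad₀ i j) ℕ.* cards i j)
        ≡⟨ trans (sym (ℕP.*-distribˡ-+ (E ℕ.* E) (area f₀ d₀) _)) (cong (E ℕ.* E ℕ.*_) (sym area′)) ⟩
      E ℕ.* E ℕ.* area f′ dead′ ∎
      where
      open ℕP.≤-Reasoning
      l : ∀ c e x → c ℕ.* (e ℕ.* x) ≡ e ℕ.* (c ℕ.* x)
      l = ℕ-ring

  record Regular (bound : ℕ) : Set where
    field
      K         : ℕ
      labelling : Labelling K
      K≤        : K ℕ.≤ bound
      few-bad   : Q ℕ.* badArea labelling ℕ.≤ n ℕ.* n

  -- Each unsuccessful round raises E²Q·`deadArea` by more than n², and this quantity never exceeds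
  -- E²Q·n². So one unit of fuel more than this is enough.
  rounds : ℕ
  rounds = E ℕ.* E ℕ.* Q

  opaque
    regularize : 0 ℕ.< n → Regular (maxSize (suc rounds) 1)
    regularize 0<n = go (suc rounds) 0 initial z≤n (ℕP.n<1+n rounds)
      where
      initial : Labelling 1
      initial = record { f = λ _ → zero ; dead = λ _ _ → false
        ; sparse = ℕP.≤-trans (ℕP.≤-reflexive (trans (cong (D ℕ.*_) (∑-zero _ λ u → ∑-zero _ λ v → refl)) (ℕP.*-zeroʳ D))) z≤n }
      go : ∀ fuel done {K} (L : Labelling K) → done ℕ.* (n ℕ.* n) ℕ.≤ E ℕ.* E ℕ.* Q ℕ.* deadArea L →
        rounds ℕ.< done ℕ.+ fuel → Regular (maxSize fuel K)
      go zero done {K} L progress enough = ⊥-elim (ℕP.<⇒≱ {rounds ℕ.* (n ℕ.* n)} {done ℕ.* (n ℕ.* n)}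
        (ℕP.*-monoˡ-< (n ℕ.* n) ⦃ ℕ.>-nonZero (ℕP.*-mono-< 0<n 0<n) ⦄ (subst (rounds ℕ.<_) (ℕP.+-identityʳ done) enough))
        (ℕP.≤-trans progress (ℕP.*-monoʳ-≤ rounds (∑₂-ι≤ (λ u v → dead L (f L u) (f L v))))))
      go (suc fuel) done {K} L progress enough = decide (Q ℕ.* badArea L ℕP.≤? n ℕ.* n)
        where
        weaken : Regular (maxSize fuel (nextSize K)) → Regular (K ℕ.+ maxSize fuel (nextSize K))
        weaken r = record { K = Regular.K r ; labelling = Regular.labelling r
          ; K≤ = ℕP.≤-trans (Regular.K≤ r) (ℕP.m≤n+m _ K) ; few-bad = Regular.few-bad r }
        decide : Dec (Q ℕ.* badArea L ℕ.≤ n ℕ.* n) → Regular (K ℕ.+ maxSize fuel (nextSize K))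
        decide (yes p) = record { K = K ; labelling = L ; K≤ = ℕP.m≤m+n K _ ; few-bad = p }
        decide (no ¬p) = weaken (go fuel (suc done) (proj₁ (refine L)) progress′
          (subst (rounds ℕ.<_) (ℕP.+-suc done fuel) enough))
          where
          l : ∀ e q d b → q ℕ.* b ℕ.+ e ℕ.* q ℕ.* d ≡ q ℕ.* (e ℕ.* d ℕ.+ b)
          l = ℕ-ring
          l₂ : ∀ e q d → q ℕ.* (e ℕ.* d) ≡ e ℕ.* q ℕ.* d
          l₂ = ℕ-ring
          progress′ : suc done ℕ.* (n ℕ.* n) ℕ.≤ E ℕ.* E ℕ.* Q ℕ.* deadArea (proj₁ (refine L))
          progress′ = ℕP.≤-trans (ℕP.+-mono-≤ (ℕP.<⇒≤ (ℕP.≰⇒> ¬p)) progress)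
            (ℕP.≤-trans (ℕP.≤-reflexive (l (E ℕ.* E) Q (deadArea L) (badArea L)))
              (ℕP.≤-trans (ℕP.*-monoʳ-≤ Q (proj₂ (refine L))) (ℕP.≤-reflexive (l₂ (E ℕ.* E) Q (deadArea (proj₁ (refine L)))))))

-- Embedding H into dense parts

# : ∀ {n} → (Fin n → Bool) → ℕ
# A = ∑ (λ u → ι (A u))

_⊆_ : ∀ {n} → (Fin n → Bool) → (Fin n → Bool) → Set
A ⊆ B = ∀ u → A u ≡ true → B u ≡ true

∑-δ₁ : ∀ {n} (j : Fin n) → ∑ (δ j) ≡ 1
∑-δ₁ j = trans (∑-cong λ i → sym (ℕP.*-identityʳ (δ j i))) (∑-δ j (λ _ → 1))

δ-≡ : ∀ {n} {t u : Fin n} → t ≡ u → δ t u ≡ 1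
δ-≡ {t = t} refl = δ-refl t

#-complement : ∀ {n} (p : Fin n → Bool) → # p ℕ.+ # (λ u → not (p u)) ≡ n
#-complement {n} p = trans (sym (∑-+ _ _)) (trans (∑-cong λ u → go (p u)) (trans (∑-const n 1) (ℕP.*-identityʳ n)))
  where
  go : ∀ b → ι b ℕ.+ ι (not b) ≡ 1
  go true  = refl
  go false = refl

ι-mono : ∀ {a b} → (a ≡ true → b ≡ true) → ι a ℕ.≤ ι b
ι-mono {false} p = z≤n
ι-mono {true}  p = ℕP.≤-reflexive (cong ι (sym (p refl)))

∧-true : ∀ {a b} → a ∧ b ≡ true → a ≡ true × b ≡ true
∧-true {true} {true} _ = refl , refl

does-≡ : ∀ {n} {t u : Fin n} → does (t Fin.≟ u) ≡ true → t ≡ u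
does-≡ {t = t} {u} e with t Fin.≟ u
... | yes p = p

remove-one : ∀ {n} (C : Fin n → Bool) v → # C ℕ.≤ suc (# (λ w → C w ∧ not (does (v Fin.≟ w))))
remove-one C v = ℕP.≤-trans (∑-mono λ w → go (C w) (does (v Fin.≟ w)))
  (ℕP.≤-reflexive (trans (∑-+ _ _) (cong (λ t → t ℕ.+ # (λ w → C w ∧ not (does (v Fin.≟ w)))) (∑-δ₁ v))))
  where
  go : ∀ c d → ι c ℕ.≤ ι d ℕ.+ ι (c ∧ not d)
  go true  true  = ℕP.≤-refl
  go true  false = ℕP.≤-refl
  go false d     = z≤n

module Embedding {n : ℕ} (Adj : Fin n → Fin n → Bool) (irrefl : ∀ v → Adj v v ≡ false) (E D : ℕ) (2≤D : 2 ℕ.≤ D) where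

  e : (Fin n → Bool) → (Fin n → Bool) → ℕ
  e A B = ∑ (λ u → ι (A u) ℕ.* # (λ v → B v ∧ Adj u v))

  -- `m` and `m′` are the sizes of the parts in which the candidate sets began. They stay fixed
  -- while `C` and `C′` shrink, so subsets inherit the property as it stands.
  DensePair : ℕ → ℕ → (Fin n → Bool) → (Fin n → Bool) → Set
  DensePair m m′ C C′ = ∀ A B → A ⊆ C → B ⊆ C′ → m ℕ.≤ E ℕ.* # A → m′ ℕ.≤ E ℕ.* # B → # A ℕ.* # B ℕ.≤ D ℕ.* e A B

  -- Otherwise the poor vertices form a large set, and density applies to them and `C′`. But each
  -- has D times its degree into `C′` strictly below the size of `C′`, and `total` adds up this
  -- strictness.
  few-poor : ∀ {m m′ C C′} → DensePair m m′ C C′ → 0 ℕ.< m → m′ ℕ.≤ E ℕ.* # C′ →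
    E ℕ.* # (λ v → C v ∧ does (D ℕ.* # (λ w → C′ w ∧ Adj v w) ℕP.<? # C′)) ℕ.≤ m
  few-poor {m} {m′} {C} {C′} dense 0<m big = decide (E ℕ.* # poor ℕP.≤? m)
    where
    poor : Fin n → Bool
    poor v = C v ∧ does (D ℕ.* # (λ w → C′ w ∧ Adj v w) ℕP.<? # C′)
    term : ∀ v → ι (poor v) ℕ.* suc (D ℕ.* # (λ w → C′ w ∧ Adj v w)) ℕ.≤ ι (poor v) ℕ.* # C′
    term v = go (C v) (D ℕ.* # (λ w → C′ w ∧ Adj v w) ℕP.<? # C′)
      where
      go : ∀ c {x y} (d : Dec (x ℕ.< y)) → ι (c ∧ does d) ℕ.* suc x ℕ.≤ ι (c ∧ does d) ℕ.* y
      go false d       = z≤n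
      go true  (yes p) = ℕP.*-monoʳ-≤ 1 p
      go true  (no _)  = z≤n
    total : # poor ℕ.+ D ℕ.* e poor C′ ℕ.≤ # poor ℕ.* # C′
    total = ℕP.≤-trans (ℕP.≤-reflexive (sym (trans (∑-cong λ v → l (ι (poor v)) D (# (λ w → C′ w ∧ Adj v w)))
        (trans (∑-+ _ _) (cong (# poor ℕ.+_) (∑-*ˡ D _)))))) (ℕP.≤-trans (∑-mono term) (ℕP.≤-reflexive (∑-*ʳ (# C′) _)))
      where
      l : ∀ i D c → i ℕ.* suc (D ℕ.* c) ≡ i ℕ.+ D ℕ.* (i ℕ.* c)
      l = ℕ-ring
    decide : Dec (E ℕ.* # poor ℕ.≤ m) → E ℕ.* # poor ℕ.≤ m
    decide (yes p) = p
    decide (no ¬p) = ⊥-elim (ℕP.<⇒≱ some (ℕP.+-cancelʳ-≤ (D ℕ.* e poor C′) (# poor) 0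
        (ℕP.≤-trans total (dense poor C′ (λ u q → proj₁ (∧-true q)) (λ _ q → q) (ℕP.<⇒≤ (ℕP.≰⇒> ¬p)) big))))
      where
      some : 0 ℕ.< # poor
      some = ℕP.n≢0⇒n>0 λ z → ¬p (subst (ℕ._≤ m) (sym (trans (cong (E ℕ.*_) z) (ℕP.*-zeroʳ E))) z≤n)

  record Copy {h} (H : Fin h → Fin h → Bool) (C : Fin h → Fin n → Bool) : Set where
    field
      φ         : Fin h → Fin n
      inside    : ∀ u → C u (φ u) ≡ true
      injective : ∀ u u′ → φ u ≡ φ u′ → u ≡ u′
      preserves : ∀ u u′ → H u u′ ≡ true → Adj (φ u) (φ u′) ≡ true

  -- Vertices of H are placed one at a time, each on a candidate rich towards the sets of its
  -- neighbours. A placement shrinks a candidate set by a factor D at worst, so `q` becomes q·D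
  -- while h drops by one; q·D^h is unchanged, and the size conditions persist.
  embed : (Adj-sym : ∀ u v → Adj u v ≡ Adj v u) → ∀ {h} (H : Fin h → Fin h → Bool) (H-sym : ∀ u v → H u v ≡ H v u)
    (H-irrefl : ∀ u → H u u ≡ false) (C : Fin h → Fin n → Bool) (m : Fin h → ℕ) (q : ℕ) →
    (∀ u u′ → H u u′ ≡ true → DensePair (m u) (m u′) (C u) (C u′)) →
    (∀ u → m u ℕ.≤ q ℕ.* # (C u)) →
    suc h ℕ.* (q ℕ.* D ℕ.^ h) ℕ.≤ E → (∀ u → 2 ℕ.* (q ℕ.* D ℕ.^ h) ℕ.< m u) → Copy H C
  embed Adj-sym {zero} H H-sym H-irrefl C m q dense large E-big m-big = record
    { φ = λ () ; inside = λ () ; injective = λ () ; preserves = λ () }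
  embed Adj-sym {suc h} H H-sym H-irrefl C m q dense large E-big m-big = build (FinP.any? good?)
    where
    poor : Fin h → Fin n → Bool
    poor u v = C zero v ∧ does (D ℕ.* # (λ w → C (suc u) w ∧ Adj v w) ℕP.<? # (C (suc u)))
    Good : Fin n → Set
    Good v = C zero v ≡ true × (∀ u → H zero (suc u) ≡ true → # (C (suc u)) ℕ.≤ D ℕ.* # (λ w → C (suc u) w ∧ Adj v w))
    good? : ∀ v → Dec (Good v)
    good? v = (C zero v BoolP.≟ true) ×-dec FinP.all? λ u → (H zero (suc u) BoolP.≟ true) →-dec (_ ℕP.≤? _)
    1≤D^ : ∀ k → 1 ℕ.≤ D ℕ.^ k
    1≤D^ k = ℕP.m^n>0 D ⦃ ℕ.>-nonZero (ℕP.<-≤-trans (s≤s z≤n) 2≤D) ⦄ k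
    q≤ : q ℕ.≤ q ℕ.* D ℕ.^ suc h
    q≤ = ℕP.≤-trans (ℕP.≤-reflexive (sym (ℕP.*-identityʳ q))) (ℕP.*-monoʳ-≤ q (1≤D^ (suc h)))
    0<q : 0 ℕ.< q
    0<q = ℕP.n≢0⇒n>0 λ z → ℕP.<⇒≱ (ℕP.≤-<-trans z≤n (m-big zero)) (subst (λ q → m zero ℕ.≤ q ℕ.* # (C zero)) z (large zero))
    q≤E : q ℕ.≤ E
    q≤E = ℕP.≤-trans q≤ (ℕP.≤-trans (ℕP.m≤m+n _ _) E-big)
    hq<E : h ℕ.* q ℕ.< E
    hq<E = ℕP.<-≤-trans (ℕP.<-≤-trans (ℕP.m<n+m (h ℕ.* q) 0<q) (ℕP.+-monoʳ-≤ q (ℕP.m≤n+m (h ℕ.* q) q)))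
      (ℕP.≤-trans (ℕP.*-monoʳ-≤ (suc (suc h)) q≤) E-big)
    -- A set with at least two elements loses at most half of them when `v` is deleted, which the
    -- factor D ≥ 2 absorbs.
    2≤C : ∀ u → 2 ℕ.≤ # (C u)
    2≤C u = ℕP.*-cancelˡ-≤ q ⦃ ℕ.>-nonZero 0<q ⦄ (ℕP.≤-trans (ℕP.≤-reflexive (ℕP.*-comm q 2))
      (ℕP.≤-trans (ℕP.*-monoʳ-≤ 2 q≤) (ℕP.≤-trans (ℕP.<⇒≤ (m-big u)) (large u))))
    m>0 : ∀ u → 0 ℕ.< m u
    m>0 u = ℕP.≤-<-trans z≤n (m-big u)
    build : Dec (∃[ v ] Good v) → Copy H C
    -- Union bound: if every candidate were poor for some neighbour, E·|C₀| would be at most h·m₀,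
    -- hence at most h·q·|C₀|, against h·q < E.
    build (no none) = ⊥-elim (ℕP.<⇒≱ (ℕP.*-monoˡ-< (# (C zero)) ⦃ ℕ.>-nonZero (ℕP.<-≤-trans (s≤s z≤n) (2≤C zero)) ⦄ hq<E) bound)
      where
      adjPoor : Fin h → Fin n → Bool
      adjPoor u v = H zero (suc u) ∧ poor u v
      hit-by-poor : ∀ v → ι (C zero v) ℕ.≤ ∑ (λ u → ι (adjPoor u v))
      hit-by-poor v = go (C zero v) refl
        where
        go : ∀ c → c ≡ C zero v → ι c ℕ.≤ ∑ (λ u → ι (adjPoor u v))
        go false _ = z≤n
        go true  e = find (FinP.any? λ u → adjPoor u v BoolP.≟ true)
          where
          find : Dec (∃[ u ] adjPoor u v ≡ true) → 1 ℕ.≤ ∑ (λ u → ι (adjPoor u v))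
          find (yes (u , p)) = subst (ℕ._≤ _) (cong ι p) (∑-term (λ u → ι (adjPoor u v)) u)
          find (no ¬p) = ⊥-elim (none (v , sym e , λ u Hu → ℕP.≮⇒≥ λ lt → ¬p (u ,
            trans (cong (_∧ poor u v) Hu) (cong₂ _∧_ (sym e) (dec-true (D ℕ.* # (λ w → C (suc u) w ∧ Adj v w) ℕP.<? # (C (suc u))) lt)))))
      each : ∀ u → E ℕ.* # (adjPoor u) ℕ.≤ m zero
      each u = go (H zero (suc u)) refl
        where
        go : ∀ b → H zero (suc u) ≡ b → E ℕ.* # (λ v → b ∧ poor u v) ℕ.≤ m zero
        go false _ = ℕP.≤-trans (ℕP.≤-reflexive (trans (cong (E ℕ.*_) (∑-zero {n} _ λ _ → refl)) (ℕP.*-zeroʳ E))) z≤n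
        go true  p = few-poor (dense zero (suc u) p) (m>0 zero) (ℕP.≤-trans (large (suc u)) (ℕP.*-monoˡ-≤ _ q≤E))
      bound : E ℕ.* # (C zero) ℕ.≤ h ℕ.* q ℕ.* # (C zero)
      bound = begin
        E ℕ.* # (C zero)                           ≤⟨ ℕP.*-monoʳ-≤ E (∑-mono hit-by-poor) ⟩
        E ℕ.* ∑ (λ v → ∑ (λ u → ι (adjPoor u v)))  ≡⟨ trans (cong (E ℕ.*_) (∑-swap _)) (sym (∑-*ˡ E _)) ⟩
        ∑ (λ u → E ℕ.* # (adjPoor u))              ≤⟨ ∑-mono each ⟩
        ∑ {h} (λ _ → m zero)                       ≡⟨ ∑-const h (m zero) ⟩
        h ℕ.* m zero                               ≤⟨ ℕP.*-monoʳ-≤ h (large zero) ⟩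
        h ℕ.* (q ℕ.* # (C zero))                   ≡⟨ sym (ℕP.*-assoc h q _) ⟩
        h ℕ.* q ℕ.* # (C zero)                     ∎
        where open ℕP.≤-Reasoning
    build (yes (v , v∈C , rich)) = record { φ = φ ; inside = inside ; injective = injective ; preserves = preserves }
      where
      -- For neighbours of the placed vertex, restricting to the neighbourhood of `v` already
      -- excludes `v` by irreflexivity; for the others `v` is deleted to keep the map injective.
      keep : Bool → Fin n → Bool
      keep true  w = Adj v w
      keep false w = not (does (v Fin.≟ w))
      C′ : Fin h → Fin n → Bool
      C′ u w = C (suc u) w ∧ keep (H zero (suc u)) w
      large′ : ∀ u → m (suc u) ℕ.≤ q ℕ.* D ℕ.* # (C′ u)
      large′ u = ℕP.≤-trans (large (suc u)) (ℕP.≤-trans (ℕP.*-monoʳ-≤ q (shrink (H zero (suc u)) refl))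
          (ℕP.≤-reflexive (sym (ℕP.*-assoc q D _))))
        where
        shrink : ∀ b → H zero (suc u) ≡ b → # (C (suc u)) ℕ.≤ D ℕ.* # (λ w → C (suc u) w ∧ keep b w)
        shrink true  e = rich u e
        shrink false e = ℕP.≤-trans (double _ _ (2≤C (suc u)) (remove-one (C (suc u)) v)) (ℕP.*-monoˡ-≤ _ 2≤D)
          where
          double : ∀ a b → 2 ℕ.≤ a → a ℕ.≤ suc b → a ℕ.≤ 2 ℕ.* b
          double a zero    p q = ⊥-elim (ℕP.<⇒≱ (ℕP.<-≤-trans (s≤s (s≤s z≤n)) p) q)
          double a (suc b) p q = ℕP.≤-trans q (ℕP.≤-trans (s≤s (ℕP.m≤m+n (suc b) b)) (ℕP.≤-reflexive (l b)))
            where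
            l : ∀ b → suc (suc b ℕ.+ b) ≡ 2 ℕ.* suc b
            l = ℕ-ring
      rest : Copy (λ u u′ → H (suc u) (suc u′)) C′
      rest = embed Adj-sym (λ u u′ → H (suc u) (suc u′)) (λ u u′ → H-sym (suc u) (suc u′)) (λ u → H-irrefl (suc u)) C′
        (λ u → m (suc u)) (q ℕ.* D)
        (λ u u′ p A B A⊆ B⊆ → dense (suc u) (suc u′) p A B (λ w r → proj₁ (∧-true (A⊆ w r))) (λ w r → proj₁ (∧-true (B⊆ w r))))
        large′
        (ℕP.≤-trans (ℕP.≤-trans (ℕP.≤-reflexive (cong (suc h ℕ.*_) (ℕP.*-assoc q D _))) (ℕP.m≤n+m _ (q ℕ.* D ℕ.^ suc h))) E-big)
        (λ u → subst (ℕ._< m (suc u)) (cong (2 ℕ.*_) (sym (ℕP.*-assoc q D _))) (m-big (suc u)))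
      open Copy rest renaming (φ to φ′; inside to inside′; injective to injective′; preserves to preserves′)
      φ : Fin (suc h) → Fin n
      φ zero    = v
      φ (suc u) = φ′ u
      inside : ∀ u → C u (φ u) ≡ true
      inside zero    = v∈C
      inside (suc u) = proj₁ (∧-true (inside′ u))
      kept : ∀ u → keep (H zero (suc u)) (φ′ u) ≡ true
      kept u = proj₂ (∧-true {C (suc u) (φ′ u)} (inside′ u))
      fresh : ∀ u → v ≢ φ′ u
      fresh u e = go (H zero (suc u)) (kept u)
        where
        go : ∀ b → ¬ (keep b (φ′ u) ≡ true)
        go true  p = BoolP.not-¬ {true} refl (trans (sym p) (trans (cong (Adj v) (sym e)) (irrefl v)))
        go false p = BoolP.not-¬ {true} refl (trans (sym p) (cong not (dec-true (v Fin.≟ φ′ u) e)))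
      injective : ∀ u u′ → φ u ≡ φ u′ → u ≡ u′
      injective zero    zero     e = refl
      injective zero    (suc u′) e = ⊥-elim (fresh u′ e)
      injective (suc u) zero     e = ⊥-elim (fresh u (sym e))
      injective (suc u) (suc u′) e = cong suc (injective′ u u′ e)
      hub : ∀ u → H zero (suc u) ≡ true → Adj v (φ′ u) ≡ true
      hub u p = subst (λ b → keep b (φ′ u) ≡ true) p (kept u)
      preserves : ∀ u u′ → H u u′ ≡ true → Adj (φ u) (φ u′) ≡ true
      preserves zero    zero     p = ⊥-elim (BoolP.not-¬ {true} refl (trans (sym p) (H-irrefl zero)))
      preserves zero    (suc u′) p = hub u′ p
      preserves (suc u) zero     p = trans (Adj-sym (φ′ u) v) (hub u (trans (H-sym zero (suc u)) p))
      preserves (suc u) (suc u′) p = preserves′ u u′ p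

-- Greedy packing of copies into prescribed parts

usage : ∀ {h K} → Fin K → List (Fin h → Fin K) → ℕ
usage i []       = 0
usage i (t ∷ ts) = ∑ (λ u → δ (t u) i) ℕ.+ usage i ts

usage-++ : ∀ {h K} (i : Fin K) (ts us : List (Fin h → Fin K)) → usage i (ts ++ us) ≡ usage i ts ℕ.+ usage i us
usage-++ i []       us = refl
usage-++ i (t ∷ ts) us = trans (cong (∑ (λ u → δ (t u) i) ℕ.+_) (usage-++ i ts us))
  (sym (ℕP.+-assoc (∑ (λ u → δ (t u) i)) (usage i ts) (usage i us)))

module Packing {n h : ℕ} (Adj : Fin n → Fin n → Bool) (Adj-sym : ∀ u v → Adj u v ≡ Adj v u)
  (irrefl : ∀ v → Adj v v ≡ false) (H : Fin h → Fin h → Bool) (H-sym : ∀ u v → H u v ≡ H v u)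
  (H-irrefl : ∀ u → H u u ≡ false) (E D Q : ℕ) (2≤D : 2 ℕ.≤ D) {K : ℕ} (f : Fin n → Fin K)
  (q : ℕ) (E-big : suc h ℕ.* (q ℕ.* D ℕ.^ h) ℕ.≤ E) where

  open Embedding Adj irrefl E D 2≤D
  open Regularity Adj E D Q using (size; card; edges; Dense)

  Suitable : (Fin h → Fin K) → Set
  Suitable t = (∀ u u′ → H u u′ ≡ true → Dense f (t u) (t u′)) × (∀ u → 2 ℕ.* (q ℕ.* D ℕ.^ h) ℕ.< size f (t u))

  part : Fin K → (Fin n → Bool) → Fin n → Bool
  part i A w = does (f w Fin.≟ i) ∧ A w

  #-part : ∀ i A → # (part i A) ≡ card f A i
  #-part i A = ∑-cong λ w → ι-∧ (does (f w Fin.≟ i)) (A w)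

  card-inside : ∀ i {A C} → A ⊆ part i C → ∀ w → δ (f w) i ℕ.* ι (A w) ≡ ι (A w)
  card-inside i {A} A⊆ w = go (A w) refl
    where
    go : ∀ a → A w ≡ a → δ (f w) i ℕ.* ι a ≡ ι a
    go false _ = ℕP.*-zeroʳ (δ (f w) i)
    go true  e = trans (ℕP.*-identityʳ _) (cong ι (proj₁ (∧-true {does (f w Fin.≟ i)} (A⊆ w e))))

  dense-pair : ∀ i j C C′ → Dense f i j → DensePair (size f i) (size f j) (part i C) (part j C′)
  dense-pair i j C C′ dense A B A⊆ B⊆ a b = subst₂ ℕ._≤_ (cong₂ ℕ._*_ eqA eqB) (cong (D ℕ.*_) eqE)
    (dense A B (subst (λ c → size f i ℕ.≤ E ℕ.* c) (sym eqA) a) (subst (λ c → size f j ℕ.≤ E ℕ.* c) (sym eqB) b))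
    where
    eqA : card f A i ≡ # A
    eqA = ∑-cong (card-inside i A⊆)
    eqB : card f B j ≡ # B
    eqB = ∑-cong (card-inside j B⊆)
    eqE : edges f A B i j ≡ e A B
    eqE = ∑-cong λ u → trans (∑-cong λ v → cong₂ ℕ._*_ (card-inside i A⊆ u)
        (trans (cong (ℕ._* ι (Adj u v)) (card-inside j B⊆ v)) (sym (ι-∧ (B v) (Adj u v)))))
      (∑-*ˡ (ι (A u)) _)

  record Pack (avail : Fin n → Bool) (ts : List (Fin h → Fin K)) : Set where
    field
      φ        : Fin (List.length ts) → Fin h → Fin n
      inside   : ∀ k u → avail (φ k u) ≡ true
      edge     : ∀ k u v → H u v ≡ true → Adj (φ k u) (φ k v) ≡ true
      disjoint : ∀ k k′ u u′ → φ k u ≡ φ k′ u′ → k ≡ k′ × u ≡ u′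

  -- Each list entry prescribes the part of every vertex of a copy. The inequality reserves a 1/q
  -- share of each part beyond the remaining demand, so `embed` always meets candidate sets of at
  -- least that share.
  pack : ∀ avail ts → All Suitable ts → (∀ i → size f i ℕ.+ q ℕ.* usage i ts ℕ.≤ q ℕ.* card f avail i) → Pack avail ts
  pack avail [] [] room = record { φ = λ () ; inside = λ () ; edge = λ () ; disjoint = λ () }
  pack avail (t ∷ ts) ((dense , large) ∷ suitable) room = record { φ = φ ; inside = inside ; edge = edge ; disjoint = disjoint }
    where
    first : Copy H (λ u → part (t u) avail)
    first = embed Adj-sym H H-sym H-irrefl (λ u → part (t u) avail) (λ u → size f (t u)) q
      (λ u u′ p → dense-pair (t u) (t u′) avail avail (dense u u′ p))
      (λ u → ℕP.≤-trans (ℕP.≤-trans (ℕP.m≤m+n _ _) (room (t u))) (ℕP.≤-reflexive (cong (q ℕ.*_) (sym (#-part (t u) avail)))))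
      E-big large
    open Copy first renaming (φ to φ₁; inside to inside₁; injective to injective₁; preserves to preserves₁)
    hit? : ∀ w → Dec (∃[ u ] φ₁ u ≡ w)
    hit? w = FinP.any? λ u → φ₁ u Fin.≟ w
    avail′ : Fin n → Bool
    avail′ w = avail w ∧ not (does (hit? w))
    used : ∀ i → ∑ (λ w → ∑ (λ u → δ (φ₁ u) w ℕ.* δ (f w) i)) ≡ ∑ (λ u → δ (t u) i)
    used i = trans (∑-swap _) (∑-cong λ u → trans (∑-δ (φ₁ u) (λ w → δ (f w) i))
      (cong (λ k → δ k i) (does-≡ {t = f (φ₁ u)} {t u} (proj₁ (∧-true {does (f (φ₁ u) Fin.≟ t u)} (inside₁ u))))))
    loss : ∀ i → card f avail i ℕ.≤ card f avail′ i ℕ.+ ∑ (λ u → δ (t u) i)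
    loss i = ℕP.≤-trans (∑-mono λ w → go w (avail w) (hit? w)) (ℕP.≤-reflexive (trans (∑-+ _ _) (cong (card f avail′ i ℕ.+_) (used i))))
      where
      go : ∀ w a (d : Dec (∃[ u ] φ₁ u ≡ w)) →
        δ (f w) i ℕ.* ι a ℕ.≤ δ (f w) i ℕ.* ι (a ∧ not (does d)) ℕ.+ ∑ (λ u → δ (φ₁ u) w ℕ.* δ (f w) i)
      go w false d             = ℕP.≤-trans (ℕP.≤-reflexive (ℕP.*-zeroʳ (δ (f w) i))) z≤n
      go w true  (no _)        = ℕP.m≤m+n _ _
      go w true  (yes (u , e)) = ℕP.≤-trans (ℕP.≤-trans (ℕP.≤-reflexive (trans (ℕP.*-identityʳ _)
          (sym (trans (cong (ℕ._* δ (f w) i) (δ-≡ e)) (ℕP.*-identityˡ _)))))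
        (∑-term (λ u → δ (φ₁ u) w ℕ.* δ (f w) i) u)) (ℕP.m≤n+m _ (δ (f w) i ℕ.* 0))
    room′ : ∀ i → size f i ℕ.+ q ℕ.* usage i ts ℕ.≤ q ℕ.* card f avail′ i
    room′ i = ℕP.+-cancelʳ-≤ (q ℕ.* now) _ _ (ℕP.≤-trans (ℕP.≤-reflexive (l (size f i) q now (usage i ts)))
      (ℕP.≤-trans (room i) (ℕP.≤-trans (ℕP.*-monoʳ-≤ q (loss i)) (ℕP.≤-reflexive (ℕP.*-distribˡ-+ q _ now)))))
      where
      now : ℕ
      now = ∑ (λ u → δ (t u) i)
      l : ∀ s q a b → (s ℕ.+ q ℕ.* b) ℕ.+ q ℕ.* a ≡ s ℕ.+ q ℕ.* (a ℕ.+ b)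
      l = ℕ-ring
    open Pack (pack avail′ ts suitable room′) renaming (φ to φ₂; inside to inside₂; edge to edge₂; disjoint to disjoint₂)
    φ : Fin (suc (List.length ts)) → Fin h → Fin n
    φ zero    = φ₁
    φ (suc k) = φ₂ k
    inside : ∀ k u → avail (φ k u) ≡ true
    inside zero    u = proj₂ (∧-true {does (f (φ₁ u) Fin.≟ t u)} (inside₁ u))
    inside (suc k) u = proj₁ (∧-true (inside₂ k u))
    edge : ∀ k u v → H u v ≡ true → Adj (φ k u) (φ k v) ≡ true
    edge zero    = preserves₁
    edge (suc k) = edge₂ k
    apart : ∀ k u u′ → φ₁ u ≢ φ₂ k u′
    apart k u u′ e = BoolP.not-¬ {true} refl (trans (sym (proj₂ (∧-true {avail (φ₂ k u′)} (inside₂ k u′))))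
      (cong not (dec-true (hit? (φ₂ k u′)) (u , e))))
    disjoint : ∀ k k′ u u′ → φ k u ≡ φ k′ u′ → k ≡ k′ × u ≡ u′
    disjoint zero    zero     u u′ e = refl , injective₁ u u′ e
    disjoint zero    (suc k′) u u′ e = ⊥-elim (apart k′ u u′ e)
    disjoint (suc k) zero     u u′ e = ⊥-elim (apart k u′ u (sym e))
    disjoint (suc k) (suc k′) u u′ e = cong suc (proj₁ (disjoint₂ k k′ u u′ e)) , proj₂ (disjoint₂ k k′ u u′ e)

-- Rotations of a colouring

∑-snoc : ∀ n (ψ : ℕ → ℕ) → ∑ {suc n} (λ r → ψ (Fin.toℕ r)) ≡ ∑ {n} (λ r → ψ (Fin.toℕ r)) ℕ.+ ψ n
∑-snoc zero    ψ = trans (∑-∷ _) (trans (cong (ψ 0 ℕ.+_) (∑-[] _)) (trans (ℕP.+-comm (ψ 0) 0) (cong (ℕ._+ ψ 0) (sym (∑-[] _)))))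
∑-snoc (suc n) ψ = trans (∑-∷ _) (trans (cong (ψ 0 ℕ.+_) (∑-snoc n (λ k → ψ (suc k))))
  (trans (sym (ℕP.+-assoc (ψ 0) _ _)) (cong (ℕ._+ ψ (suc n)) (sym (∑-∷ _)))))

module Rotation (ρ : ℕ) where

  N : ℕ
  N = suc ρ

  rotate : ℕ → Fin N → Fin N
  rotate r k = (r ℕ.+ Fin.toℕ k) mod N

  mod-cong : ∀ {a b} → a % N ≡ b % N → a mod N ≡ b mod N
  mod-cong {a} {b} e = FinP.toℕ-injective (trans (FinP.toℕ-fromℕ< _) (trans e (sym (FinP.toℕ-fromℕ< _))))

  mod-toℕ : ∀ (k : Fin N) → Fin.toℕ k mod N ≡ k
  mod-toℕ k = FinP.toℕ-injective (trans (FinP.toℕ-fromℕ< _) (m<n⇒m%n≡m (FinP.toℕ<n k)))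

  -- Passing from r to r + 1 drops the first term of the cyclic sum and appends one whose index
  -- agrees with it modulo N.
  ∑-rotate : ∀ (g : Fin N → ℕ) r → ∑ (λ k → g (rotate r k)) ≡ ∑ g
  ∑-rotate g zero    = ∑-cong λ k → cong g (mod-toℕ k)
  ∑-rotate g (suc r) = trans (ℕP.+-cancelˡ-≡ (ψ 0) _ _ shift) (∑-rotate g r)
    where
    ψ : ℕ → ℕ
    ψ m = g ((r ℕ.+ m) mod N)
    shift : ψ 0 ℕ.+ ∑ {N} (λ k → g (rotate (suc r) k)) ≡ ψ 0 ℕ.+ ∑ {N} (λ k → g (rotate r k))
    shift = begin
      ψ 0 ℕ.+ ∑ {N} (λ k → g (rotate (suc r) k))       ≡⟨ cong (ψ 0 ℕ.+_) (∑-cong λ k → cong (λ m → g (m mod N)) (sym (ℕP.+-suc r (Fin.toℕ k)))) ⟩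
      ψ 0 ℕ.+ ∑ {N} (λ k → ψ (suc (Fin.toℕ k)))         ≡⟨ sym (∑-∷ {N} (λ k → ψ (Fin.toℕ k))) ⟩
      ∑ {suc N} (λ k → ψ (Fin.toℕ k))                  ≡⟨ ∑-snoc N ψ ⟩
      ∑ {N} (λ k → ψ (Fin.toℕ k)) ℕ.+ ψ N              ≡⟨ cong (∑ {N} (λ k → ψ (Fin.toℕ k)) ℕ.+_) (cong g (mod-cong {r ℕ.+ N} {r ℕ.+ 0} (trans ([m+n]%n≡m%n r N) (cong (_% N) (sym (ℕP.+-identityʳ r)))))) ⟩
      ∑ {N} (λ k → ψ (Fin.toℕ k)) ℕ.+ ψ 0              ≡⟨ ℕP.+-comm _ (ψ 0) ⟩
      ψ 0 ℕ.+ ∑ {N} (λ k → ψ (Fin.toℕ k))              ∎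
      where open ≡-Reasoning

  ∑-rotations : ∀ (g : Fin N → ℕ) k → ∑ {N} (λ r → g (rotate (Fin.toℕ r) k)) ≡ ∑ g
  ∑-rotations g k = trans (∑-cong {N} λ r → cong (λ m → g (m mod N)) (ℕP.+-comm (Fin.toℕ r) (Fin.toℕ k))) (∑-rotate g (Fin.toℕ k))

  -- A collision would make a rotated indicator sum at least 2, whereas by `∑-rotate` it is 1.
  rotate-injective : ∀ r {k k′} → rotate r k ≡ rotate r k′ → k ≡ k′
  rotate-injective r {k} {k′} e with k Fin.≟ k′
  ... | yes p = p
  ... | no ¬p = ⊥-elim (ℕP.<-irrefl {2} refl (s≤s (subst₂ ℕ._≤_ (cong₂ ℕ._+_ (δ-refl (rotate r k)) (δ-≡ e))
      (trans (∑-rotate (δ (rotate r k)) r) (∑-δ₁ (rotate r k)))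
      (∑-two (λ k″ → δ (rotate r k) (rotate r k″)) ¬p))))

  rotate₀ : ℕ → Fin (suc N) → Fin (suc N)
  rotate₀ r zero    = zero
  rotate₀ r (suc k) = suc (rotate r k)

  rotate₀-injective : ∀ r {k k′} → rotate₀ r k ≡ rotate₀ r k′ → k ≡ k′
  rotate₀-injective r {zero}  {zero}   e = refl
  rotate₀-injective r {suc k} {suc k′} e = cong suc (rotate-injective r (FinP.suc-injective e))

concatF : ∀ {A : Set} {m} → (Fin m → List A) → List A
concatF {m = zero}  τ = []
concatF {m = suc m} τ = τ zero ++ concatF (λ j → τ (suc j))

repeat : ∀ {A : Set} → ℕ → List A → List A
repeat zero    ts = []
repeat (suc k) ts = ts ++ repeat k ts

length-concatF : ∀ {A : Set} {m} (τ : Fin m → List A) → List.length (concatF τ) ≡ ∑ (λ j → List.length (τ j))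
length-concatF {m = zero}  τ = sym (∑-[] _)
length-concatF {m = suc m} τ = trans (ListP.length-++ (τ zero)) (trans (cong (List.length (τ zero) ℕ.+_) (length-concatF (λ j → τ (suc j)))) (sym (∑-∷ _)))

length-repeat : ∀ {A : Set} k (ts : List A) → List.length (repeat k ts) ≡ k ℕ.* List.length ts
length-repeat zero    ts = refl
length-repeat (suc k) ts = trans (ListP.length-++ ts) (cong (List.length ts ℕ.+_) (length-repeat k ts))

usage-concatF : ∀ {h K m} i (τ : Fin m → List (Fin h → Fin K)) → usage i (concatF τ) ≡ ∑ (λ j → usage i (τ j))
usage-concatF {m = zero}  i τ = sym (∑-[] _)
usage-concatF {m = suc m} i τ = trans (usage-++ i (τ zero) _) (trans (cong (usage i (τ zero) ℕ.+_) (usage-concatF i (λ j → τ (suc j)))) (sym (∑-∷ _)))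

usage-repeat : ∀ {h K} i k (ts : List (Fin h → Fin K)) → usage i (repeat k ts) ≡ k ℕ.* usage i ts
usage-repeat i zero    ts = refl
usage-repeat i (suc k) ts = trans (usage-++ i ts _) (cong (usage i ts ℕ.+_) (usage-repeat i k ts))

All-concatF : ∀ {A : Set} {S : A → Set} {m} (τ : Fin m → List A) → (∀ j → All S (τ j)) → All S (concatF τ)
All-concatF {m = zero}  τ p = []
All-concatF {m = suc m} τ p = AllP.++⁺ (p zero) (All-concatF (λ j → τ (suc j)) (λ j → p (suc j)))

All-repeat : ∀ {A : Set} {S : A → Set} k {ts : List A} → All S ts → All S (repeat k ts)
All-repeat zero    p = []
All-repeat (suc k) p = AllP.++⁺ p (All-repeat k p)

-- One bottle consists of the N rotations of the colour classes, so that every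
-- part except the pointed one receives all of the N other classes.
module Unit {h : ℕ} (ρ : ℕ) (c : Fin h → Fin (suc (suc ρ))) {K : ℕ} where
  open Rotation ρ

  rotated : (Fin (suc N) → Fin K) → Fin N → List (Fin h → Fin K)
  rotated T r = (λ u → T (rotate₀ (Fin.toℕ r) (c u))) ∷ []

  unit : (Fin (suc N) → Fin K) → List (Fin h → Fin K)
  unit T = concatF (rotated T)

  length-unit : ∀ T → List.length (unit T) ≡ N
  length-unit T = trans (length-concatF (rotated T)) (trans (∑-const N 1) (ℕP.*-identityʳ N))

  -- With σ and W as the two class counts, the right side is the entry `col` of a bottle at cluster
  -- i: one unit of N copies of H consumes exactly what one bottle consumes.
  usage-unit : ∀ T i → usage i (unit T) ≡
    # (λ u → does (c u Fin.≟ zero)) ℕ.* N ℕ.* δ (T zero) i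
      ℕ.+ # (λ u → not (does (c u Fin.≟ zero))) ℕ.* ∑ (λ k → δ (T (suc k)) i)
  usage-unit T i = begin
    usage i (unit T)                                                 ≡⟨ usage-concatF i (rotated T) ⟩
    ∑ {N} (λ r → ∑ (λ u → g r (c u)) ℕ.+ 0)                          ≡⟨ ∑-cong {N} (λ r → ℕP.+-identityʳ _) ⟩
    ∑ {N} (λ r → ∑ (λ u → g r (c u)))                                ≡⟨ ∑-swap {N} _ ⟩
    ∑ (λ u → ∑ {N} (λ r → g r (c u)))                                ≡⟨ ∑-cong (λ u → class (c u)) ⟩
    ∑ (λ u → ι (does (c u Fin.≟ zero)) ℕ.* (N ℕ.* X) ℕ.+ ι (not (does (c u Fin.≟ zero))) ℕ.* Y) ≡⟨ trans (∑-+ _ _) (cong₂ ℕ._+_ (∑-*ʳ (N ℕ.* X) _) (∑-*ʳ Y _)) ⟩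
    # (λ u → does (c u Fin.≟ zero)) ℕ.* (N ℕ.* X) ℕ.+ # (λ u → not (does (c u Fin.≟ zero))) ℕ.* Y
      ≡⟨ cong (ℕ._+ # (λ u → not (does (c u Fin.≟ zero))) ℕ.* Y) (sym (ℕP.*-assoc (# (λ u → does (c u Fin.≟ zero))) N X)) ⟩
    # (λ u → does (c u Fin.≟ zero)) ℕ.* N ℕ.* X ℕ.+ # (λ u → not (does (c u Fin.≟ zero))) ℕ.* Y ∎
    where
    open ≡-Reasoning
    X Y : ℕ
    X = δ (T zero) i
    Y = ∑ (λ k → δ (T (suc k)) i)
    g : Fin N → Fin (suc N) → ℕ
    g r a = δ (T (rotate₀ (Fin.toℕ r) a)) i
    class : ∀ a → ∑ (λ r → g r a) ≡ ι (does (a Fin.≟ zero)) ℕ.* (N ℕ.* X) ℕ.+ ι (not (does (a Fin.≟ zero))) ℕ.* Y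
    class zero    = trans (∑-const N X) (sym (trans (ℕP.+-identityʳ _) (ℕP.+-identityʳ _)))
    class (suc k) = trans (∑-rotations (λ a → δ (T (suc a)) i) k) (sym (ℕP.+-identityʳ Y))

  All-unit : ∀ {S : (Fin h → Fin K) → Set} T → (∀ r → S (λ u → T (rotate₀ r (c u)))) → All S (unit T)
  All-unit T p = All-concatF (rotated T) λ r → p (Fin.toℕ r) ∷ []

-- Using the degree sequence

-- For a nonnegative combination l ≤ r of hypotheses, the remaining identity is left to the ring solver.
≤-certificate : ∀ {x y l r} → l ℕ.≤ r → x ℕ.+ r ≡ y ℕ.+ l → x ℕ.≤ y
≤-certificate {x} {y} {l} {r} l≤r e = ℕP.+-cancelʳ-≤ r x y (ℕP.≤-trans (ℕP.≤-reflexive e) (ℕP.+-monoʳ-≤ y l≤r))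

cancel-≤ : ∀ c {x y} → 0 ℕ.< c → c ℕ.* x ℕ.≤ c ℕ.* y → x ℕ.≤ y
cancel-≤ c 0<c = ℕP.*-cancelˡ-≤ c ⦃ ℕ.>-nonZero 0<c ⦄

x≤c*x : ∀ c x → 0 ℕ.< c → x ℕ.≤ c ℕ.* x
x≤c*x (suc c) x _ = ℕP.m≤m+n x (c ℕ.* x)

-- The case |Z| ≤ ωn/h, with the degree condition read at i = |Z|. It bounds `far` from above and
-- duality bounds it from below; the main terms cancel, leaving the dummy use against the losses `l`
-- and `ν`. The looser `suc ν` is shared with the other case.
dummy-bound-small : ∀ (P W s n n′ l d far z ν μ A : ℕ) → 0 ℕ.< W → n ≡ n′ ℕ.+ l →
  P ℕ.* W ℕ.* n ℕ.+ P ℕ.* s ℕ.* z ℕ.≤ P ℕ.* W ℕ.* d ℕ.+ W ℕ.* (W ℕ.+ s) ℕ.* n →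
  far ℕ.+ d ℕ.≤ n ℕ.+ ν →
  W ℕ.* (W ℕ.+ s) ℕ.* (μ ℕ.* n′ ℕ.+ A) ℕ.≤ P ℕ.* (W ℕ.* (μ ℕ.* far) ℕ.+ s ℕ.* (μ ℕ.* z)) →
  A ℕ.≤ μ ℕ.* (l ℕ.+ P ℕ.* suc ν)
dummy-bound-small P W s n n′ l d far z ν μ A 0<W refl h₁ h₂ h₃ = ℕP.≤-trans
  (cancel-≤ (W ℕ.+ s) 0<W+s (ℕP.≤-trans step₂ (ℕP.*-monoʳ-≤ μ
    (ℕP.+-monoʳ-≤ ((W ℕ.+ s) ℕ.* l) (x≤c*x (W ℕ.+ s) (P ℕ.* ν) 0<W+s))) ⟨≤⟩ l₃ (W ℕ.+ s) l (P ℕ.* ν) μ))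
  (ℕP.*-monoʳ-≤ μ (ℕP.+-monoʳ-≤ l (ℕP.*-monoʳ-≤ P (ℕP.n≤1+n ν))))
  where
  _⟨≤⟩_ : ∀ {x y z} → x ℕ.≤ y → y ≡ z → x ℕ.≤ z
  p ⟨≤⟩ refl = p
  0<W+s : 0 ℕ.< W ℕ.+ s
  0<W+s = ℕP.<-≤-trans 0<W (ℕP.m≤m+n W s)
  step₁ : P ℕ.* W ℕ.* far ℕ.+ P ℕ.* s ℕ.* z ℕ.≤ W ℕ.* (W ℕ.+ s) ℕ.* (n′ ℕ.+ l) ℕ.+ P ℕ.* W ℕ.* ν
  step₁ = ≤-certificate (ℕP.+-mono-≤ h₁ (ℕP.*-monoʳ-≤ (P ℕ.* W) h₂)) (l₁ P W s (n′ ℕ.+ l) d far z ν)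
    where
    l₁ : ∀ P W s n d far z ν → (P ℕ.* W ℕ.* far ℕ.+ P ℕ.* s ℕ.* z) ℕ.+
      ((P ℕ.* W ℕ.* d ℕ.+ W ℕ.* (W ℕ.+ s) ℕ.* n) ℕ.+ P ℕ.* W ℕ.* (n ℕ.+ ν)) ≡
      (W ℕ.* (W ℕ.+ s) ℕ.* n ℕ.+ P ℕ.* W ℕ.* ν) ℕ.+ ((P ℕ.* W ℕ.* n ℕ.+ P ℕ.* s ℕ.* z) ℕ.+ P ℕ.* W ℕ.* (far ℕ.+ d))
    l₁ = ℕ-ring
  step₂ : (W ℕ.+ s) ℕ.* A ℕ.≤ μ ℕ.* ((W ℕ.+ s) ℕ.* l ℕ.+ P ℕ.* ν)
  step₂ = cancel-≤ W 0<W (≤-certificate (ℕP.+-mono-≤ h₃ (ℕP.*-monoʳ-≤ μ step₁)) (l₂ P W s n′ l far z ν μ A))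
    where
    l₂ : ∀ P W s n′ l far z ν μ A → W ℕ.* ((W ℕ.+ s) ℕ.* A) ℕ.+
      (P ℕ.* (W ℕ.* (μ ℕ.* far) ℕ.+ s ℕ.* (μ ℕ.* z)) ℕ.+ μ ℕ.* (W ℕ.* (W ℕ.+ s) ℕ.* (n′ ℕ.+ l) ℕ.+ P ℕ.* W ℕ.* ν))
      ≡ W ℕ.* (μ ℕ.* ((W ℕ.+ s) ℕ.* l ℕ.+ P ℕ.* ν)) ℕ.+
      (W ℕ.* (W ℕ.+ s) ℕ.* (μ ℕ.* n′ ℕ.+ A) ℕ.+ μ ℕ.* (P ℕ.* W ℕ.* far ℕ.+ P ℕ.* s ℕ.* z))
    l₂ = ℕ-ring
  l₃ : ∀ w l p μ → μ ℕ.* (w ℕ.* l ℕ.+ w ℕ.* p) ≡ w ℕ.* (μ ℕ.* (l ℕ.+ p))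
  l₃ = ℕ-ring

-- The case |Z| > ωn/h, where i is ωn/h rounded down and the bound with W alone suffices. Rounding
-- costs P·s ≤ P·W, which turns `ν` into `suc ν`.
dummy-bound-large : ∀ (P W s n n′ l d far i ν μ A : ℕ) → 0 ℕ.< W → s ℕ.≤ W → n ≡ n′ ℕ.+ l →
  P ℕ.* W ℕ.* n ℕ.+ P ℕ.* s ℕ.* i ℕ.≤ P ℕ.* W ℕ.* d ℕ.+ W ℕ.* (W ℕ.+ s) ℕ.* n →
  far ℕ.+ d ℕ.≤ n ℕ.+ ν → W ℕ.* n ℕ.≤ P ℕ.* i ℕ.+ P →
  W ℕ.* (μ ℕ.* n′ ℕ.+ A) ℕ.≤ P ℕ.* (μ ℕ.* far) →
  A ℕ.≤ μ ℕ.* (l ℕ.+ P ℕ.* suc ν)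
dummy-bound-large P W s n n′ l d far i ν μ A 0<W s≤W refl h₁ h₂ h₃ h₄ =
  cancel-≤ W 0<W (ℕP.≤-trans step₂ (ℕP.≤-trans (ℕP.*-monoʳ-≤ μ (ℕP.+-monoʳ-≤ (W ℕ.* l) (x≤c*x W _ 0<W)))
    (ℕP.≤-reflexive (l₃ W l (P ℕ.* suc ν) μ))))
  where
  l₃ : ∀ w l p μ → μ ℕ.* (w ℕ.* l ℕ.+ w ℕ.* p) ≡ w ℕ.* (μ ℕ.* (l ℕ.+ p))
  l₃ = ℕ-ring
  step₁ : P ℕ.* far ℕ.≤ W ℕ.* (n′ ℕ.+ l) ℕ.+ P ℕ.* suc ν
  step₁ = cancel-≤ W 0<W (≤-certificate (ℕP.+-mono-≤ (ℕP.+-mono-≤ h₁ (ℕP.*-monoʳ-≤ (P ℕ.* W) h₂))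
      (ℕP.+-mono-≤ (ℕP.*-monoʳ-≤ s h₃) (ℕP.*-monoʳ-≤ P s≤W))) (l₁ P W s (n′ ℕ.+ l) d far i ν))
    where
    l₁ : ∀ P W s n d far i ν → W ℕ.* (P ℕ.* far) ℕ.+
      (((P ℕ.* W ℕ.* d ℕ.+ W ℕ.* (W ℕ.+ s) ℕ.* n) ℕ.+ P ℕ.* W ℕ.* (n ℕ.+ ν)) ℕ.+ (s ℕ.* (P ℕ.* i ℕ.+ P) ℕ.+ P ℕ.* W))
      ≡ W ℕ.* (W ℕ.* n ℕ.+ P ℕ.* suc ν) ℕ.+
      (((P ℕ.* W ℕ.* n ℕ.+ P ℕ.* s ℕ.* i) ℕ.+ P ℕ.* W ℕ.* (far ℕ.+ d)) ℕ.+ (s ℕ.* (W ℕ.* n) ℕ.+ P ℕ.* s))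
    l₁ = ℕ-ring
  step₂ : W ℕ.* A ℕ.≤ μ ℕ.* (W ℕ.* l ℕ.+ P ℕ.* suc ν)
  step₂ = ≤-certificate (ℕP.+-mono-≤ h₄ (ℕP.*-monoʳ-≤ μ step₁)) (l₂ P W n′ l far ν μ A)
    where
    l₂ : ∀ P W n′ l far ν μ A → W ℕ.* A ℕ.+ (P ℕ.* (μ ℕ.* far) ℕ.+ μ ℕ.* (W ℕ.* (n′ ℕ.+ l) ℕ.+ P ℕ.* suc ν))
      ≡ μ ℕ.* (W ℕ.* l ℕ.+ P ℕ.* suc ν) ℕ.+ (W ℕ.* (μ ℕ.* n′ ℕ.+ A) ℕ.+ μ ℕ.* (P ℕ.* far))
    l₂ = ℕ-ring

-- The hypothesis on dᵢ multiplied by (r − 1) h W, where W = (r − 1) ω, s = (r − 1) σ and P = (r − 1) h.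
DegreeCondition : ∀ {n} → (Fin n → Fin n → Bool) → (P W s : ℕ) → Set
DegreeCondition {n} Adj P W s = ∀ i → 1 ℕ.≤ i → P ℕ.* i ℕ.≤ W ℕ.* n →
  ∃[ d ] (# (λ v → does (# (Adj v) ℕP.<? d)) ℕ.< i) ×
    (P ℕ.* W ℕ.* n ℕ.+ P ℕ.* s ℕ.* i ℕ.≤ P ℕ.* W ℕ.* d ℕ.+ W ℕ.* (W ℕ.+ s) ℕ.* n)

lost : ∀ {n K} → (Fin n → Fin n → Bool) → (Fin n → Fin K) → (Fin K → Fin K → Bool) → Fin n → ℕ
lost Adj f R u = # (λ v → Adj u v ∧ not (R (f u) (f v)))

module DummyBound {n K : ℕ} (Adj : Fin n → Fin n → Bool) (f : Fin n → Fin K) (R : Fin K → Fin K → Bool)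
  (R-sym : ∀ i j → R i j ≡ R j i) (kept : Fin n → Bool) (ν : ℕ)
  (few-lost : ∀ u → kept u ≡ true → lost Adj f R u ℕ.≤ ν)
  (ρ W s : ℕ) (0<s : 0 ℕ.< s) (s≤W : s ℕ.≤ W) where

  b : Fin K → ℕ
  b i = ∑ (λ u → δ (f u) i ℕ.* ι (kept u))

  open Bottle R R-sym ρ W s 0<s s≤W using (P; 0<W)
  open Fractional R R-sym ρ W s 0<s s≤W b

  b-sum : ∀ (φ : Fin K → ℕ) → ∑ (λ i → b i ℕ.* φ i) ≡ ∑ (λ u → ι (kept u) ℕ.* φ (f u))
  b-sum φ = sym (trans (∑-group f (λ i u → ι (kept u) ℕ.* φ i)) (∑-cong λ i →
    trans (∑-cong λ u → sym (ℕP.*-assoc (δ (f u) i) (ι (kept u)) (φ i))) (∑-*ʳ (φ i) _)))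

  ∑b : ∑ b ≡ # kept
  ∑b = trans (∑-cong λ i → sym (ℕP.*-identityʳ (b i))) (trans (b-sum (λ _ → 1)) (∑-cong λ u → ℕP.*-identityʳ (ι (kept u))))

  -- A kept vertex in a part not joined to that of `u` is a nonneighbour of `u`, or the edge to it
  -- is one of at most ν lost ones.
  far-degree : ∀ u → kept u ≡ true → far (f u) ℕ.+ # (Adj u) ℕ.≤ n ℕ.+ ν
  far-degree u k = ℕP.≤-trans (ℕP.≤-reflexive (trans (cong (ℕ._+ # (Adj u)) (b-sum (λ j → ι (not (R (f u) j))))) (sym (∑-+ _ _))))
    (ℕP.≤-trans (∑-mono λ v → go (kept v) (R (f u) (f v)) (Adj u v))
      (ℕP.≤-trans (ℕP.≤-reflexive (trans (∑-+ _ _) (cong (ℕ._+ lost Adj f R u) (trans (∑-const n 1) (ℕP.*-identityʳ n)))))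
        (ℕP.+-monoʳ-≤ n (few-lost u k))))
    where
    go : ∀ k r a → ι k ℕ.* ι (not r) ℕ.+ ι a ℕ.≤ 1 ℕ.+ ι (a ∧ not r)
    go true  true  true  = ℕP.≤-refl
    go true  true  false = z≤n
    go true  false true  = ℕP.≤-refl
    go true  false false = ℕP.≤-refl
    go false true  true  = ℕP.≤-refl
    go false true  false = z≤n
    go false false true  = s≤s z≤n
    go false false false = z≤n

  -- Pigeonhole: otherwise every vertex of `p` would be among the fewer than |p| vertices of degree
  -- below `d`.
  high-degree : ∀ (p : Fin n → Bool) d → # (λ v → does (# (Adj v) ℕP.<? d)) ℕ.< # p →
    ∃[ u ] p u ≡ true × d ℕ.≤ # (Adj u)
  high-degree p d lt = found (FinP.any? λ u → (p u BoolP.≟ true) ×-dec (d ℕP.≤? # (Adj u)))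
    where
    found : Dec (∃[ u ] p u ≡ true × d ℕ.≤ # (Adj u)) → ∃[ u ] p u ≡ true × d ℕ.≤ # (Adj u)
    found (yes q) = q
    found (no ¬q) = ⊥-elim (ℕP.<⇒≱ lt (∑-mono λ u → ι-mono λ e →
      dec-true (# (Adj u) ℕP.<? d) (ℕP.≰⇒> λ q → ¬q (u , e , q))))

  dummy-bound : DegreeCondition Adj P W s → P ℕ.≤ W ℕ.* n → (t : FractionalTiling) → ∀ l → n ≡ # kept ℕ.+ l →
    dummyUse (FractionalTiling.x t) ℕ.≤ FractionalTiling.μ t ℕ.* (l ℕ.+ P ℕ.* suc ν)
  dummy-bound degrees P≤Wn t l n≡ = [ (λ e → ℕP.≤-trans (ℕP.≤-reflexive e) z≤n) , main ]′ obstruction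
    where
    open FractionalTiling t
    A : ℕ
    A = dummyUse x
    0<P : 0 ℕ.< P
    0<P = ℕP.<-≤-trans 0<s (ℕP.m≤m+n s _)
    main : _ → A ℕ.≤ μ ℕ.* (l ℕ.+ P ℕ.* suc ν)
    main (Z , (v₀ , Zv₀ , b>0) , bounds) = bySize (P ℕ.* z ℕP.≤? W ℕ.* n)
      where
      z : ℕ
      z = ∑ (λ i → b i ℕ.* ι (Z i))
      in-Z : Fin n → Bool
      in-Z u = kept u ∧ Z (f u)
      z-count : z ≡ # in-Z
      z-count = trans (b-sum (λ i → ι (Z i))) (∑-cong λ u → sym (ι-∧ (kept u) (Z (f u))))
      1≤z : 1 ℕ.≤ z
      1≤z = ℕP.≤-trans (subst (1 ℕ.≤_) (sym (trans (cong (λ c → b v₀ ℕ.* ι c) Zv₀) (ℕP.*-identityʳ (b v₀)))) b>0)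
        (∑-term (λ i → b i ℕ.* ι (Z i)) v₀)
      vertex : ∀ i → 1 ℕ.≤ i → P ℕ.* i ℕ.≤ W ℕ.* n → i ℕ.≤ z → ∃[ v ] ∃[ d ] Z v ≡ true × (far v ℕ.+ d ℕ.≤ n ℕ.+ ν) ×
        (P ℕ.* W ℕ.* n ℕ.+ P ℕ.* s ℕ.* i ℕ.≤ P ℕ.* W ℕ.* d ℕ.+ W ℕ.* (W ℕ.+ s) ℕ.* n)
      vertex i 1≤i Pi≤Wn i≤z = pick (degrees i 1≤i Pi≤Wn)
        where
        pick : ∃[ d ] (# (λ v → does (# (Adj v) ℕP.<? d)) ℕ.< i) ×
          (P ℕ.* W ℕ.* n ℕ.+ P ℕ.* s ℕ.* i ℕ.≤ P ℕ.* W ℕ.* d ℕ.+ W ℕ.* (W ℕ.+ s) ℕ.* n) → _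
        pick (d , few , ineq) = f u , d , proj₂ (∧-true {kept u} Zu) ,
            ℕP.≤-trans (ℕP.+-monoʳ-≤ (far (f u)) (proj₂ (proj₂ w))) (far-degree u (proj₁ (∧-true Zu))) , ineq
          where
          w : ∃[ u ] in-Z u ≡ true × d ℕ.≤ # (Adj u)
          w = high-degree in-Z d (ℕP.<-≤-trans few (ℕP.≤-trans i≤z (ℕP.≤-reflexive z-count)))
          u : Fin n
          u = proj₁ w
          Zu : in-Z u ≡ true
          Zu = proj₁ (proj₂ w)
      n≡′ : n ≡ ∑ b ℕ.+ l
      n≡′ = trans n≡ (cong (ℕ._+ l) (sym ∑b))
      bySize : Dec (P ℕ.* z ℕ.≤ W ℕ.* n) → A ℕ.≤ μ ℕ.* (l ℕ.+ P ℕ.* suc ν)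
      bySize (yes Pz≤Wn) = conclude (vertex z 1≤z Pz≤Wn ℕP.≤-refl)
        where
        conclude : ∃[ v ] ∃[ d ] Z v ≡ true × (far v ℕ.+ d ℕ.≤ n ℕ.+ ν) ×
          (P ℕ.* W ℕ.* n ℕ.+ P ℕ.* s ℕ.* z ℕ.≤ P ℕ.* W ℕ.* d ℕ.+ W ℕ.* (W ℕ.+ s) ℕ.* n) → A ℕ.≤ μ ℕ.* (l ℕ.+ P ℕ.* suc ν)
        conclude (v , d , Zv , h₂ , h₁) = dummy-bound-small P W s n (∑ b) l d (far v) z ν μ A 0<W n≡′ h₁ h₂ (proj₂ (bounds v Zv))
      bySize (no Pz≰Wn) = conclude (vertex i 1≤i Pi≤Wn (ℕP.<⇒≤ i<z))
        where
        instance
          P-nonZero : ℕ.NonZero P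
          P-nonZero = ℕ.>-nonZero 0<P
        i : ℕ
        i = W ℕ.* n / P
        Pi≤Wn : P ℕ.* i ℕ.≤ W ℕ.* n
        Pi≤Wn = ℕP.≤-trans (ℕP.≤-reflexive (ℕP.*-comm P i)) (m/n*n≤m (W ℕ.* n) P)
        Wn<Pi+P : W ℕ.* n ℕ.< P ℕ.* i ℕ.+ P
        Wn<Pi+P = subst₂ ℕ._<_ (sym (m≡m%n+[m/n]*n (W ℕ.* n) P)) (trans (ℕP.+-comm P _) (cong (ℕ._+ P) (ℕP.*-comm i P)))
          (ℕP.+-monoˡ-< (i ℕ.* P) (m%n<n (W ℕ.* n) P))
        1≤i : 1 ℕ.≤ i
        1≤i = ℕP.n≢0⇒n>0 λ e → ℕP.<⇒≱ Wn<Pi+P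
          (subst (λ k → P ℕ.* k ℕ.+ P ℕ.≤ W ℕ.* n) (sym e) (ℕP.≤-trans (ℕP.≤-reflexive (cong (ℕ._+ P) (ℕP.*-zeroʳ P))) P≤Wn))
        i<z : i ℕ.< z
        i<z = ℕP.*-cancelˡ-< P i z (ℕP.≤-<-trans Pi≤Wn (ℕP.≰⇒> Pz≰Wn))
        conclude : ∃[ v ] ∃[ d ] Z v ≡ true × (far v ℕ.+ d ℕ.≤ n ℕ.+ ν) ×
          (P ℕ.* W ℕ.* n ℕ.+ P ℕ.* s ℕ.* i ℕ.≤ P ℕ.* W ℕ.* d ℕ.+ W ℕ.* (W ℕ.+ s) ℕ.* n) → A ℕ.≤ μ ℕ.* (l ℕ.+ P ℕ.* suc ν)
        conclude (v , d , Zv , h₂ , h₁) = dummy-bound-large P W s n (∑ b) l d (far v) i ν μ A 0<W s≤W n≡′ h₁ h₂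
          (ℕP.<⇒≤ Wn<Pi+P) (proj₁ (bounds v Zv))

-- The reduced graph and the edges and vertices it loses

module ReducedGraph {n : ℕ} (Adj : Fin n → Fin n → Bool) (Adj-sym : ∀ u v → Adj u v ≡ Adj v u)
  (E D N₀ : ℕ) {K : ℕ} (L : Regularity.Labelling Adj E D D K) where

  open Regularity Adj E D D
  open Labelling L

  big ok : Fin K → Fin K → Bool
  big i j = does (N₀ ℕP.<? size f i)
  ok i j = not (dead i j) ∧ (isDense f i j ∧ big i j)

  -- Deadness and density concern ordered pairs, so `ok` need not be symmetric. Asking for both
  -- orders repairs this and makes both parts big.
  R : Fin K → Fin K → Bool
  R i j = ok i j ∧ ok j i

  R-sym : ∀ i j → R i j ≡ R j i
  R-sym i j = BoolP.∧-comm (ok i j) (ok j i)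

  R-ok : ∀ {i j} → R i j ≡ true → Dense f i j × N₀ ℕ.< size f i
  R-ok {i} {j} e = isDense-sound f i j (proj₁ de) , large (N₀ ℕP.<? size f i) (proj₂ de)
    where
    de : isDense f i j ≡ true × big i j ≡ true
    de = ∧-true {isDense f i j} (proj₂ (∧-true {not (dead i j)} (proj₁ (∧-true {ok i j} e))))
    large : ∀ {x y} (d : Dec (x ℕ.< y)) → does d ≡ true → x ℕ.< y
    large (yes p) _ = p

  ∑-lost : ℕ
  ∑-lost = ∑ (lost Adj f R)

  half : ℕ
  half = ∑₂ (λ u v → ι (Adj u v) ℕ.* ι (not (ok (f u) (f v))))

  ∑-lost≤ : ∑-lost ℕ.≤ half ℕ.+ half
  ∑-lost≤ = ℕP.≤-trans (∑₂-mono λ u v → go (Adj u v) (Adj v u) (Adj-sym u v) (ok (f u) (f v)) (ok (f v) (f u)))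
    (ℕP.≤-reflexive (trans (∑₂-+ _ _) (cong (half ℕ.+_) (∑-swap _))))
    where
    go : ∀ a a′ → a ≡ a′ → ∀ x y → ι (a ∧ not (x ∧ y)) ℕ.≤ ι a ℕ.* ι (not x) ℕ.+ ι a′ ℕ.* ι (not y)
    go true  _ refl true  true  = z≤n
    go true  _ refl true  false = ℕP.≤-refl
    go true  _ refl false y     = s≤s z≤n
    go false _ refl x     y     = z≤n

  small-vertices : ∑ (λ u → ι (not (big (f u) (f u)))) ℕ.≤ K ℕ.* N₀
  small-vertices = ℕP.≤-trans (ℕP.≤-reflexive (trans (∑-group f (λ i u → ι (not (big i i)))) (∑-cong λ i → ∑-*ʳ (ι (not (big i i))) _)))
    (ℕP.≤-trans (∑-mono λ i → go (N₀ ℕP.<? size f i)) (ℕP.≤-reflexive (∑-const K N₀)))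
    where
    go : ∀ {x} (d : Dec (N₀ ℕ.< x)) → x ℕ.* ι (not (does d)) ℕ.≤ N₀
    go {x} (yes _) = ℕP.≤-trans (ℕP.≤-reflexive (ℕP.*-zeroʳ x)) z≤n
    go {x} (no ¬p) = ℕP.≤-trans (ℕP.≤-reflexive (ℕP.*-identityʳ x)) (ℕP.≮⇒≥ ¬p)

  half≤ : half ℕ.≤ (edgesIn f dead ℕ.+ badArea L) ℕ.+ n ℕ.* (K ℕ.* N₀)
  half≤ = ℕP.≤-trans (∑₂-mono λ u v → go (Adj u v) (dead (f u) (f v)) (isDense f (f u) (f v)) (big (f u) (f v)))
    (ℕP.≤-trans (ℕP.≤-reflexive (trans (∑₂-+ _ _) (cong₂ ℕ._+_ (∑₂-+ _ _)
        (trans (∑-cong λ u → ∑-const n (ι (not (big (f u) (f u))))) (∑-*ˡ n _)))))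
      (ℕP.+-monoʳ-≤ (edgesIn f dead ℕ.+ badArea L) (ℕP.*-monoʳ-≤ n small-vertices)))
    where
    go : ∀ a d e g → ι a ℕ.* ι (not (not d ∧ (e ∧ g))) ℕ.≤ (ι d ℕ.* ι a ℕ.+ ι (not d ∧ not e)) ℕ.+ ι (not g)
    go false d     e     g     = z≤n
    go true  true  e     g     = s≤s z≤n
    go true  false false g     = s≤s z≤n
    go true  false true  false = ℕP.≤-refl
    go true  false true  true  = z≤n

  -- An edge is lost to a dead pair, a bad pair or a small part, each accounting for at most n²/D
  -- ordered pairs. The two orders double this, hence the constant 6.
  few-lost-edges : ∀ ℓ → D ≡ 6 ℕ.* ℓ → D ℕ.* badArea L ℕ.≤ n ℕ.* n → D ℕ.* (K ℕ.* N₀) ℕ.≤ n → ℓ ℕ.* ∑-lost ℕ.≤ n ℕ.* n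
  few-lost-edges ℓ D≡ bad≤ small≤ = cancel-≤ 3 (s≤s z≤n) (begin
    3 ℕ.* (ℓ ℕ.* ∑-lost)                ≤⟨ ℕP.*-monoʳ-≤ 3 (ℕP.*-monoʳ-≤ ℓ ∑-lost≤) ⟩
    3 ℕ.* (ℓ ℕ.* (half ℕ.+ half))       ≡⟨ trans (l₁ ℓ half) (cong (ℕ._* half) (sym D≡)) ⟩
    D ℕ.* half                          ≤⟨ ℕP.*-monoʳ-≤ D half≤ ⟩
    D ℕ.* ((edgesIn f dead ℕ.+ badArea L) ℕ.+ n ℕ.* (K ℕ.* N₀))
      ≡⟨ l₂ D (edgesIn f dead) (badArea L) n (K ℕ.* N₀) ⟩
    D ℕ.* edgesIn f dead ℕ.+ (D ℕ.* badArea L ℕ.+ n ℕ.* (D ℕ.* (K ℕ.* N₀)))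
      ≤⟨ ℕP.+-mono-≤ (ℕP.≤-trans sparse (∑₂-ι≤ (λ u v → dead (f u) (f v)))) (ℕP.+-mono-≤ bad≤ (ℕP.*-monoʳ-≤ n small≤)) ⟩
    n ℕ.* n ℕ.+ (n ℕ.* n ℕ.+ n ℕ.* n)   ≡⟨ l₃ (n ℕ.* n) ⟩
    3 ℕ.* (n ℕ.* n)                     ∎)
    where
    open ℕP.≤-Reasoning
    l₁ : ∀ ℓ h → 3 ℕ.* (ℓ ℕ.* (h ℕ.+ h)) ≡ 6 ℕ.* ℓ ℕ.* h
    l₁ = ℕ-ring
    l₂ : ∀ D e b n k → D ℕ.* ((e ℕ.+ b) ℕ.+ n ℕ.* k) ≡ D ℕ.* e ℕ.+ (D ℕ.* b ℕ.+ n ℕ.* (D ℕ.* k))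
    l₂ = ℕ-ring
    l₃ : ∀ x → x ℕ.+ (x ℕ.+ x) ≡ 3 ℕ.* x
    l₃ = ℕ-ring

  kept : ℕ → Fin n → Bool
  kept ℓ u = not (does (n ℕP.<? ℓ ℕ.* lost Adj f R u))

  kept-lost : ∀ ℓ u → kept ℓ u ≡ true → ℓ ℕ.* lost Adj f R u ℕ.≤ n
  kept-lost ℓ u = go (n ℕP.<? ℓ ℕ.* lost Adj f R u)
    where
    go : ∀ {x} (d : Dec (n ℕ.< x)) → not (does d) ≡ true → x ℕ.≤ n
    go (no ¬p) _ = ℕP.≮⇒≥ ¬p

  lossy : ℕ → ℕ
  lossy ℓ = # (λ u → does (n ℕP.<? ℓ ℕ.* lost Adj f R u))

  -- Markov's inequality: each lossy vertex accounts for more than n/ℓ₁ of the lost pairs, of which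
  -- there are at most n²/ℓ₂.
  few-lossy : ∀ ℓ₁ ℓ₂ → 0 ℕ.< n → ℓ₂ ℕ.* ∑-lost ℕ.≤ n ℕ.* n → ℓ₂ ℕ.* lossy ℓ₁ ℕ.≤ ℓ₁ ℕ.* n
  few-lossy ℓ₁ ℓ₂ 0<n h = cancel-≤ n 0<n (begin
    n ℕ.* (ℓ₂ ℕ.* lossy ℓ₁)          ≡⟨ l n ℓ₂ (lossy ℓ₁) ⟩
    ℓ₂ ℕ.* (n ℕ.* lossy ℓ₁)          ≡⟨ cong (ℓ₂ ℕ.*_) (sym (∑-*ˡ n _)) ⟩
    ℓ₂ ℕ.* ∑ (λ u → n ℕ.* ι (does (n ℕP.<? ℓ₁ ℕ.* lost Adj f R u)))
      ≤⟨ ℕP.*-monoʳ-≤ ℓ₂ (∑-mono λ u → go (n ℕP.<? ℓ₁ ℕ.* lost Adj f R u)) ⟩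
    ℓ₂ ℕ.* ∑ (λ u → ℓ₁ ℕ.* lost Adj f R u) ≡⟨ trans (cong (ℓ₂ ℕ.*_) (∑-*ˡ ℓ₁ _)) (l ℓ₂ ℓ₁ ∑-lost) ⟩
    ℓ₁ ℕ.* (ℓ₂ ℕ.* ∑-lost)           ≤⟨ ℕP.*-monoʳ-≤ ℓ₁ h ⟩
    ℓ₁ ℕ.* (n ℕ.* n)                 ≡⟨ l′ ℓ₁ n ⟩
    n ℕ.* (ℓ₁ ℕ.* n)                 ∎)
    where
    open ℕP.≤-Reasoning
    l : ∀ a b c → a ℕ.* (b ℕ.* c) ≡ b ℕ.* (a ℕ.* c)
    l = ℕ-ring
    l′ : ∀ a n → a ℕ.* (n ℕ.* n) ≡ n ℕ.* (a ℕ.* n)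
    l′ = ℕ-ring
    go : ∀ {x} (d : Dec (n ℕ.< x)) → n ℕ.* ι (does d) ℕ.≤ x
    go (yes p) = ℕP.≤-trans (ℕP.≤-reflexive (ℕP.*-identityʳ n)) (ℕP.<⇒≤ p)
    go (no _)  = ℕP.≤-trans (ℕP.≤-reflexive (ℕP.*-zeroʳ n)) z≤n

-- Rounding the fractional tiling down

module Rounding {K : ℕ} (R : Fin K → Fin K → Bool) (R-sym : ∀ i j → R i j ≡ R j i)
  (ρ W s : ℕ) (0<s : 0 ℕ.< s) (s≤W : s ℕ.≤ W) (b : Fin K → ℕ)
  (t : Fractional.FractionalTiling R R-sym ρ W s 0<s s≤W b) (q₁ : ℕ) where

  open Bottle R R-sym ρ W s 0<s s≤W
  open Fractional R R-sym ρ W s 0<s s≤W b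
  open FractionalTiling t
  open Counting μ x covers

  q : ℕ
  q = suc q₁

  Genuine : Fin #tuples → Set
  Genuine j = ∀ a → tup j a ≢ zero

  genuine? : ∀ j → Dec (Genuine j)
  genuine? j = FinP.all? λ a → ¬? (tup j a Fin.≟ zero)

  instance
    qμ-nonZero : ℕ.NonZero (q ℕ.* μ)
    qμ-nonZero = ℕ.>-nonZero (ℕP.*-mono-< {0} {q} (s≤s z≤n) μ>0)

  y : Fin #tuples → ℕ
  y j = ι (does (genuine? j)) ℕ.* (q₁ ℕ.* x j / (q ℕ.* μ))

  y-upper : ∀ j → q ℕ.* μ ℕ.* y j ℕ.≤ q₁ ℕ.* x j
  y-upper j = go (does (genuine? j))
    where
    go : ∀ g → q ℕ.* μ ℕ.* (ι g ℕ.* (q₁ ℕ.* x j / (q ℕ.* μ))) ℕ.≤ q₁ ℕ.* x j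
    go false = ℕP.≤-trans (ℕP.≤-reflexive (ℕP.*-zeroʳ (q ℕ.* μ))) z≤n
    go true  = ℕP.≤-trans (ℕP.≤-reflexive (trans (cong (q ℕ.* μ ℕ.*_) (ℕP.*-identityˡ _)) (ℕP.*-comm (q ℕ.* μ) _))) (m/n*n≤m (q₁ ℕ.* x j) (q ℕ.* μ))

  -- Rounding costs a genuine bottle at most 1. A discarded bottle has dummy weight at least 1, so
  -- its loss is charged to the dummy use.
  y-lower : ∀ j → q₁ ℕ.* x j ℕ.≤ q ℕ.* μ ℕ.* (y j ℕ.+ 1) ℕ.+ q₁ ℕ.* (x j ℕ.* col j zero)
  y-lower j = go (genuine? j)
    where
    k : ℕ
    k = q₁ ℕ.* x j / (q ℕ.* μ)
    go : (d : Dec (Genuine j)) → q₁ ℕ.* x j ℕ.≤ q ℕ.* μ ℕ.* (ι (does d) ℕ.* k ℕ.+ 1) ℕ.+ q₁ ℕ.* (x j ℕ.* col j zero)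
    go (yes _) = ℕP.≤-trans (ℕP.≤-reflexive (m≡m%n+[m/n]*n (q₁ ℕ.* x j) (q ℕ.* μ))) (ℕP.≤-trans
        (ℕP.+-monoˡ-≤ (k ℕ.* (q ℕ.* μ)) (ℕP.<⇒≤ (m%n<n (q₁ ℕ.* x j) (q ℕ.* μ))))
        (ℕP.≤-trans (ℕP.≤-reflexive (l (q ℕ.* μ) k)) (ℕP.m≤m+n _ _)))
      where
      l : ∀ m k → m ℕ.+ k ℕ.* m ≡ m ℕ.* (1 ℕ.* k ℕ.+ 1)
      l = ℕ-ring
    go (no ¬g) = ℕP.≤-trans (ℕP.*-monoʳ-≤ q₁ (ℕP.≤-trans (ℕP.≤-reflexive (sym (ℕP.*-identityʳ (x j)))) (ℕP.*-monoʳ-≤ (x j) 1≤col)))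
      (ℕP.m≤n+m _ (q ℕ.* μ ℕ.* 1))
      where
      star : ∃[ a ] ¬ (tup j a ≢ zero)
      star = FinP.¬∀⟶∃¬ _ _ (λ a → ¬? (tup j a Fin.≟ zero)) ¬g
      a : Position
      a = proj₁ star
      a≡ : tup j a ≡ zero
      a≡ = decidable-stable (tup j a Fin.≟ zero) (proj₂ star)
      1≤col : 1 ℕ.≤ col j zero
      1≤col = ℕP.≤-trans (coef>0 a) (ℕP.≤-trans (ℕP.≤-reflexive (sym (trans (cong (coef a ℕ.*_) (δ-≡ a≡)) (ℕP.*-identityʳ _))))
        (∑-term (λ a → coef a ℕ.* δ (tup j a) zero) a))

  use : Fin K → ℕ
  use i = ∑ (λ j → y j ℕ.* col j (suc i))

  use≤ : ∀ i → q ℕ.* use i ℕ.≤ q₁ ℕ.* b i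
  use≤ i = cancel-≤ μ μ>0 (begin
    μ ℕ.* (q ℕ.* use i)                                ≡⟨ l₁ μ q (use i) ⟩
    q ℕ.* μ ℕ.* use i                                  ≡⟨ sym (∑-*ˡ (q ℕ.* μ) _) ⟩
    ∑ (λ j → q ℕ.* μ ℕ.* (y j ℕ.* col j (suc i)))      ≡⟨ ∑-cong (λ j → sym (ℕP.*-assoc (q ℕ.* μ) (y j) (col j (suc i)))) ⟩
    ∑ (λ j → q ℕ.* μ ℕ.* y j ℕ.* col j (suc i))        ≤⟨ ∑-mono (λ j → ℕP.*-monoˡ-≤ (col j (suc i)) (y-upper j)) ⟩
    ∑ (λ j → q₁ ℕ.* x j ℕ.* col j (suc i))             ≡⟨ trans (∑-cong λ j → ℕP.*-assoc q₁ (x j) (col j (suc i))) (∑-*ˡ q₁ _) ⟩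
    q₁ ℕ.* ∑ (λ j → x j ℕ.* col j (suc i))             ≡⟨ cong (q₁ ℕ.*_) (covers i) ⟩
    q₁ ℕ.* (μ ℕ.* b i)                                 ≡⟨ l₂ q₁ μ (b i) ⟩
    μ ℕ.* (q₁ ℕ.* b i)                                 ∎)
    where
    open ℕP.≤-Reasoning
    l₁ : ∀ μ q u → μ ℕ.* (q ℕ.* u) ≡ q ℕ.* μ ℕ.* u
    l₁ = ℕ-ring
    l₂ : ∀ q μ u → q ℕ.* (μ ℕ.* u) ≡ μ ℕ.* (q ℕ.* u)
    l₂ = ℕ-ring

  summed : q₁ ℕ.* ∑ x ℕ.≤ q ℕ.* μ ℕ.* (∑ y ℕ.+ #tuples) ℕ.+ q₁ ℕ.* dummyUse x
  summed = subst₂ ℕ._≤_ (∑-*ˡ q₁ x) (trans (∑-+ _ _) (cong₂ ℕ._+_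
      (trans (∑-*ˡ (q ℕ.* μ) _) (cong (q ℕ.* μ ℕ.*_) (trans (∑-+ y (λ _ → 1)) (cong (∑ y ℕ.+_) (trans (∑-const #tuples 1) (ℕP.*-identityʳ #tuples))))))
      (∑-*ˡ q₁ _))) (∑-mono y-lower)

  rounded : ∀ G → dummyUse x ℕ.≤ μ ℕ.* G →
    q ℕ.* ∑ b ℕ.≤ ∑ b ℕ.+ (q ℕ.* (P ℕ.* (∑ y ℕ.+ #tuples)) ℕ.+ q ℕ.* (P ℕ.* G))
  rounded G A≤ = ℕP.+-monoʳ-≤ (∑ b) (cancel-≤ μ μ>0 (begin
    μ ℕ.* (q₁ ℕ.* ∑ b)                    ≡⟨ l₁ μ q₁ (∑ b) ⟩
    q₁ ℕ.* (μ ℕ.* ∑ b)                    ≤⟨ ℕP.*-monoʳ-≤ q₁ (ℕP.m≤m+n _ A) ⟩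
    q₁ ℕ.* (μ ℕ.* ∑ b ℕ.+ A)              ≡⟨ trans (cong (q₁ ℕ.*_) (sym mass)) (l₁ q₁ P (∑ x)) ⟩
    P ℕ.* (q₁ ℕ.* ∑ x)                    ≤⟨ ℕP.*-monoʳ-≤ P (ℕP.≤-trans summed (ℕP.+-monoʳ-≤ (q ℕ.* μ ℕ.* (∑ y ℕ.+ #tuples)) (ℕP.*-mono-≤ (ℕP.n≤1+n q₁) A≤))) ⟩
    P ℕ.* (q ℕ.* μ ℕ.* (∑ y ℕ.+ #tuples) ℕ.+ q ℕ.* (μ ℕ.* G)) ≡⟨ l₂ P q μ (∑ y ℕ.+ #tuples) G ⟩
    μ ℕ.* (q ℕ.* (P ℕ.* (∑ y ℕ.+ #tuples)) ℕ.+ q ℕ.* (P ℕ.* G)) ∎))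
    where
    open ℕP.≤-Reasoning
    A : ℕ
    A = dummyUse x
    l₁ : ∀ μ q u → μ ℕ.* (q ℕ.* u) ≡ q ℕ.* (μ ℕ.* u)
    l₁ = ℕ-ring
    l₂ : ∀ P q μ V G → P ℕ.* (q ℕ.* μ ℕ.* V ℕ.+ q ℕ.* (μ ℕ.* G)) ≡ μ ℕ.* (q ℕ.* (P ℕ.* V) ℕ.+ q ℕ.* (P ℕ.* G))
    l₂ = ℕ-ring

-- Four losses, each at most n after multiplication by 4t: the share 1/q held back, the lossy
-- vertices `l`, the defect `ν`, and the additive terms from rounding. Together they are at most
-- n/t.
budget : ∀ t P m Y l ν n n′ q → q ≡ 4 ℕ.* t → n ≡ n′ ℕ.+ l →
  q ℕ.* n′ ℕ.≤ n′ ℕ.+ (q ℕ.* (P ℕ.* (Y ℕ.+ m)) ℕ.+ q ℕ.* (P ℕ.* (l ℕ.+ P ℕ.* suc ν))) →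
  4 ℕ.* t ℕ.* suc P ℕ.* l ℕ.≤ n → 4 ℕ.* t ℕ.* (P ℕ.* P) ℕ.* ν ℕ.≤ n → 4 ℕ.* t ℕ.* (P ℕ.* m ℕ.+ P ℕ.* P) ℕ.≤ n →
  t ℕ.* n ℕ.≤ n ℕ.+ t ℕ.* (P ℕ.* Y)
budget t P m Y l ν _ n′ _ refl refl r i ii iii = cancel-≤ 4 (s≤s z≤n) (ℕP.≤-trans (ℕP.m≤m+n _ l)
  (≤-certificate (ℕP.+-mono-≤ (ℕP.+-mono-≤ r i) (ℕP.+-mono-≤ ii iii)) (identity t P m Y l ν n′)))
  where
  identity : ∀ t P m Y l ν n′ → (4 ℕ.* (t ℕ.* (n′ ℕ.+ l)) ℕ.+ l) ℕ.+
    (((n′ ℕ.+ (4 ℕ.* t ℕ.* (P ℕ.* (Y ℕ.+ m)) ℕ.+ 4 ℕ.* t ℕ.* (P ℕ.* (l ℕ.+ P ℕ.* suc ν)))) ℕ.+ (n′ ℕ.+ l))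
      ℕ.+ ((n′ ℕ.+ l) ℕ.+ (n′ ℕ.+ l)))
    ≡ 4 ℕ.* ((n′ ℕ.+ l) ℕ.+ t ℕ.* (P ℕ.* Y)) ℕ.+
    ((4 ℕ.* t ℕ.* n′ ℕ.+ 4 ℕ.* t ℕ.* suc P ℕ.* l) ℕ.+ (4 ℕ.* t ℕ.* (P ℕ.* P) ℕ.* ν ℕ.+ 4 ℕ.* t ℕ.* (P ℕ.* m ℕ.+ P ℕ.* P)))
  identity = ℕ-ring

-- Choice of constants and assembly for a fixed colouring

bottle-size : ∀ σ W R {h} → σ ℕ.+ W ≡ h → σ ℕ.* R ℕ.+ R ℕ.* W ≡ R ℕ.* h
bottle-size σ W R refl = trans (cong (ℕ._+ R ℕ.* W) (ℕP.*-comm σ R)) (sym (ℕP.*-distribˡ-+ R σ W))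

module Core {h : ℕ} (H : Fin h → Fin h → Bool) (H-sym : ∀ u v → H u v ≡ H v u) (H-irrefl : ∀ u → H u u ≡ false)
  (ρ : ℕ) (c : Fin h → Fin (suc (suc ρ))) (proper : ∀ u v → H u v ≡ true → c u ≢ c v)
  (σ W : ℕ) (σ-count : # (λ u → does (c u Fin.≟ zero)) ≡ σ) (W-count : # (λ u → not (does (c u Fin.≟ zero))) ≡ W)
  (0<σ : 0 ℕ.< σ) (s≤W : σ ℕ.* suc ρ ℕ.≤ W) (t₁ : ℕ) where

  s P t : ℕ
  s = σ ℕ.* suc ρ
  P = s ℕ.+ suc ρ ℕ.* W
  t = suc t₁

  0<s : 0 ℕ.< s
  0<s = ℕP.*-mono-< 0<σ (s≤s z≤n)

  σ+W≡h : σ ℕ.+ W ≡ h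
  σ+W≡h = trans (cong₂ ℕ._+_ (sym σ-count) (sym W-count)) (#-complement (λ u → does (c u Fin.≟ zero)))

  P≡ : P ≡ suc ρ ℕ.* h
  P≡ = bottle-size σ W (suc ρ) σ+W≡h

  0<P : 0 ℕ.< P
  0<P = ℕP.<-≤-trans 0<s (ℕP.m≤m+n s _)

  -- `q`, `ℓ₁` and `ℓ₂` are dictated by three of the losses in `budget`, `D` by the 6 of
  -- `few-lost-edges`, `N₀` and `E` by `embed`. The summands of `n₀` make the small parts
  -- negligible, pay for the number of tuples, and give P ≤ W·n; its successor gives n > 0.
  q₁ q ℓ₁ ℓ₂ D N₀ E bound n₀ : ℕ
  q₁ = 3 ℕ.+ 4 ℕ.* t₁
  q = suc q₁
  ℓ₁ = 4 ℕ.* t ℕ.* (P ℕ.* P)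
  ℓ₂ = 4 ℕ.* t ℕ.* suc P ℕ.* ℓ₁
  D = 6 ℕ.* ℓ₂
  N₀ = 2 ℕ.* (q ℕ.* D ℕ.^ h)
  E = suc h ℕ.* (q ℕ.* D ℕ.^ h)
  bound = maxSize (suc (E ℕ.* E ℕ.* D)) 1
  n₀ = suc (D ℕ.* (bound ℕ.* N₀) ℕ.+ (4 ℕ.* t ℕ.* (P ℕ.* suc bound ℕ.^ suc (suc ρ) ℕ.+ P ℕ.* P) ℕ.+ P))

  q≡4t : q ≡ 4 ℕ.* t
  q≡4t = l t₁
    where
    l : ∀ t → 4 ℕ.+ 4 ℕ.* t ≡ 4 ℕ.* suc t
    l = ℕ-ring

  0<ℓ₁ : 0 ℕ.< ℓ₁
  0<ℓ₁ = ℕP.*-mono-< {0} {4 ℕ.* t} (s≤s z≤n) (ℕP.*-mono-< 0<P 0<P)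

  0<ℓ₂ : 0 ℕ.< ℓ₂
  0<ℓ₂ = ℕP.*-mono-< (ℕP.*-mono-< {0} {4 ℕ.* t} {0} {suc P} (s≤s z≤n) (s≤s z≤n)) 0<ℓ₁

  2≤D : 2 ℕ.≤ D
  2≤D = ℕP.≤-trans (s≤s (s≤s z≤n)) (ℕP.*-monoʳ-≤ 6 0<ℓ₂)

  record AlmostTiling {n : ℕ} (Adj : Fin n → Fin n → Bool) : Set where
    field
      copies   : ℕ
      φ        : Fin copies → Fin h → Fin n
      edge     : ∀ k u v → H u v ≡ true → Adj (φ k u) (φ k v) ≡ true
      disjoint : ∀ k k′ u u′ → φ k u ≡ φ k′ u′ → k ≡ k′ × u ≡ u′
      covering : t ℕ.* n ℕ.≤ n ℕ.+ t ℕ.* (copies ℕ.* h)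

  module _ {n : ℕ} (n₀≤n : n₀ ℕ.≤ n) (Adj : Fin n → Fin n → Bool) (Adj-sym : ∀ u v → Adj u v ≡ Adj v u)
    (Adj-irrefl : ∀ u → Adj u u ≡ false) (degrees : DegreeCondition Adj P W s)
    (regular : Regularity.Regular Adj E D D bound) where

    open Regularity.Regular regular
    open Regularity Adj E D D using (size; card; Dense; module Labelling)
    open Labelling labelling using (f)
    open ReducedGraph Adj Adj-sym E D N₀ labelling

    0<n : 0 ℕ.< n
    0<n = ℕP.<-≤-trans (s≤s z≤n) n₀≤n

    ν : ℕ
    ν = _/_ n ℓ₁ ⦃ ℕ.>-nonZero 0<ℓ₁ ⦄

    ℓ₁ν≤n : ℓ₁ ℕ.* ν ℕ.≤ n
    ℓ₁ν≤n = ℕP.≤-trans (ℕP.≤-reflexive (ℕP.*-comm ℓ₁ ν)) (m/n*n≤m n ℓ₁ ⦃ ℕ.>-nonZero 0<ℓ₁ ⦄)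

    survives : Fin n → Bool
    survives = kept ℓ₁

    l : ℕ
    l = lossy ℓ₁

    few-lost : ∀ u → survives u ≡ true → lost Adj f R u ℕ.≤ ν
    few-lost u e = ℕP.≤-trans (ℕP.≤-reflexive (sym (m*n/n≡m x ℓ₁ ⦃ ℕ.>-nonZero 0<ℓ₁ ⦄)))
      (/-monoˡ-≤ ℓ₁ ⦃ ℕ.>-nonZero 0<ℓ₁ ⦄ (ℕP.≤-trans (ℕP.≤-reflexive (ℕP.*-comm x ℓ₁)) (kept-lost ℓ₁ u e)))
      where
      x : ℕ
      x = lost Adj f R u

    n≡ : n ≡ # survives ℕ.+ l
    n≡ = trans (sym (#-complement (λ u → does (n ℕP.<? ℓ₁ ℕ.* lost Adj f R u)))) (ℕP.+-comm l (# survives))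

    small-parts : D ℕ.* (K ℕ.* N₀) ℕ.≤ n
    small-parts = ℕP.≤-trans (ℕP.*-monoʳ-≤ D (ℕP.*-monoˡ-≤ N₀ K≤)) (ℕP.≤-trans (ℕP.m≤m+n _ _) (ℕP.≤-trans (ℕP.n≤1+n _) n₀≤n))

    l-small : 4 ℕ.* t ℕ.* suc P ℕ.* l ℕ.≤ n
    l-small = cancel-≤ ℓ₁ 0<ℓ₁ (ℕP.≤-trans (ℕP.≤-reflexive (comm ℓ₁ (4 ℕ.* t ℕ.* suc P) l))
      (few-lossy ℓ₁ ℓ₂ 0<n (few-lost-edges ℓ₂ refl few-bad small-parts)))
      where
      comm : ∀ a b l → a ℕ.* (b ℕ.* l) ≡ b ℕ.* a ℕ.* l
      comm = ℕ-ring

    open DummyBound Adj f R R-sym survives ν few-lost ρ W s 0<s s≤W using (b; ∑b; dummy-bound)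
    open Bottle R R-sym ρ W s 0<s s≤W using (Node; adj; coef)
    open Fractional R R-sym ρ W s 0<s s≤W b using (#tuples; #tuples-def; tup; tup-valid; col; fractional-tiling)
    open Rounding R R-sym ρ W s 0<s s≤W b fractional-tiling q₁ using (y; use; use≤; rounded; Genuine; genuine?)

    1≤W : 1 ℕ.≤ W
    1≤W = ℕP.≤-trans 0<s s≤W

    rest≤n : D ℕ.* (bound ℕ.* N₀) ℕ.+ (4 ℕ.* t ℕ.* (P ℕ.* suc bound ℕ.^ suc (suc ρ) ℕ.+ P ℕ.* P) ℕ.+ P) ℕ.≤ n
    rest≤n = ℕP.≤-trans (ℕP.n≤1+n _) n₀≤n

    P≤Wn : P ℕ.≤ W ℕ.* n
    P≤Wn = ℕP.≤-trans (ℕP.≤-trans (ℕP.m≤n+m P (4 ℕ.* t ℕ.* (P ℕ.* suc bound ℕ.^ suc (suc ρ) ℕ.+ P ℕ.* P))) (ℕP.≤-trans (ℕP.m≤n+m _ (D ℕ.* (bound ℕ.* N₀))) rest≤n)) (x≤c*x W n 1≤W)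

    few-tuples : 4 ℕ.* t ℕ.* (P ℕ.* #tuples ℕ.+ P ℕ.* P) ℕ.≤ n
    few-tuples = ℕP.≤-trans (ℕP.*-monoʳ-≤ (4 ℕ.* t) (ℕP.+-monoˡ-≤ (P ℕ.* P) (ℕP.*-monoʳ-≤ P
        (ℕP.≤-trans (ℕP.≤-reflexive #tuples-def) (ℕP.^-monoˡ-≤ (suc (suc ρ)) (s≤s K≤))))))
      (ℕP.≤-trans (ℕP.≤-trans (ℕP.m≤m+n _ P) (ℕP.m≤n+m _ (D ℕ.* (bound ℕ.* N₀)))) rest≤n)

    covering′ : t ℕ.* n ℕ.≤ n ℕ.+ t ℕ.* (P ℕ.* ∑ y)
    covering′ = budget t P #tuples (∑ y) l ν n (# survives) q q≡4t n≡
      (subst (λ z → q ℕ.* z ℕ.≤ z ℕ.+ (q ℕ.* (P ℕ.* (∑ y ℕ.+ #tuples)) ℕ.+ q ℕ.* (P ℕ.* (l ℕ.+ P ℕ.* suc ν)))) ∑b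
        (rounded (l ℕ.+ P ℕ.* suc ν) (dummy-bound degrees P≤Wn fractional-tiling l n≡)))
      l-small ℓ₁ν≤n few-tuples

    open Rotation ρ using (rotate₀; rotate₀-injective)
    open Unit ρ c {K}
    open Packing Adj Adj-sym Adj-irrefl H H-sym H-irrefl E D D 2≤D f q ℕP.≤-refl

    lower : (x : Node) → x ≢ zero → Fin K
    lower zero    x≢0 = ⊥-elim (x≢0 refl)
    lower (suc i) x≢0 = i

    suc-lower : ∀ (x : Node) (p : x ≢ zero) → suc (lower x p) ≡ x
    suc-lower zero    p = ⊥-elim (p refl)
    suc-lower (suc i) p = refl

    clusters : ∀ j → Genuine j → Fin (suc (suc ρ)) → Fin K
    clusters j g a = lower (tup j a) (g a)

    tasksFrom : ∀ j → Dec (Genuine j) → ℕ → List (Fin h → Fin K)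
    tasksFrom j (yes g) k = repeat k (unit (clusters j g))
    tasksFrom j (no _)  k = []

    tasks : Fin #tuples → List (Fin h → Fin K)
    tasks j = tasksFrom j (genuine? j) (y j)

    usage-tasks : ∀ i j → usage i (tasks j) ≡ y j ℕ.* col j (suc i)
    usage-tasks i j = go (genuine? j) _
      where
      go : (d : Dec (Genuine j)) (k : ℕ) → usage i (tasksFrom j d (ι (does d) ℕ.* k)) ≡ ι (does d) ℕ.* k ℕ.* col j (suc i)
      go (no _)  k = refl
      go (yes g) k = trans (usage-repeat i (1 ℕ.* k) (unit (clusters j g))) (cong (1 ℕ.* k ℕ.*_) (trans (usage-unit (clusters j g) i) (trans
        (cong₂ ℕ._+_ (cong₂ (λ a x → a ℕ.* suc ρ ℕ.* δ x (suc i)) σ-count (suc-lower (tup j zero) (g zero)))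
          (trans (cong₂ ℕ._*_ W-count (∑-cong λ a → cong (λ x → δ x (suc i)) (suc-lower (tup j (suc a)) (g (suc a))))) (sym (∑-*ˡ W _))))
        (sym (∑-∷ _)))))

    length-tasks : ∀ j → List.length (tasks j) ≡ y j ℕ.* suc ρ
    length-tasks j = go (genuine? j) _
      where
      go : (d : Dec (Genuine j)) (k : ℕ) → List.length (tasksFrom j d (ι (does d) ℕ.* k)) ≡ ι (does d) ℕ.* k ℕ.* suc ρ
      go (no _)  k = refl
      go (yes g) k = trans (length-repeat (1 ℕ.* k) (unit (clusters j g))) (cong (1 ℕ.* k ℕ.*_) (length-unit (clusters j g)))

    suitable-tasks : ∀ j → All Suitable (tasks j)
    suitable-tasks j = go (genuine? j) (y j)
      where
      go : (d : Dec (Genuine j)) (k : ℕ) → All Suitable (tasksFrom j d k)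
      go (no _)  k = []
      go (yes g) k = All-repeat k (All-unit (clusters j g) λ r →
          (λ u u′ p → proj₁ (R-ok (joined (λ e → proper u u′ p (rotate₀-injective r e))))) ,
          (λ u → proj₂ (R-ok (joined (proj₂ (other (rotate₀ r (c u))))))))
        where
        joined : ∀ {a a′} → a ≢ a′ → R (clusters j g a) (clusters j g a′) ≡ true
        joined {a} {a′} a≢a′ = trans (cong₂ adj (suc-lower (tup j a) (g a)) (suc-lower (tup j a′) (g a′))) (tup-valid j a a′ a≢a′)
        -- Bigness of a cluster is read off an edge of `R` at it, so each position needs a partner;
        -- r ≥ 2 provides one.
        other : ∀ (a : Fin (suc (suc ρ))) → ∃[ a′ ] a ≢ a′
        other zero    = suc zero , λ ()
        other (suc a) = zero , λ ()

    all-tasks : List (Fin h → Fin K)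
    all-tasks = concatF tasks

    -- By `use≤`, q times the demand is at most q₁·b i, hence at most q₁ times the size of the part;
    -- as q = q₁ + 1, one full size remains.
    room : ∀ i → size f i ℕ.+ q ℕ.* usage i all-tasks ℕ.≤ q ℕ.* card f (λ _ → true) i
    room i = subst₂ (λ a c → size f i ℕ.+ q ℕ.* a ℕ.≤ q ℕ.* c)
      (sym (trans (usage-concatF i tasks) (∑-cong (usage-tasks i)))) (∑-cong λ u → sym (ℕP.*-identityʳ (δ (f u) i)))
      (ℕP.+-monoʳ-≤ (size f i) (ℕP.≤-trans (use≤ i) (ℕP.*-monoʳ-≤ q₁ (∑-mono λ u → go (δ (f u) i) (survives u)))))
      where
      go : ∀ d k → d ℕ.* ι k ℕ.≤ d
      go d true  = ℕP.≤-reflexive (ℕP.*-identityʳ d)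
      go d false = ℕP.≤-trans (ℕP.≤-reflexive (ℕP.*-zeroʳ d)) z≤n

    tiling-from-regular : AlmostTiling Adj
    tiling-from-regular = record { copies = List.length all-tasks ; φ = φ ; edge = edge ; disjoint = disjoint
      ; covering = subst (λ z → t ℕ.* n ℕ.≤ n ℕ.+ t ℕ.* z) total covering′ }
      where
      open Pack (pack (λ _ → true) all-tasks (All-concatF tasks suitable-tasks) room)
      assoc : ∀ r h y → r ℕ.* h ℕ.* y ≡ y ℕ.* r ℕ.* h
      assoc = ℕ-ring
      -- A bottle has weight P = (ρ + 1)·h and its unit consists of ρ + 1 copies of H.
      total : P ℕ.* ∑ y ≡ List.length all-tasks ℕ.* h
      total = trans (cong (ℕ._* ∑ y) P≡) (trans (assoc (suc ρ) h (∑ y)) (cong (ℕ._* h)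
        (sym (trans (length-concatF tasks) (trans (∑-cong length-tasks) (∑-*ʳ (suc ρ) y))))))

  opaque
    almost-tiling : ∀ n → n₀ ℕ.≤ n → (Adj : Fin n → Fin n → Bool) (Adj-sym : ∀ u v → Adj u v ≡ Adj v u)
      (Adj-irrefl : ∀ u → Adj u u ≡ false) → DegreeCondition Adj P W s → AlmostTiling Adj
    almost-tiling n n₀≤n Adj Adj-sym Adj-irrefl degrees = tiling-from-regular n₀≤n Adj Adj-sym Adj-irrefl degrees
      (Regularity.regularize Adj E D D (ℕP.<-≤-trans (s≤s z≤n) n₀≤n))

-- Degree sequences and rationals

countᵇ-tabulate : ∀ {n} {A : Set} (p : A → Bool) (f : Fin n → A) → Vec.countᵇ p (Vec.tabulate f) ≡ # (p ∘ f)
countᵇ-tabulate {zero}  p f = sym (∑-[] _)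
countᵇ-tabulate {suc n} p f = trans (go (p (f zero)) _) (trans (cong (ι (p (f zero)) ℕ.+_) (countᵇ-tabulate p (f ∘ suc))) (sym (∑-∷ _)))
  where
  go : ∀ b k → (if b then suc else id) k ≡ ι b ℕ.+ k
  go true  k = refl
  go false k = refl

degree-# : ∀ {n} (G : Graph n) v → degree G v ≡ # (Graph.Adj G v)
degree-# G v = countᵇ-tabulate (Graph.Adj G v) id

classSize-# : ∀ {h k} (c : Fin h → Fin k) j → classSize c j ≡ # (λ v → does (c v Fin.≟ j))
classSize-# c j = trans (countᵇ-tabulate _ id) (∑-cong λ v → cong ι (isYes≗does (c v Fin.≟ j)))

below : ℕ → List ℕ → ℕ
below d xs = ListAction.sum (List.map (λ x → ι (does (x ℕP.<? d))) xs)

below-↭ : ∀ d {xs ys} → xs ↭ ys → below d xs ≡ below d ys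
below-↭ d p = ListActionP.sum-↭ (PermP.map⁺ _ p)

below-all : ∀ {d xs} → All (d ℕ.≤_) xs → below d xs ≡ 0
below-all []                   = refl
below-all {d} {x ∷ xs} (p ∷ ps) = cong₂ ℕ._+_ (cong ι (dec-false (x ℕP.<? d) (ℕP.≤⇒≯ p))) (below-all ps)

-- In a sorted list, entries smaller than the one at the zero-based position k precede it. Beyond
-- the end `nth` is 0, and nothing lies below 0.
below-nth : ∀ {xs} → AllPairs ℕ._≤_ xs → ∀ k → below (nth xs k) xs ℕ.≤ k
below-nth []                      k       = z≤n
below-nth {x ∷ xs} (x≤ ∷ sorted)  zero    = ℕP.≤-reflexive (below-all (ℕP.≤-refl ∷ x≤))
below-nth {x ∷ xs} (x≤ ∷ sorted)  (suc k) = ℕP.+-mono-≤ (ι≤1 (does (x ℕP.<? nth xs k))) (below-nth sorted k)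

below-tabulate : ∀ {n} d {A : Set} (g : A → ℕ) (f : Fin n → A) →
  below d (Vec.toList (Vec.map g (Vec.tabulate f))) ≡ # (λ v → does (g (f v) ℕP.<? d))
below-tabulate {zero}  d g f = sym (∑-[] _)
below-tabulate {suc n} d g f = trans (cong (ι (does (g (f zero) ℕP.<? d)) ℕ.+_) (below-tabulate d g (f ∘ suc))) (sym (∑-∷ _))

-- The count of entries below a value survives sorting, so the bound for the sorted list holds for
-- the vertices. The shift from i to i - 1 makes it strict.
few-below : ∀ {n} (G : Graph n) i → 1 ℕ.≤ i → # (λ v → does (# (Graph.Adj G v) ℕP.<? Defs.d G i)) ℕ.< i
few-below {n} G (suc k) _ = s≤s (subst (ℕ._≤ k) (trans (below-↭ (Defs.d G (suc k)) (sort-↭ _))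
    (trans (below-tabulate (Defs.d G (suc k)) (degree G) id) (∑-cong λ v → cong (λ x → ι (does (x ℕP.<? Defs.d G (suc k)))) (degree-# G v))))
  (below-nth (LinkedP.Linked⇒AllPairs ℕP.≤-trans (sort-↗ (Vec.toList (Vec.map (degree G) (Vec.allFin n))))) k))
  where open Sort ℕP.≤-decTotalOrder using (sort-↭; sort-↗)

cast-toℚᵘ : ∀ n → ℚ.toℚᵘ (ℕ→ℚ n) ℚᵘ.≃ mkℚᵘ (+ n) 0
cast-toℚᵘ n = ℚP.toℚᵘ-fromℚᵘ (mkℚᵘ (+ n) 0)

cast-+ : ∀ m n → ℕ→ℚ (m ℕ.+ n) ≡ ℕ→ℚ m ℚ.+ ℕ→ℚ n
cast-+ m n = ℚP.toℚᵘ-injective (ℚᵘP.≃-trans (cast-toℚᵘ (m ℕ.+ n)) (ℚᵘP.≃-trans (*≡* e)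
  (ℚᵘP.≃-sym (ℚᵘP.≃-trans (ℚP.toℚᵘ-homo-+ (ℕ→ℚ m) (ℕ→ℚ n)) (ℚᵘP.+-cong (cast-toℚᵘ m) (cast-toℚᵘ n))))))
  where
  l : ∀ x y → (x ℤ.+ y) ℤ.* (1ℤ ℤ.* 1ℤ) ≡ (x ℤ.* 1ℤ ℤ.+ y ℤ.* 1ℤ) ℤ.* 1ℤ
  l = ℤ-ring
  e : + (m ℕ.+ n) ℤ.* + 1 ≡ (+ m ℤ.* + 1 ℤ.+ + n ℤ.* + 1) ℤ.* + 1
  e = l (+ m) (+ n)

cast-* : ∀ m n → ℕ→ℚ (m ℕ.* n) ≡ ℕ→ℚ m ℚ.* ℕ→ℚ n
cast-* m n = ℚP.toℚᵘ-injective (ℚᵘP.≃-trans (cast-toℚᵘ (m ℕ.* n)) (ℚᵘP.≃-trans (*≡* (cong (ℤ._* + 1) (ℤP.pos-* m n)))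
  (ℚᵘP.≃-sym (ℚᵘP.≃-trans (ℚP.toℚᵘ-homo-* (ℕ→ℚ m) (ℕ→ℚ n)) (ℚᵘP.*-cong (cast-toℚᵘ m) (cast-toℚᵘ n))))))

cast-mono : ∀ {m n} → m ℕ.≤ n → ℕ→ℚ m ℚ.≤ ℕ→ℚ n
cast-mono {m} {n} p = ℚP.toℚᵘ-cancel-≤ (ℚᵘP.≤-respˡ-≃ (ℚᵘP.≃-sym (cast-toℚᵘ m)) (ℚᵘP.≤-respʳ-≃ (ℚᵘP.≃-sym (cast-toℚᵘ n))
  (*≤* (ℤP.*-monoʳ-≤-nonNeg (+ 1) (ℤ.+≤+ p)))))

cast-cancel : ∀ {m n} → ℕ→ℚ m ℚ.≤ ℕ→ℚ n → m ℕ.≤ n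
cast-cancel {m} {n} p with ℚᵘP.≤-respˡ-≃ (cast-toℚᵘ m) (ℚᵘP.≤-respʳ-≃ (cast-toℚᵘ n) (ℚP.toℚᵘ-mono-≤ p))
... | *≤* q = ℤP.drop‿+≤+ (subst₂ ℤ._≤_ (ℤP.*-identityʳ (+ m)) (ℤP.*-identityʳ (+ n)) q)

cast-positive : ∀ {n} → 0 ℕ.< n → ℚ.Positive (ℕ→ℚ n)
cast-positive {n} p = ℚ.positive (ℚP.toℚᵘ-cancel-< (ℚᵘP.<-respʳ-≃ (ℚᵘP.≃-sym (cast-toℚᵘ n))
  (*<* (subst (0ℤ ℤ.<_) (sym (ℤP.*-identityʳ (+ n))) (ℤ.+<+ p)))))

pos⇒≢0 : ∀ {q} → ℚ.Positive q → q ≢ 0ℚ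
pos⇒≢0 p refl = ℚP.<-irrefl refl (ℚP.positive⁻¹ 0ℚ ⦃ p ⦄)

÷₀-cancel : ∀ p {q} → q ≢ 0ℚ → (p ÷₀ q) ℚ.* q ≡ p
÷₀-cancel p {q} q≢0 with q ℚP.≟ 0ℚ
... | yes e = ⊥-elim (q≢0 e)
... | no ne = trans (ℚP.*-assoc p _ q) (trans (cong (p ℚ.*_) (ℚP.*-inverseˡ q ⦃ ℚ.≢-nonZero ne ⦄)) (ℚP.*-identityʳ p))

-- Any natural t with 1/t ≤ η will do; the denominator of η is one.
below-η : ∀ η → 0ℚ ℚ.< η → ∀ x n → ℚ.↧ₙ η ℕ.* x ℕ.≤ n → ℕ→ℚ x ℚ.≤ η ℚ.* ℕ→ℚ n
below-η η@(ℚ.mkℚ (+ suc p) t₁ _) η>0 x n le = ℚP.toℚᵘ-cancel-≤ (ℚᵘP.≤-respˡ-≃ (ℚᵘP.≃-sym (cast-toℚᵘ x))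
  (ℚᵘP.≤-respʳ-≃ (ℚᵘP.≃-sym (ℚᵘP.≃-trans (ℚP.toℚᵘ-homo-* η (ℕ→ℚ n)) (ℚᵘP.*-cong (ℚᵘP.≃-refl {ℚ.toℚᵘ η}) (cast-toℚᵘ n))))
    (*≤* (subst₂ ℤ._≤_ (ℤP.pos-* x (suc t₁ ℕ.* 1)) (trans (ℤP.pos-* (suc p ℕ.* n) 1) (cong (ℤ._* + 1) (ℤP.pos-* (suc p) n)))
      (ℤ.+≤+ le′)))))
  where
  le′ : x ℕ.* (suc t₁ ℕ.* 1) ℕ.≤ suc p ℕ.* n ℕ.* 1
  le′ = ℕP.≤-trans (ℕP.≤-reflexive (trans (cong (x ℕ.*_) (ℕP.*-identityʳ (suc t₁))) (ℕP.*-comm x (suc t₁))))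
    (ℕP.≤-trans le (ℕP.≤-trans (ℕP.m≤m+n n (p ℕ.* n)) (ℕP.≤-reflexive (sym (ℕP.*-identityʳ _)))))
below-η (ℚ.mkℚ (+ 0)      _ _) η>0 x n le = ⊥-elim (ℚP.<-irrefl refl (ℚP.<-≤-trans η>0 (ℚ.*≤* (ℤ.+≤+ z≤n))))
below-η (ℚ.mkℚ (ℤ.-[1+ _ ]) _ _) η>0 x n le = ⊥-elim (ℚP.<-irrefl refl (ℚP.<-≤-trans η>0 (ℚ.*≤* ℤ.-≤+)))

-- For w = ω, A = (ω + σ)/h and B = σ/ω the last factor vanishes. Leaving A and B free keeps
-- division out of the polynomial identity.
degree-identity : ∀ (R h w B A n i : ℚ) →
  (R ℚ.* h) ℚ.* (w ℚ.* R) ℚ.* ((1ℚ ℚ.- A) ℚ.* n ℚ.+ B ℚ.* i)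
    ℚ.+ (w ℚ.* R) ℚ.* (w ℚ.* R ℚ.+ (B ℚ.* w) ℚ.* R) ℚ.* n
  ≡ ((R ℚ.* h) ℚ.* (w ℚ.* R) ℚ.* n ℚ.+ (R ℚ.* h) ℚ.* ((B ℚ.* w) ℚ.* R) ℚ.* i)
    ℚ.+ R ℚ.* (w ℚ.* R) ℚ.* n ℚ.* ((w ℚ.+ B ℚ.* w) ℚ.- A ℚ.* h)
degree-identity = solve 7 (λ R h w B A n i →
  (R :* h) :* (w :* R) :* ((con 1ℚ :- A) :* n :+ B :* i) :+ (w :* R) :* (w :* R :+ (B :* w) :* R) :* n
  := ((R :* h) :* (w :* R) :* n :+ (R :* h) :* ((B :* w) :* R) :* i)
    :+ R :* (w :* R) :* n :* ((w :+ B :* w) :- A :* h)) refl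
  where open ℚSolver.+-*-Solver

module DegreeTranslation (h ρ σ W : ℕ) (h≡ : σ ℕ.+ W ≡ h) (0<W : 0 ℕ.< W) where

  R s P : ℕ
  R = suc ρ
  s = σ ℕ.* R
  P = s ℕ.+ R ℕ.* W

  P≡ : P ≡ R ℕ.* h
  P≡ = bottle-size σ W R h≡

  ω A B : ℚ
  ω = ℕ→ℚ W ÷₀ ℕ→ℚ R
  A = (ω ℚ.+ ℕ→ℚ σ) ÷₀ ℕ→ℚ h
  B = ℕ→ℚ σ ÷₀ ω

  0<h : 0 ℕ.< h
  0<h = subst (0 ℕ.<_) h≡ (ℕP.<-≤-trans 0<W (ℕP.m≤n+m W σ))

  h≢0 : ℕ→ℚ h ≢ 0ℚ
  h≢0 = pos⇒≢0 {ℕ→ℚ h} (cast-positive 0<h)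

  ωR : ω ℚ.* ℕ→ℚ R ≡ ℕ→ℚ W
  ωR = ÷₀-cancel (ℕ→ℚ W) {ℕ→ℚ R} (pos⇒≢0 {ℕ→ℚ R} (cast-positive {R} (s≤s z≤n)))

  ω≢0 : ω ≢ 0ℚ
  ω≢0 e = pos⇒≢0 (cast-positive 0<W) (trans (sym ωR) (trans (cong (ℚ._* ℕ→ℚ R) e) (ℚP.*-zeroˡ (ℕ→ℚ R))))

  Ah : A ℚ.* ℕ→ℚ h ≡ ω ℚ.+ ℕ→ℚ σ
  Ah = ÷₀-cancel (ω ℚ.+ ℕ→ℚ σ) {ℕ→ℚ h} h≢0

  Bω : B ℚ.* ω ≡ ℕ→ℚ σ
  Bω = ÷₀-cancel (ℕ→ℚ σ) {ω} ω≢0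

  cast-P : ℕ→ℚ P ≡ ℕ→ℚ R ℚ.* ℕ→ℚ h
  cast-P = trans (cong ℕ→ℚ P≡) (cast-* R h)

  cast-s : ℕ→ℚ s ≡ (B ℚ.* ω) ℚ.* ℕ→ℚ R
  cast-s = trans (cast-* σ R) (cong (ℚ._* ℕ→ℚ R) (sym Bω))

  -- Multiplication by P turns ωn/h into W·n, since P = R·h and ω·R = W.
  in-range : ∀ n i → P ℕ.* i ℕ.≤ W ℕ.* n → ℕ→ℚ i ℚ.≤ (ω ℚ.* ℕ→ℚ n) ÷₀ ℕ→ℚ h
  in-range n i le = ℚP.*-cancelʳ-≤-pos (ℕ→ℚ P) ⦃ cast-positive 0<P ⦄ (subst₂ ℚ._≤_ lhs rhs (cast-mono le))
    where
    0<P : 0 ℕ.< P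
    0<P = ℕP.<-≤-trans (ℕP.*-mono-< {0} {R} (s≤s z≤n) 0<W) (ℕP.m≤n+m (R ℕ.* W) s)
    C : ℚ
    C = (ω ℚ.* ℕ→ℚ n) ÷₀ ℕ→ℚ h
    lhs : ℕ→ℚ (P ℕ.* i) ≡ ℕ→ℚ i ℚ.* ℕ→ℚ P
    lhs = trans (cast-* P i) (ℚP.*-comm (ℕ→ℚ P) (ℕ→ℚ i))
    rearrange : ∀ w r n → w ℚ.* r ℚ.* n ≡ w ℚ.* n ℚ.* r
    rearrange = solve 3 (λ w r n → w :* r :* n := w :* n :* r) refl
      where open ℚSolver.+-*-Solver
    rearrange′ : ∀ c h r → c ℚ.* h ℚ.* r ≡ c ℚ.* (r ℚ.* h)
    rearrange′ = solve 3 (λ c h r → c :* h :* r := c :* (r :* h)) refl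
      where open ℚSolver.+-*-Solver
    rhs : ℕ→ℚ (W ℕ.* n) ≡ C ℚ.* ℕ→ℚ P
    rhs = trans (cast-* W n) (trans (cong (ℚ._* ℕ→ℚ n) (sym ωR)) (trans (rearrange ω (ℕ→ℚ R) (ℕ→ℚ n))
      (trans (cong (ℚ._* ℕ→ℚ R) (sym (÷₀-cancel (ω ℚ.* ℕ→ℚ n) {ℕ→ℚ h} h≢0)))
        (trans (rearrange′ C (ℕ→ℚ h) (ℕ→ℚ R)) (cong (C ℚ.*_) (sym cast-P))))))

  degree-bound : ∀ n i d → (1ℚ ℚ.- A) ℚ.* ℕ→ℚ n ℚ.+ B ℚ.* ℕ→ℚ i ℚ.≤ ℕ→ℚ d →
    P ℕ.* W ℕ.* n ℕ.+ P ℕ.* s ℕ.* i ℕ.≤ P ℕ.* W ℕ.* d ℕ.+ W ℕ.* (W ℕ.+ s) ℕ.* n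
  degree-bound n i d le = cast-cancel (subst₂ ℚ._≤_ lhs rhs
    (ℚP.+-monoˡ-≤ (W̄ ℚ.* (W̄ ℚ.+ s̄) ℚ.* n̄) (ℚP.*-monoˡ-≤-nonNeg (P̄ ℚ.* W̄) ⦃ nonNeg ⦄ le)))
    where
    P̄ W̄ s̄ n̄ ī d̄ : ℚ
    P̄ = ℕ→ℚ P
    W̄ = ℕ→ℚ W
    s̄ = ℕ→ℚ s
    n̄ = ℕ→ℚ n
    ī = ℕ→ℚ i
    d̄ = ℕ→ℚ d
    nonNeg : ℚ.NonNegative (P̄ ℚ.* W̄)
    nonNeg = ℚ.nonNegative (subst (0ℚ ℚ.≤_) (cast-* P W) (cast-mono {0} {P ℕ.* W} z≤n))
    cast₃ : ∀ a b c → ℕ→ℚ (a ℕ.* b ℕ.* c) ≡ ℕ→ℚ a ℚ.* ℕ→ℚ b ℚ.* ℕ→ℚ c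
    cast₃ a b c = trans (cast-* (a ℕ.* b) c) (cong (ℚ._* ℕ→ℚ c) (cast-* a b))
    rhs : P̄ ℚ.* W̄ ℚ.* d̄ ℚ.+ W̄ ℚ.* (W̄ ℚ.+ s̄) ℚ.* n̄ ≡ ℕ→ℚ (P ℕ.* W ℕ.* d ℕ.+ W ℕ.* (W ℕ.+ s) ℕ.* n)
    rhs = sym (trans (cast-+ (P ℕ.* W ℕ.* d) _) (cong₂ ℚ._+_ (cast₃ P W d)
      (trans (cast₃ W (W ℕ.+ s) n) (cong (λ z → W̄ ℚ.* z ℚ.* n̄) (cast-+ W s)))))
    vanishing : (ω ℚ.+ B ℚ.* ω) ℚ.- A ℚ.* ℕ→ℚ h ≡ 0ℚ
    vanishing = trans (cong₂ (λ x y → (ω ℚ.+ x) ℚ.- y) Bω Ah) (ℚP.+-inverseʳ (ω ℚ.+ ℕ→ℚ σ))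
    drop-last : ∀ x y {z} → z ≡ 0ℚ → x ℚ.+ y ℚ.* z ≡ x
    drop-last x y refl = trans (cong (λ t → x ℚ.+ t) (ℚP.*-zeroʳ y)) (ℚP.+-identityʳ x)
    expand : ∀ {p w s} → p ≡ ℕ→ℚ R ℚ.* ℕ→ℚ h → w ≡ ω ℚ.* ℕ→ℚ R → s ≡ (B ℚ.* ω) ℚ.* ℕ→ℚ R →
      p ℚ.* w ℚ.* ((1ℚ ℚ.- A) ℚ.* n̄ ℚ.+ B ℚ.* ī) ℚ.+ w ℚ.* (w ℚ.+ s) ℚ.* n̄ ≡ p ℚ.* w ℚ.* n̄ ℚ.+ p ℚ.* s ℚ.* ī
    expand refl refl refl = trans (degree-identity (ℕ→ℚ R) (ℕ→ℚ h) ω B A n̄ ī) (drop-last _ (ℕ→ℚ R ℚ.* (ω ℚ.* ℕ→ℚ R) ℚ.* n̄) vanishing)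
    lhs : P̄ ℚ.* W̄ ℚ.* ((1ℚ ℚ.- A) ℚ.* n̄ ℚ.+ B ℚ.* ī) ℚ.+ W̄ ℚ.* (W̄ ℚ.+ s̄) ℚ.* n̄
      ≡ ℕ→ℚ (P ℕ.* W ℕ.* n ℕ.+ P ℕ.* s ℕ.* i)
    lhs = trans (expand {P̄} {W̄} {s̄} cast-P (sym ωR) cast-s)
      (sym (trans (cast-+ (P ℕ.* W ℕ.* n) _) (cong₂ ℚ._+_ (cast₃ P W n) (cast₃ P s i))))

  degree-condition : ∀ {n} (G : Graph n) →
    (∀ i → 1 ℕ.≤ i → ℕ→ℚ i ℚ.≤ (ω ℚ.* ℕ→ℚ n) ÷₀ ℕ→ℚ h →
      (1ℚ ℚ.- A) ℚ.* ℕ→ℚ n ℚ.+ B ℚ.* ℕ→ℚ i ℚ.≤ ℕ→ℚ (Defs.d G i)) → DegreeCondition (Graph.Adj G) P W s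
  degree-condition {n} G hyp i 1≤i le = Defs.d G i , few-below G i 1≤i ,
    degree-bound n i (Defs.d G i) (hyp i 1≤i (in-range n i le))

-- Minimal colour classes and the final statement

transpose-injective : ∀ {n} (i j : Fin n) {k k′} → PC.transpose i j k ≡ PC.transpose i j k′ → k ≡ k′
transpose-injective i j e = trans (sym (PC.transpose-inverse j i)) (trans (cong (PC.transpose j i) e) (PC.transpose-inverse j i))

transpose-target : ∀ {n} (i j k : Fin n) → does (PC.transpose i j k Fin.≟ j) ≡ does (k Fin.≟ i)
transpose-target i j k = go (k Fin.≟ i)
  where
  hit : PC.transpose i j i ≡ j
  hit with does (i Fin.≟ i) | dec-true (i Fin.≟ i) refl
  ... | true | _ = refl
  go : (d : Dec (k ≡ i)) → does (PC.transpose i j k Fin.≟ j) ≡ does d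
  go (yes refl) = dec-true (PC.transpose i j i Fin.≟ j) hit
  go (no k≢i)   = dec-false (PC.transpose i j k Fin.≟ j) λ e → k≢i (transpose-injective i j (trans e (sym hit)))

module _ {h : ℕ} (H : Graph h) (ρ : ℕ) (chromatic : IsChromaticNumber H (suc (suc ρ))) where

  -- Punching out an empty class would colour H with r - 1 colours.
  classes-nonempty : ∀ c → ProperColouring H (suc (suc ρ)) c → ∀ j → 0 ℕ.< classSize c j
  classes-nonempty c proper j = ℕP.n≢0⇒n>0 λ empty → proj₂ chromatic (suc ρ) (ℕP.n<1+n _) (recolour λ v e →
    ℕP.<⇒≱ {0} {1} (s≤s z≤n) (ℕP.≤-trans (ℕP.≤-reflexive (sym (cong ι (dec-true (c v Fin.≟ j) e))))
      (ℕP.≤-trans (∑-term (λ v → ι (does (c v Fin.≟ j))) v) (ℕP.≤-reflexive (trans (sym (classSize-# c j)) empty)))))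
    where
    recolour : (∀ v → c v ≢ j) → Colourable H (suc ρ)
    recolour avoid = (λ v → Fin.punchOut (avoid v ∘ sym)) , λ u v uv e →
      proper u v uv (FinP.punchOut-injective (avoid u ∘ sym) (avoid v ∘ sym) e)

  -- Each of the r - 1 remaining classes has at least σ vertices. This is σ ≤ ω, the inequality s ≤
  -- W that the bottles rely on.
  other-classes : ∀ σ → (∀ c → ProperColouring H (suc (suc ρ)) c → ∀ j → σ ℕ.≤ classSize c j) →
    ∀ c → ProperColouring H (suc (suc ρ)) c → σ ℕ.* suc ρ ℕ.≤ # (λ u → not (does (c u Fin.≟ zero)))
  other-classes σ minimal c proper = begin
    σ ℕ.* suc ρ                                      ≡⟨ trans (ℕP.*-comm σ (suc ρ)) (sym (∑-const (suc ρ) σ)) ⟩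
    ∑ {suc ρ} (λ _ → σ)                              ≤⟨ ∑-mono (λ k → ℕP.≤-trans (minimal c proper (suc k)) (ℕP.≤-reflexive (classSize-# c (suc k)))) ⟩
    ∑ {suc ρ} (λ k → ∑ (λ u → δ (c u) (suc k)))      ≡⟨ ∑-swap {suc ρ} _ ⟩
    ∑ (λ u → ∑ {suc ρ} (λ k → δ (c u) (suc k)))      ≡⟨ ∑-cong (λ u → class (c u)) ⟩
    # (λ u → not (does (c u Fin.≟ zero)))            ∎
    where
    open ℕP.≤-Reasoning
    class : ∀ (a : Fin (suc (suc ρ))) → ∑ {suc ρ} (λ k → δ a (suc k)) ≡ ι (not (does (a Fin.≟ zero)))
    class zero    = ∑-zero {suc ρ} _ λ k → refl
    class (suc k) = ∑-δ₁ k

Conclusion : ℚ → ∀ {h} → Graph h → ℕ → ℕ → Set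
Conclusion η {h} H r σ = ∃[ n₀ ] ∀ n → n₀ ℕ.≤ n → (G : Graph n) →
  (∀ i → 1 ℕ.≤ i → ℕ→ℚ i ℚ.≤ (ω ℚ.* ℕ→ℚ n) ÷₀ ℕ→ℚ h →
    ((1ℚ ℚ.- ((ω ℚ.+ ℕ→ℚ σ) ÷₀ ℕ→ℚ h)) ℚ.* ℕ→ℚ n ℚ.+ (ℕ→ℚ σ ÷₀ ω) ℚ.* ℕ→ℚ i) ℚ.≤ ℕ→ℚ (Defs.d G i)) →
  Σ[ T ∈ Tiling H G ] ℕ→ℚ (n ℕ.∸ covered T) ℚ.≤ η ℚ.* ℕ→ℚ n
  where
  ω : ℚ
  ω = ℕ→ℚ (h ℕ.∸ σ) ÷₀ ℕ→ℚ (r ℕ.∸ 1)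

tiling-theorem : (η : ℚ) → 0ℚ ℚ.< η → ∀ {h} (H : Graph h) → HasEdge H → (r σ : ℕ) →
  IsChromaticNumber H r → IsSigma H r σ → Conclusion η H r σ
-- An edge supplies a vertex to colour and two ends that need different colours, so r is at least 2.
tiling-theorem η η>0 H (u , v , uv) zero σ ((c , _) , _) _ = ⊥-elim (FinP.¬Fin0 (c u))
tiling-theorem η η>0 H (u , v , uv) (suc zero) σ ((c , proper) , _) _ = ⊥-elim (proper u v uv (unique (c u) (c v)))
  where
  unique : ∀ (a b : Fin 1) → a ≡ b
  unique zero zero = refl
tiling-theorem η η>0 {h} H _ (suc (suc ρ)) σ chromatic ((c₀ , proper₀ , j₀ , size₀) , minimal) =
  n₀ , λ n n₀≤n G hyp → finish G (almost-tiling n n₀≤n (Graph.Adj G) (Graph.sym G) (Graph.irrefl G)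
    (degree-condition G hyp))
  where
  -- Colours are exchanged so that a class of size σ gets colour zero, the pointed position of a
  -- bottle.
  c : Fin h → Fin (suc (suc ρ))
  c u = PC.transpose j₀ zero (c₀ u)
  proper : ProperColouring H (suc (suc ρ)) c
  proper u v uv e = proper₀ u v uv (transpose-injective j₀ zero e)
  σ-count : # (λ u → does (c u Fin.≟ zero)) ≡ σ
  σ-count = trans (∑-cong λ u → cong ι (transpose-target j₀ zero (c₀ u))) (trans (sym (classSize-# c₀ j₀)) size₀)
  W : ℕ
  W = h ℕ.∸ σ
  complement : # (λ u → does (c u Fin.≟ zero)) ℕ.+ # (λ u → not (does (c u Fin.≟ zero))) ≡ h
  complement = #-complement (λ u → does (c u Fin.≟ zero))
  W-count : # (λ u → not (does (c u Fin.≟ zero))) ≡ W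
  W-count = sym (trans (cong₂ ℕ._∸_ (sym complement) (sym σ-count)) (ℕP.m+n∸m≡n (# (λ u → does (c u Fin.≟ zero))) _))
  σ+W≡h : σ ℕ.+ W ≡ h
  σ+W≡h = trans (cong₂ ℕ._+_ (sym σ-count) (sym W-count)) complement
  0<σ : 0 ℕ.< σ
  0<σ = subst (0 ℕ.<_) size₀ (classes-nonempty H ρ chromatic c₀ proper₀ j₀)
  s≤W : σ ℕ.* suc ρ ℕ.≤ W
  s≤W = ℕP.≤-trans (other-classes H ρ chromatic σ minimal c proper) (ℕP.≤-reflexive W-count)
  0<W : 0 ℕ.< W
  0<W = ℕP.<-≤-trans (ℕP.*-mono-< 0<σ (s≤s z≤n)) s≤W
  open Core (Graph.Adj H) (Graph.sym H) (Graph.irrefl H) ρ c proper σ W σ-count W-count 0<σ s≤W (ℚ.ℚ.denominator-1 η)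
    using (n₀; almost-tiling; AlmostTiling; t)
  open DegreeTranslation h ρ σ W σ+W≡h 0<W using (degree-condition)
  finish : ∀ {n} (G : Graph n) → AlmostTiling (Graph.Adj G) →
    Σ[ T ∈ Tiling H G ] ℕ→ℚ (n ℕ.∸ covered T) ℚ.≤ η ℚ.* ℕ→ℚ n
  finish {n} G tiling = record { copies = copies ; embed = φ ; edges = edge ; disjoint = disjoint } ,
    below-η η η>0 (n ℕ.∸ copies ℕ.* h) n (ℕP.≤-trans (ℕP.≤-reflexive (ℕP.*-distribˡ-∸ t n (copies ℕ.* h)))
      (ℕP.m≤n+o⇒m∸n≤o (t ℕ.* n) (t ℕ.* (copies ℕ.* h)) (ℕP.≤-trans covering (ℕP.≤-reflexive (ℕP.+-comm n _)))))
    where open AlmostTiling tiling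

open import Defs
open import Data.Nat using (ℕ; _≤_; _∸_)
open import Data.Product using (∃-syntax; Σ-syntax)
open import Data.Rational using (ℚ; 0ℚ; 1ℚ; _+_; _-_; _*_) renaming (_≤_ to _≤ℚ_; _<_ to _<ℚ_)

theorem1p4 : (η : ℚ) → 0ℚ <ℚ η →
    ∀ {h} (H : Graph h) → HasEdge H →
    (r σ : ℕ) → IsChromaticNumber H r → IsSigma H r σ →
    let ω = ℕ→ℚ (h ∸ σ) ÷₀ ℕ→ℚ (r ∸ 1) in
    ∃[ n₀ ] ∀ n → n₀ ≤ n → (G : Graph n) →
    (∀ i → 1 ≤ i → ℕ→ℚ i ≤ℚ (ω * ℕ→ℚ n) ÷₀ ℕ→ℚ h →
    ((1ℚ - ((ω + ℕ→ℚ σ) ÷₀ ℕ→ℚ h)) * ℕ→ℚ n + (ℕ→ℚ σ ÷₀ ω) * ℕ→ℚ i) ≤ℚ ℕ→ℚ (d G i)) →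
    Σ[ T ∈ Tiling H G ] ℕ→ℚ (n ∸ covered T) ≤ℚ η * ℕ→ℚ n
theorem1p4 = tiling-theorem
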